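{- Define, for every integer $r\geqslant 2$, $m(r)=2^{(r+2)/2}-2$ if $r$ is even and $m(r)=5\cdot 2^{(r-3)/2}-2$ if $r$ is odd. Suppose that for every integer $r$ with $2\leqslant r\leqslant 46$, every reduced graph of rank $r$ has at most $m(r)$ vertices. Then for every integer $r\geqslant 2$, every reduced graph of rank $r$ has at most $m(r)$ vertices.
   Context: All graphs are finite and simple. The rank of a graph is the rank over $\mathbb{R}$ of its adjacency matrix. A graph is reduced if it has no isolated vertices and no two distinct vertices with the same set of neighbors. -}

module Defs where

open import Data.Nat as ℕ using (ℕ; zero; suc; _∸_; _^_; _≡ᵇ_; _%_; _/_)
open import Data.Bool using (Bool; true; false; if_then_else_)
open import Data.Fin using (Fin; zero; suc)
open import Data.Rational as ℚ using (ℚ; 0ℚ; 1ℚ)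
open import Data.Product using (Σ; ∃; _×_)
open import Relation.Binary.PropositionalEquality using (_≡_; _≢_)
open import Relation.Nullary using (¬_)

record Graph (n : ℕ) : Set where
  field
    adj   : Fin n → Fin n → Bool
    sym   : ∀ i j → adj i j ≡ adj j i
    irrefl : ∀ i → adj i i ≡ false
open Graph public

Reduced : ∀ {n} → Graph n → Set
Reduced {n} G =
  (∀ i → ∃ λ j → adj G i j ≡ true) ×
  (∀ i j → i ≢ j → ∃ λ k → adj G i k ≢ adj G j k)

entry : Bool → ℚ
entry true  = 1ℚ
entry false = 0ℚ

Σ[_] : ∀ k → (Fin k → ℚ) → ℚ
Σ[ zero  ] f = 0ℚ
Σ[ suc k ] f = f zero ℚ.+ Σ[ k ] (λ i → f (suc i))

LinIndep : ∀ {k n} → (Fin k → Fin n → ℚ) → Set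
LinIndep {k} {n} v =
  (c : Fin k → ℚ) → (∀ j → Σ[ k ] (λ i → c i ℚ.* v i j) ≡ 0ℚ) → ∀ i → c i ≡ 0ℚ

row : ∀ {n} → Graph n → Fin n → Fin n → ℚ
row G i j = entry (adj G i j)

HasRank : ∀ {n} → Graph n → ℕ → Set
HasRank {n} G r =
  (∃ λ (f : Fin r → Fin n) → LinIndep (λ i → row G (f i))) ×
  (∀ (g : Fin (suc r) → Fin n) → ¬ LinIndep (λ i → row G (g i)))

m : ℕ → ℕ
m r = if r % 2 ≡ᵇ 0
      then 2 ^ ((r ℕ.+ 2) / 2) ∸ 2
      else 5 ℕ.* 2 ^ ((r ∸ 3) / 2) ∸ 2

{-# OPTIONS --safe #-}

-- Take a counterexample G of least rank r ≥ 47 with n > m(r) vertices.  The ±1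
-- rows of the adjacency matrix lie in a space of dimension D = r + 1, and the
-- Hamming distances of the rows determine their inner products n - 2 d(u,v).
--
-- Let C be a largest vertex set inducing rank at most r - 2, and t = n - |C|.
-- Deleting the support of an isotropic vector of the row space drops the rank by
-- two, so nonadjacent vertices have distance at least t and the three distances
-- within a triple sum to at least 2t; by minimality of r, any two vertices have
-- distance at least t or n - m(r - 1).  Vertices with equal rows on C come in
-- pairs of opposite rows outside C with one common pattern, which makes the sets
-- X true and X false of such vertices induce small rank, hence be small.
--
-- If t ≤ n - m(r - 1), all distances are at least t and a Plotkin-type bound for
-- ±1 vectors bounds t, hence n, contradicting n > m(r).  Otherwise all pairs are
-- well separated, all triples satisfy Σ d ≥ (599/600) n, and only boundedly many
-- vertices lie in a cap around a given one.  The polynomial t^2k (t - s)(t + s)²,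
-- with the moments of the Gram matrix bounded below as for spherical designs,
-- then bounds n by a quantity smaller than m(r): a finite computation for
-- r ≤ 240 and a uniform estimate with k ≈ r/8 afterwards.

module Submission where

open import Defs using (Graph; adj; Reduced; HasRank; m)

-- The polynomial bound needs few rows close to any given row, and the combinatorial part exists to
-- ensure that. For even r, n > m(r) and d ≥ n - m(r-1) alone give d ≥ (3/8)n, so three distances
-- sum to (9/8)n. For odd r they give only d ≥ n/5, and the inequality Σ d ≥ 2t suffices only if t
-- is almost n/2. The deficit of 2t from n is at most 2|X true|. Here the twins enter: at least t/2
-- vertices outside the core have constant adjacency to X true, so their differences contain about
-- r/2 independent rows vanishing on X true. Hence X true induces rank about r/2 and has at most
-- n/1200 vertices; this is the origin of 599/600.
--
-- Projecting a cap orthogonally to its centre turns the triple inequality into an upper bound on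
-- inner products. It is negative when the cap starts a little above √2 - 1, which leaves room for
-- constantly many vertices; a cap starting lower is treated with a cubic polynomial.
--
-- The argument stays over ℚ: subspaces are projections, not orthonormal bases, and lengths occur
-- only squared.

module RatSum where

  -- Rational arithmetic and finite sums.

  open import Data.Nat as ℕ using (ℕ; zero; suc)
  open import Data.Fin using (Fin; zero; suc)
  import Data.Rational as ℚ
  open ℚ using (ℚ)
  import Data.Rational.Properties as ℚP
  open import Data.Maybe using (Maybe; just; nothing)
  open import Data.Sum using (_⊎_; inj₁; inj₂)
  open import Relation.Nullary using (Dec; yes; no; ¬_)
  open import Relation.Nullary.Negation using (contradiction)
  open import Relation.Binary.PropositionalEquality
  open import Tactic.RingSolver using (solve-∀)
  open import Tactic.RingSolver.Core.AlmostCommutativeRing using (AlmostCommutativeRing; fromCommutativeRing)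

  ℚ-ring : AlmostCommutativeRing _ _
  ℚ-ring = fromCommutativeRing ℚP.+-*-commutativeRing isZero
    where
    isZero : (x : ℚ) → Maybe (ℚ.0ℚ ≡ x)
    isZero x with ℚ.0ℚ ℚP.≟ x
    ... | yes p = just p
    ... | no _  = nothing

  -- The field of rationals is kept opaque: the operations of ℚ unfold on
  -- variables, which defeats unification.

  infixl 6 _+_ _-_
  infixl 7 _*_
  infix 8 -_
  infix 4 _≤_ _≟_

  opaque
    K : Set
    K = ℚ

    _+_ _*_ : K → K → K
    _+_ = ℚ._+_
    _*_ = ℚ._*_

    -_ : K → K
    -_ = ℚ.-_

    0# 1# : K
    0# = ℚ.0ℚ
    1# = ℚ.1ℚ

    _≤_ : K → K → Set
    _≤_ = ℚ._≤_

    _≟_ : (a b : K) → Dec (a ≡ b)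
    _≟_ = ℚP._≟_

    inverse : (b : K) → b ≢ 0# → K
    inverse b b≢0 = ℚ.1/_ b {{ℚ.≢-nonZero b≢0}}

    +-comm : ∀ a b → a + b ≡ b + a
    +-comm = ℚP.+-comm

    +-assoc : ∀ a b c → a + b + c ≡ a + (b + c)
    +-assoc = ℚP.+-assoc

    +-identityˡ : ∀ a → 0# + a ≡ a
    +-identityˡ = ℚP.+-identityˡ

    +-identityʳ : ∀ a → a + 0# ≡ a
    +-identityʳ = ℚP.+-identityʳ

    *-comm : ∀ a b → a * b ≡ b * a
    *-comm = ℚP.*-comm

    *-assoc : ∀ a b c → a * b * c ≡ a * (b * c)
    *-assoc = ℚP.*-assoc

    *-identityˡ : ∀ a → 1# * a ≡ a
    *-identityˡ = ℚP.*-identityˡ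

    *-identityʳ : ∀ a → a * 1# ≡ a
    *-identityʳ = ℚP.*-identityʳ

    *-zeroˡ : ∀ a → 0# * a ≡ 0#
    *-zeroˡ = ℚP.*-zeroˡ

    *-zeroʳ : ∀ a → a * 0# ≡ 0#
    *-zeroʳ = ℚP.*-zeroʳ

    *-distribˡ-+ : ∀ a b c → a * (b + c) ≡ a * b + a * c
    *-distribˡ-+ = ℚP.*-distribˡ-+

    *-inverseʳ : ∀ b b≢0 → b * inverse b b≢0 ≡ 1#
    *-inverseʳ b b≢0 = ℚP.*-inverseʳ b {{ℚ.≢-nonZero b≢0}}

    ≤-refl : ∀ {a} → a ≤ a
    ≤-refl = ℚP.≤-refl

    ≤-reflexive : ∀ {a b} → a ≡ b → a ≤ b
    ≤-reflexive = ℚP.≤-reflexive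

    ≤-trans : ∀ {a b c} → a ≤ b → b ≤ c → a ≤ c
    ≤-trans = ℚP.≤-trans

    ≤-antisym : ∀ {a b} → a ≤ b → b ≤ a → a ≡ b
    ≤-antisym = ℚP.≤-antisym

    ≤-total : ∀ a b → a ≤ b ⊎ b ≤ a
    ≤-total = ℚP.≤-total

    +-mono-≤ : ∀ {a b c d} → a ≤ b → c ≤ d → a + c ≤ b + d
    +-mono-≤ = ℚP.+-mono-≤

    *-monoʳ : ∀ {a b} c → 0# ≤ c → a ≤ b → a * c ≤ b * c
    *-monoʳ c 0≤c a≤b = ℚP.*-monoʳ-≤-nonNeg c {{ℚ.nonNegative 0≤c}} a≤b

    *-cancelˡ : ∀ {a b c} → 0# ≤ c → c ≢ 0# → c * a ≤ c * b → a ≤ b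
    *-cancelˡ {c = c} 0≤c c≢0 = ℚP.*-cancelˡ-≤-pos c
      {{ℚP.nonNeg∧nonZero⇒pos c {{ℚ.nonNegative 0≤c}} {{ℚ.≢-nonZero c≢0}}}}

    0≤1 : 0# ≤ 1#
    0≤1 = ℚP.nonNegative⁻¹ ℚ.1ℚ

    1≢0 : 1# ≢ 0#
    1≢0 ()

  _-_ : K → K → K
  a - b = a + - b

  +-monoʳ-≤ : ∀ a {b c} → b ≤ c → a + b ≤ a + c
  +-monoʳ-≤ a = +-mono-≤ ≤-refl

  +-monoˡ-≤ : ∀ a {b c} → b ≤ c → b + a ≤ c + a
  +-monoˡ-≤ a b≤c = +-mono-≤ b≤c ≤-refl

  0+ : ∀ {a b} → a ≡ 0# → a + b ≡ b
  0+ {b = b} a≡0 = trans (cong (_+ b) a≡0) (+-identityˡ b)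

  +0 : ∀ {a b} → b ≡ 0# → a + b ≡ a
  +0 {a} b≡0 = trans (cong (a +_) b≡0) (+-identityʳ a)

  *-≥0 : ∀ {a b} → 0# ≤ a → 0# ≤ b → 0# ≤ a * b
  *-≥0 {a} {b} 0≤a 0≤b = subst (_≤ a * b) (*-zeroˡ b) (*-monoʳ b 0≤b 0≤a)

  +-≥0 : ∀ {a b} → 0# ≤ a → 0# ≤ b → 0# ≤ a + b
  +-≥0 {a} {b} 0≤a 0≤b = subst (_≤ a + b) (+-identityˡ 0#) (+-mono-≤ 0≤a 0≤b)

  *-monoˡ : ∀ {a b} c → 0# ≤ c → a ≤ b → c * a ≤ c * b
  *-monoˡ {a} {b} c 0≤c a≤b = subst₂ _≤_ (*-comm a c) (*-comm b c) (*-monoʳ c 0≤c a≤b)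

  *-mono-≥0 : ∀ {a b c d} → 0# ≤ a → 0# ≤ c → a ≤ b → c ≤ d → a * c ≤ b * d
  *-mono-≥0 {b = b} {c = c} 0≤a 0≤c a≤b c≤d =
    ≤-trans (*-monoʳ c 0≤c a≤b) (*-monoˡ b (≤-trans 0≤a a≤b) c≤d)

  0≤q-p : ∀ {p q} → p ≤ q → 0# ≤ q - p
  0≤q-p {p} {q} p≤q = subst (_≤ q - p) (cancel p) (+-monoˡ-≤ (- p) p≤q)
    where
    opaque
      unfolding K
      cancel : ∀ p → p - p ≡ 0#
      cancel = solve-∀ ℚ-ring

  p≤q-by : ∀ {p q d} → 0# ≤ d → q ≡ p + d → p ≤ q
  p≤q-by {p} {q} {d} 0≤d eq =
    subst₂ _≤_ (+-identityʳ p) (sym eq) (+-monoʳ-≤ p 0≤d)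

  p≤q⇐0≤q-p : ∀ {p q} → 0# ≤ q - p → p ≤ q
  p≤q⇐0≤q-p {p} {q} h = p≤q-by h (identity p q)
    where
    opaque
      unfolding K
      identity : ∀ p q → q ≡ p + (q - p)
      identity = solve-∀ ℚ-ring

  opaque
    unfolding K
    neg-sq : ∀ a → a * a ≡ (- a) * (- a)
    neg-sq = solve-∀ ℚ-ring

  neg-≥0 : ∀ {a} → a ≤ 0# → 0# ≤ - a
  neg-≥0 {a} a≤0 = subst (0# ≤_) (+-identityˡ (- a)) (0≤q-p a≤0)

  sq-≥0 : ∀ a → 0# ≤ a * a
  sq-≥0 a with ≤-total 0# a
  ... | inj₁ 0≤a = *-≥0 0≤a 0≤a
  ... | inj₂ a≤0 = subst (0# ≤_) (sym (neg-sq a)) (*-≥0 (neg-≥0 a≤0) (neg-≥0 a≤0))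

  a*b≤0 : ∀ {a b} → a ≤ 0# → 0# ≤ b → a * b ≤ 0#
  a*b≤0 {a} {b} a≤0 0≤b = subst (a * b ≤_) (*-zeroˡ b) (*-monoʳ b 0≤b a≤0)

  a*b≡0 : ∀ {a b} → b ≢ 0# → a * b ≡ 0# → a ≡ 0#
  a*b≡0 {a} {b} b≢0 ab≡0 = begin
    a                ≡⟨ *-identityʳ a ⟨
    a * 1#           ≡⟨ cong (a *_) (*-inverseʳ b b≢0) ⟨
    a * (b * b⁻¹)    ≡⟨ *-assoc a b b⁻¹ ⟨
    a * b * b⁻¹      ≡⟨ cong (_* b⁻¹) ab≡0 ⟩
    0# * b⁻¹         ≡⟨ *-zeroˡ b⁻¹ ⟩
    0#               ∎
    where
    open ≡-Reasoning
    b⁻¹ = inverse b b≢0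

  ι : ℕ → K
  ι zero    = 0#
  ι (suc k) = 1# + ι k

  ι-≥0 : ∀ k → 0# ≤ ι k
  ι-≥0 zero    = ≤-refl
  ι-≥0 (suc k) = +-≥0 0≤1 (ι-≥0 k)

  ι-+ : ∀ a b → ι (a ℕ.+ b) ≡ ι a + ι b
  ι-+ zero    b = sym (+-identityˡ (ι b))
  ι-+ (suc a) b = trans (cong (1# +_) (ι-+ a b)) (sym (+-assoc 1# (ι a) (ι b)))

  ι-* : ∀ a b → ι (a ℕ.* b) ≡ ι a * ι b
  ι-* zero    b = sym (*-zeroˡ (ι b))
  ι-* (suc a) b = trans (ι-+ b (a ℕ.* b)) (trans (cong (ι b +_) (ι-* a b)) (identity (ι a) (ι b)))
    where
    opaque
      unfolding K
      identity : ∀ x y → y + x * y ≡ (1# + x) * y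
      identity = solve-∀ ℚ-ring

  ι-mono : ∀ {a b} → a ℕ.≤ b → ι a ≤ ι b
  ι-mono {b = b} ℕ.z≤n = ι-≥0 b
  ι-mono (ℕ.s≤s h)     = +-monoʳ-≤ 1# (ι-mono h)

  1≤ι : ∀ k → 1# ≤ ι (suc k)
  1≤ι k = subst (_≤ ι (suc k)) (+-identityʳ 1#) (+-monoʳ-≤ 1# (ι-≥0 k))

  1≰0 : ¬ (1# ≤ 0#)
  1≰0 1≤0 = 1≢0 (≤-antisym 1≤0 0≤1)

  ι-suc≢0 : ∀ k → ι (suc k) ≢ 0#
  ι-suc≢0 k eq = 1≰0 (subst (1# ≤_) eq (1≤ι k))

  ι-cancel : ∀ {a b} → ι a ≤ ι b → a ℕ.≤ b
  ι-cancel {zero}  h = ℕ.z≤n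
  ι-cancel {suc a} {zero}  h = contradiction (≤-trans (1≤ι a) h) 1≰0
  ι-cancel {suc a} {suc b} h = ℕ.s≤s (ι-cancel (subst₂ _≤_ (cancel (ι a)) (cancel (ι b)) (+-monoʳ-≤ (- 1#) h)))
    where
    opaque
      unfolding K
      cancel : ∀ x → - 1# + (1# + x) ≡ x
      cancel = solve-∀ ℚ-ring

  Σ[_] : ∀ k → (Fin k → K) → K
  Σ[ zero  ] f = 0#
  Σ[ suc k ] f = f zero + Σ[ k ] (λ i → f (suc i))

  Σ-cong : ∀ {k} {f g : Fin k → K} → (∀ i → f i ≡ g i) → Σ[ k ] f ≡ Σ[ k ] g
  Σ-cong {zero}  h = refl
  Σ-cong {suc k} h = cong₂ _+_ (h zero) (Σ-cong (λ i → h (suc i)))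

  Σ-0 : ∀ k → Σ[ k ] (λ _ → 0#) ≡ 0#
  Σ-0 zero    = refl
  Σ-0 (suc k) = trans (+-identityˡ _) (Σ-0 k)

  Σ-≡0 : ∀ {k} {f : Fin k → K} → (∀ i → f i ≡ 0#) → Σ[ k ] f ≡ 0#
  Σ-≡0 {k} h = trans (Σ-cong h) (Σ-0 k)

  opaque
    unfolding K
    interchange : ∀ a b c d → a + b + (c + d) ≡ a + c + (b + d)
    interchange = solve-∀ ℚ-ring

  Σ-+ : ∀ {k} (f g : Fin k → K) → Σ[ k ] (λ i → f i + g i) ≡ Σ[ k ] f + Σ[ k ] g
  Σ-+ {zero}  f g = sym (+-identityˡ 0#)
  Σ-+ {suc k} f g = trans (cong (f zero + g zero +_) (Σ-+ (λ i → f (suc i)) (λ i → g (suc i))))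
    (interchange (f zero) (g zero) _ _)

  Σ-*ˡ : ∀ {k} c (f : Fin k → K) → Σ[ k ] (λ i → c * f i) ≡ c * Σ[ k ] f
  Σ-*ˡ {zero}  c f = sym (*-zeroʳ c)
  Σ-*ˡ {suc k} c f = trans (cong (c * f zero +_) (Σ-*ˡ c (λ i → f (suc i)))) (sym (*-distribˡ-+ c _ _))

  Σ-*ʳ : ∀ {k} (f : Fin k → K) c → Σ[ k ] (λ i → f i * c) ≡ Σ[ k ] f * c
  Σ-*ʳ f c = trans (Σ-cong (λ i → *-comm (f i) c)) (trans (Σ-*ˡ c f) (*-comm c _))

  Σ-swap : ∀ {k l} (f : Fin k → Fin l → K) →
    Σ[ k ] (λ i → Σ[ l ] (λ j → f i j)) ≡ Σ[ l ] (λ j → Σ[ k ] (λ i → f i j))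
  Σ-swap {zero}  {l} f = sym (Σ-0 l)
  Σ-swap {suc k} {l} f = trans (cong (Σ[ l ] (f zero) +_) (Σ-swap (λ i → f (suc i))))
    (sym (Σ-+ (f zero) (λ j → Σ[ k ] (λ i → f (suc i) j))))

  Σ-≤ : ∀ {k} {f g : Fin k → K} → (∀ i → f i ≤ g i) → Σ[ k ] f ≤ Σ[ k ] g
  Σ-≤ {zero}  h = ≤-refl
  Σ-≤ {suc k} h = +-mono-≤ (h zero) (Σ-≤ (λ i → h (suc i)))

  Σ-≥0 : ∀ {k} {f : Fin k → K} → (∀ i → 0# ≤ f i) → 0# ≤ Σ[ k ] f
  Σ-≥0 {k} {f} h = subst (_≤ Σ[ k ] f) (Σ-0 k) (Σ-≤ h)

  Σ-const : ∀ k c → Σ[ k ] (λ _ → c) ≡ ι k * c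
  Σ-const zero    c = sym (*-zeroˡ c)
  Σ-const (suc k) c = trans (cong (c +_) (Σ-const k c)) (identity (ι k) c)
    where
    opaque
      unfolding K
      identity : ∀ x c → c + x * c ≡ (1# + x) * c
      identity = solve-∀ ℚ-ring

  Σ-member-≤ : ∀ {k} (f : Fin k → K) → (∀ i → 0# ≤ f i) → ∀ i → f i ≤ Σ[ k ] f
  Σ-member-≤ f h zero    = p≤q-by (Σ-≥0 (λ i → h (suc i))) refl
  Σ-member-≤ f h (suc i) = ≤-trans (Σ-member-≤ (λ i → f (suc i)) (λ i → h (suc i)) i)
    (p≤q-by (h zero) (+-comm (f zero) _))

  ΣΣ : ∀ k → (Fin k → Fin k → K) → K
  ΣΣ k f = Σ[ k ] (λ i → Σ[ k ] (λ j → f i j))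

  ΣΣ-cong : ∀ {k} {f g : Fin k → Fin k → K} → (∀ i j → f i j ≡ g i j) → ΣΣ k f ≡ ΣΣ k g
  ΣΣ-cong h = Σ-cong (λ i → Σ-cong (h i))

  ΣΣ-+ : ∀ {k} (f g : Fin k → Fin k → K) → ΣΣ k (λ i j → f i j + g i j) ≡ ΣΣ k f + ΣΣ k g
  ΣΣ-+ {k} f g = trans (Σ-cong (λ i → Σ-+ (f i) (g i))) (Σ-+ {k} _ _)

  ΣΣ-*ˡ : ∀ {k} c (f : Fin k → Fin k → K) → ΣΣ k (λ i j → c * f i j) ≡ c * ΣΣ k f
  ΣΣ-*ˡ {k} c f = trans (Σ-cong (λ i → Σ-*ˡ c (f i))) (Σ-*ˡ {k} c _)

  ΣΣ-≤ : ∀ {k} {f g : Fin k → Fin k → K} → (∀ i j → f i j ≤ g i j) → ΣΣ k f ≤ ΣΣ k g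
  ΣΣ-≤ h = Σ-≤ (λ i → Σ-≤ (h i))

  Σ-product : ∀ {k l} (f : Fin k → K) (g : Fin l → K) →
    Σ[ k ] (λ i → Σ[ l ] (λ j → f i * g j)) ≡ Σ[ k ] f * Σ[ l ] g
  Σ-product f g = trans (Σ-cong (λ i → Σ-*ˡ (f i) g)) (Σ-*ʳ f _)

-- Subspaces of ℚⁿ as orthogonal projections; dimension as trace.

module LinAlg where

  open RatSum
  open import Data.Nat as ℕ using (ℕ; zero; suc)
  open import Data.Fin using (Fin; zero; suc)
  open import Data.Fin.Properties using (all?; ¬∀⟶∃¬)
  open import Data.Product using (Σ; ∃; _,_; proj₁; proj₂)
  open import Data.Empty using (⊥-elim)
  open import Function using (_∘_)
  open import Relation.Nullary using (Dec; yes; no; ¬_)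
  open import Relation.Binary.PropositionalEquality
  open import Tactic.RingSolver using (solve-∀)

  Vect : ℕ → Set
  Vect n = Fin n → K

  infixl 7 _∙_
  _∙_ : ∀ {n} → Vect n → Vect n → K
  _∙_ {n} x y = Σ[ n ] (λ a → x a * y a)

  ∙-comm : ∀ {n} (x y : Vect n) → x ∙ y ≡ y ∙ x
  ∙-comm x y = Σ-cong (λ a → *-comm (x a) (y a))

  ∙-cong : ∀ {n} {x x' y y' : Vect n} → (∀ a → x a ≡ x' a) → (∀ a → y a ≡ y' a) → x ∙ y ≡ x' ∙ y'
  ∙-cong h k = Σ-cong (λ a → cong₂ _*_ (h a) (k a))

  ∙-Σʳ : ∀ {n k} (x : Vect n) (c : Fin k → K) (v : Fin k → Vect n) →
    x ∙ (λ b → Σ[ k ] (λ i → c i * v i b)) ≡ Σ[ k ] (λ i → c i * (x ∙ v i))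
  ∙-Σʳ {n} {k} x c v = begin
    Σ[ n ] (λ a → x a * Σ[ k ] (λ i → c i * v i a))    ≡⟨ Σ-cong (λ a → Σ-*ˡ {k} (x a) _) ⟨
    Σ[ n ] (λ a → Σ[ k ] (λ i → x a * (c i * v i a)))  ≡⟨ Σ-swap {n} {k} _ ⟩
    Σ[ k ] (λ i → Σ[ n ] (λ a → x a * (c i * v i a)))
      ≡⟨ Σ-cong (λ i → Σ-cong (λ a → rearrange (x a) (c i) (v i a))) ⟩
    Σ[ k ] (λ i → Σ[ n ] (λ a → c i * (x a * v i a)))  ≡⟨ Σ-cong (λ i → Σ-*ˡ {n} (c i) _) ⟩
    Σ[ k ] (λ i → c i * (x ∙ v i))                     ∎
    where
    open ≡-Reasoning
    opaque
      unfolding K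
      rearrange : ∀ a b c → a * (b * c) ≡ b * (a * c)
      rearrange = solve-∀ ℚ-ring

  infixr 5 _◂_
  _◂_ : ∀ {k} {A : Set} → A → (Fin k → A) → Fin (suc k) → A
  (x ◂ v) zero    = x
  (x ◂ v) (suc i) = v i

  LinIndep : ∀ {k n} → (Fin k → Vect n) → Set
  LinIndep {k} v =
    (c : Fin k → K) → (∀ j → Σ[ k ] (λ i → c i * v i j) ≡ 0#) → ∀ i → c i ≡ 0#

  InSpan : ∀ {k n} → (Fin k → Vect n) → Vect n → Set
  InSpan {k} v y = Σ (Fin k → K) λ c → ∀ b → y b ≡ Σ[ k ] (λ i → c i * v i b)

  span-weaken : ∀ {k n} {v : Fin k → Vect n} {x y} → InSpan v y → InSpan (x ◂ v) y
  span-weaken {x = x} (c , h) = 0# ◂ c , λ b →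
    trans (h b) (sym (0+ (*-zeroˡ (x b))))

  span-head : ∀ {k n} {v : Fin k → Vect n} {x} → InSpan (x ◂ v) x
  span-head {k} {v = v} {x} = 1# ◂ (λ _ → 0#) , λ b → sym (begin
    1# * x b + Σ[ k ] (λ i → 0# * v i b) ≡⟨ cong₂ _+_ (*-identityˡ (x b)) (Σ-≡0 (λ i → *-zeroˡ (v i b))) ⟩
    x b + 0#                             ≡⟨ +-identityʳ (x b) ⟩
    x b                                  ∎)
    where open ≡-Reasoning

  span-Σ : ∀ {k l n} {v : Fin k → Vect n} (w : Fin l → K) (u : Fin l → Vect n) → (∀ a → InSpan v (u a)) →
    InSpan v (λ b → Σ[ l ] (λ a → w a * u a b))
  span-Σ {k} {l} {v = v} w u s = (λ i → Σ[ l ] (λ a → w a * C a i)) , λ b → begin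
    Σ[ l ] (λ a → w a * u a b)
      ≡⟨ Σ-cong (λ a → cong (w a *_) (proj₂ (s a) b)) ⟩
    Σ[ l ] (λ a → w a * Σ[ k ] (λ i → C a i * v i b))
      ≡⟨ Σ-cong (λ a → Σ-*ˡ {k} (w a) _) ⟨
    Σ[ l ] (λ a → Σ[ k ] (λ i → w a * (C a i * v i b)))
      ≡⟨ Σ-swap {l} {k} _ ⟩
    Σ[ k ] (λ i → Σ[ l ] (λ a → w a * (C a i * v i b)))
      ≡⟨ Σ-cong (λ i → Σ-cong (λ a → *-assoc (w a) (C a i) (v i b))) ⟨
    Σ[ k ] (λ i → Σ[ l ] (λ a → w a * C a i * v i b))
      ≡⟨ Σ-cong (λ i → Σ-*ʳ {l} _ (v i b)) ⟩
    Σ[ k ] (λ i → Σ[ l ] (λ a → w a * C a i) * v i b) ∎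
    where
    open ≡-Reasoning
    C : Fin l → Fin k → K
    C a = proj₁ (s a)

  span-lin : ∀ {k n} {v : Fin k → Vect n} {x y} α β → InSpan v x → InSpan v y → InSpan v (λ b → α * x b + β * y b)
  span-lin {k} {v = v} {x} {y} α β (c , h) (d , g) = (λ i → α * c i + β * d i) , λ b → begin
    α * x b + β * y b                          ≡⟨ cong₂ (λ p q → α * p + β * q) (h b) (g b) ⟩
    α * Σ[ k ] (λ i → c i * v i b) + β * Σ[ k ] (λ i → d i * v i b)
      ≡⟨ cong₂ _+_ (Σ-*ˡ {k} α _) (Σ-*ˡ {k} β _) ⟨
    Σ[ k ] (λ i → α * (c i * v i b)) + Σ[ k ] (λ i → β * (d i * v i b))
      ≡⟨ Σ-+ {k} _ _ ⟨
    Σ[ k ] (λ i → α * (c i * v i b) + β * (d i * v i b))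
      ≡⟨ Σ-cong (λ i → identity α (c i) β (d i) (v i b)) ⟩
    Σ[ k ] (λ i → (α * c i + β * d i) * v i b) ∎
    where
    open ≡-Reasoning
    opaque
      unfolding K
      identity : ∀ α c β d v → α * (c * v) + β * (d * v) ≡ (α * c + β * d) * v
      identity = solve-∀ ℚ-ring

  -- A `d`-dimensional subspace given by its orthogonal projection. Over ℚ this matrix always
  -- exists, whereas an orthonormal basis may not, and its trace is exactly what the moment
  -- inequalities consume.
  record Proj (n d : ℕ) : Set where
    field
      Π      : Fin n → Vect n
      Π-sym  : ∀ a b → Π a b ≡ Π b a
      Π-idem : ∀ a b → Π a ∙ Π b ≡ Π a b
      Π-tr   : Σ[ n ] (λ a → Π a a) ≡ ι d
  open Proj public

  Fix : ∀ {n d} → Proj n d → Vect n → Set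
  Fix P x = ∀ a → Π P a ∙ x ≡ x a

  Fix-span : ∀ {k n d} (P : Proj n d) {v : Fin k → Vect n} → (∀ i → Fix P (v i)) → ∀ {y} → InSpan v y → Fix P y
  Fix-span {k} P {v} fv {y} (c , h) a = begin
    Π P a ∙ y                                    ≡⟨ ∙-cong (λ _ → refl) h ⟩
    Π P a ∙ (λ b → Σ[ k ] (λ i → c i * v i b))   ≡⟨ ∙-Σʳ (Π P a) c v ⟩
    Σ[ k ] (λ i → c i * (Π P a ∙ v i))           ≡⟨ Σ-cong (λ i → cong (c i *_) (fv i a)) ⟩
    Σ[ k ] (λ i → c i * v i a)                   ≡⟨ h a ⟨
    y a                                          ∎
    where open ≡-Reasoning

  zeroProj : ∀ n → Proj n 0
  zeroProj n = record
    { Π = λ _ _ → 0# ; Π-sym = λ _ _ → refl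
    ; Π-idem = λ _ _ → Σ-≡0 {n} (λ _ → *-zeroˡ 0#) ; Π-tr = Σ-0 n }

  module Residual {n d} (P : Proj n d) (x : Vect n) where
    y : Vect n
    y a = x a - Π P a ∙ x

    y-orth : ∀ z → Fix P z → y ∙ z ≡ 0#
    y-orth z fz = begin
      y ∙ z
        ≡⟨ Σ-cong (λ a → identity (x a) (Π P a ∙ x) (z a)) ⟩
      Σ[ n ] (λ a → x a * z a + (- 1#) * (z a * (Π P a ∙ x)))
        ≡⟨ Σ-+ {n} _ _ ⟩
      x ∙ z + Σ[ n ] (λ a → (- 1#) * (z a * (Π P a ∙ x)))
        ≡⟨ cong (x ∙ z +_) (Σ-*ˡ {n} (- 1#) _) ⟩
      x ∙ z + (- 1#) * Σ[ n ] (λ a → z a * (Π P a ∙ x))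
        ≡⟨ cong (λ q → x ∙ z + (- 1#) * q) (Σ-cong (λ a → cong (z a *_) (∙-cong (Π-sym P a) (λ _ → refl)))) ⟩
      x ∙ z + (- 1#) * Σ[ n ] (λ a → z a * Σ[ n ] (λ b → Π P b a * x b))
        ≡⟨ cong (λ q → x ∙ z + (- 1#) * q) (Σ-cong (λ a → cong (z a *_) (Σ-cong (λ b → *-comm (Π P b a) (x b))))) ⟩
      x ∙ z + (- 1#) * (z ∙ (λ a → Σ[ n ] (λ b → x b * Π P b a)))
        ≡⟨ cong (λ q → x ∙ z + (- 1#) * q) (∙-Σʳ z x (Π P)) ⟩
      x ∙ z + (- 1#) * Σ[ n ] (λ b → x b * (z ∙ Π P b))
        ≡⟨ cong (λ q → x ∙ z + (- 1#) * q) (Σ-cong (λ b → cong (x b *_) (trans (∙-comm z (Π P b)) (fz b)))) ⟩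
      x ∙ z + (- 1#) * (x ∙ z)
        ≡⟨ cancel (x ∙ z) ⟩
      0# ∎
      where
      open ≡-Reasoning
      opaque
        unfolding K
        identity : ∀ x p z → (x - p) * z ≡ x * z + (- 1#) * (z * p)
        identity = solve-∀ ℚ-ring
      opaque
        unfolding K
        cancel : ∀ q → q + (- 1#) * q ≡ 0#
        cancel = solve-∀ ℚ-ring

    Π-fixed : ∀ b → Fix P (Π P b)
    Π-fixed b a = trans (Π-idem P a b) (Π-sym P a b)

    Πx-fixed : Fix P (λ a → Π P a ∙ x)
    Πx-fixed = Fix-span P Π-fixed (x , λ b → trans (∙-cong (Π-sym P b) (λ _ → refl)) (Σ-cong (λ a → *-comm (Π P a b) (x a))))

    ν : K
    ν = y ∙ y

    y∙x : y ∙ x ≡ ν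
    y∙x = begin
      y ∙ x                                                 ≡⟨ Σ-cong (λ a → identity (y a) (x a) (Π P a ∙ x)) ⟩
      Σ[ n ] (λ a → y a * y a + y a * (Π P a ∙ x))          ≡⟨ Σ-+ {n} _ _ ⟩
      ν + y ∙ (λ a → Π P a ∙ x)                             ≡⟨ cong (ν +_) (y-orth _ Πx-fixed) ⟩
      ν + 0#                                                ≡⟨ +-identityʳ ν ⟩
      ν                                                     ∎
      where
      open ≡-Reasoning
      opaque
        unfolding K
        identity : ∀ y x p → y * x ≡ y * (x - p) + y * p
        identity = solve-∀ ℚ-ring

    y≡0⇒Fix : (∀ a → y a ≡ 0#) → Fix P x
    y≡0⇒Fix h a = sym (trans (split (x a) (Π P a ∙ x)) (trans (cong (_+ Π P a ∙ x) (h a)) (+-identityˡ _)))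
      where
      opaque
        unfolding K
        split : ∀ x p → x ≡ (x - p) + p
        split = solve-∀ ℚ-ring

    module _ (a₀ : Fin n) (y≢0 : y a₀ ≢ 0#) where
      -- A sum of squares dominates each of its terms, so one nonzero coordinate suffices.
      ν≢0 : ν ≢ 0#
      ν≢0 ν≡0 = y≢0 (a*b≡0 y≢0 (≤-antisym
        (≤-trans (Σ-member-≤ (λ a → y a * y a) (λ a → sq-≥0 (y a)) a₀) (≤-reflexive ν≡0)) (sq-≥0 (y a₀))))

      ν⁻¹ : K
      ν⁻¹ = inverse ν ν≢0

      ν*ν⁻¹ : ν * ν⁻¹ ≡ 1#
      ν*ν⁻¹ = *-inverseʳ ν ν≢0

      -- A Gram-Schmidt step without normalisation: dividing the rank-one matrix `y yᵀ` by `y ∙ y`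
      -- avoids the square root.
      Π' : Fin n → Vect n
      Π' a b = Π P a b + ν⁻¹ * y a * y b

      Π'-apply : ∀ a z → Π' a ∙ z ≡ Π P a ∙ z + ν⁻¹ * y a * (y ∙ z)
      Π'-apply a z = begin
        Π' a ∙ z                                                    ≡⟨ Σ-cong (λ b → identity (Π P a b) (ν⁻¹ * y a) (y b) (z b)) ⟩
        Σ[ n ] (λ b → Π P a b * z b + ν⁻¹ * y a * (y b * z b))      ≡⟨ Σ-+ {n} _ _ ⟩
        Π P a ∙ z + Σ[ n ] (λ b → ν⁻¹ * y a * (y b * z b))          ≡⟨ cong (Π P a ∙ z +_) (Σ-*ˡ {n} _ _) ⟩
        Π P a ∙ z + ν⁻¹ * y a * (y ∙ z)                             ∎
        where
        open ≡-Reasoning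
        opaque
          unfolding K
          identity : ∀ p c y z → (p + c * y) * z ≡ p * z + c * (y * z)
          identity = solve-∀ ℚ-ring

      fix' : ∀ z → Fix P z → ∀ a → Π' a ∙ z ≡ z a
      fix' z fz a = trans (Π'-apply a z) (trans (cong₂ (λ p q → p + ν⁻¹ * y a * q) (fz a) (y-orth z fz)) (identity (z a) (ν⁻¹ * y a)))
        where
        opaque
          unfolding K
          identity : ∀ z c → z + c * 0# ≡ z
          identity = solve-∀ ℚ-ring

      fix-y : ∀ a → Π' a ∙ y ≡ y a
      fix-y a = begin
        Π' a ∙ y                    ≡⟨ Π'-apply a y ⟩
        Π P a ∙ y + ν⁻¹ * y a * ν   ≡⟨ cong (_+ ν⁻¹ * y a * ν) (trans (∙-comm (Π P a) y) (y-orth (Π P a) (Π-fixed a))) ⟩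
        0# + ν⁻¹ * y a * ν          ≡⟨ identity ν⁻¹ (y a) ν ⟩
        ν * ν⁻¹ * y a               ≡⟨ cong (_* y a) ν*ν⁻¹ ⟩
        1# * y a                    ≡⟨ *-identityˡ (y a) ⟩
        y a                         ∎
        where
        open ≡-Reasoning
        opaque
          unfolding K
          identity : ∀ c y v → 0# + c * y * v ≡ v * c * y
          identity = solve-∀ ℚ-ring

      fix-x : ∀ a → Π' a ∙ x ≡ x a
      fix-x a = begin
        Π' a ∙ x                    ≡⟨ Π'-apply a x ⟩
        Π P a ∙ x + ν⁻¹ * y a * (y ∙ x) ≡⟨ cong (λ q → Π P a ∙ x + ν⁻¹ * y a * q) y∙x ⟩
        Π P a ∙ x + ν⁻¹ * y a * ν   ≡⟨ identity (Π P a ∙ x) ν⁻¹ (y a) ν ⟩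
        Π P a ∙ x + ν * ν⁻¹ * y a   ≡⟨ cong (λ q → Π P a ∙ x + q * y a) ν*ν⁻¹ ⟩
        Π P a ∙ x + 1# * y a        ≡⟨ unfold (Π P a ∙ x) (x a) ⟩
        x a                         ∎
        where
        open ≡-Reasoning
        opaque
          unfolding K
          identity : ∀ p c y v → p + c * y * v ≡ p + v * c * y
          identity = solve-∀ ℚ-ring
        opaque
          unfolding K
          unfold : ∀ p x → p + 1# * (x - p) ≡ x
          unfold = solve-∀ ℚ-ring

      extend : Proj n (suc d)
      extend = record
        { Π = Π'
        ; Π-sym = λ a b → cong₂ _+_ (Π-sym P a b) (swap ν⁻¹ (y a) (y b))
        ; Π-idem = idem
        ; Π-tr = begin
            Σ[ n ] (λ a → Π P a a + ν⁻¹ * y a * y a)           ≡⟨ Σ-+ {n} _ _ ⟩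
            Σ[ n ] (λ a → Π P a a) + Σ[ n ] (λ a → ν⁻¹ * y a * y a)
              ≡⟨ cong₂ _+_ (Π-tr P) (trans (Σ-cong (λ a → *-assoc ν⁻¹ (y a) (y a))) (Σ-*ˡ {n} ν⁻¹ _)) ⟩
            ι d + ν⁻¹ * ν                                      ≡⟨ cong (ι d +_) (trans (*-comm ν⁻¹ ν) ν*ν⁻¹) ⟩
            ι d + 1#                                           ≡⟨ +-comm (ι d) 1# ⟩
            1# + ι d                                           ∎ }
        where
        open ≡-Reasoning
        opaque
          unfolding K
          swap : ∀ c y z → c * y * z ≡ c * z * y
          swap = solve-∀ ℚ-ring
        idem : ∀ a b → Π' a ∙ Π' b ≡ Π' a b
        idem a b = begin
          Π' a ∙ Π' b                                      ≡⟨ Σ-cong (λ c → identity (Π' a c) (Π P b c) (ν⁻¹ * y b) (y c)) ⟩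
          Σ[ n ] (λ c → Π' a c * Π P b c + ν⁻¹ * y b * (Π' a c * y c)) ≡⟨ Σ-+ {n} _ _ ⟩
          Π' a ∙ Π P b + Σ[ n ] (λ c → ν⁻¹ * y b * (Π' a c * y c)) ≡⟨ cong₂ _+_ (fix' (Π P b) (Π-fixed b) a) (Σ-*ˡ {n} _ _) ⟩
          Π P b a + ν⁻¹ * y b * (Π' a ∙ y)                 ≡⟨ cong₂ (λ p q → p + ν⁻¹ * y b * q) (Π-sym P b a) (fix-y a) ⟩
          Π P a b + ν⁻¹ * y b * y a                        ≡⟨ cong (Π P a b +_) (swap ν⁻¹ (y b) (y a)) ⟩
          Π' a b                                           ∎
          where
          opaque
            unfolding K
            identity : ∀ p q c y → p * (q + c * y) ≡ p * q + c * (p * y)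
            identity = solve-∀ ℚ-ring

  -- Applying the functional `φ` to a vanishing combination isolates the coefficient of `x`. Every
  -- later independence proof exhibits such a separating `φ`.
  LinIndep-cons : ∀ {k n} {v : Fin k → Vect n} {x} (φ : Vect n) →
    LinIndep v → (∀ i → φ ∙ v i ≡ 0#) → φ ∙ x ≢ 0# → LinIndep (x ◂ v)
  LinIndep-cons {k} {n} {v} {x} φ li φv φx c h = λ where
      zero    → c₀≡0
      (suc i) → li (c ∘ suc) (λ j → trans (sym (tail-only j)) (h j)) i
    where
    open ≡-Reasoning
    c₀≡0 : c zero ≡ 0#
    c₀≡0 = a*b≡0 φx (begin
      c zero * (φ ∙ x)                                            ≡⟨ +-identityʳ _ ⟨
      c zero * (φ ∙ x) + 0#
        ≡⟨ cong (c zero * (φ ∙ x) +_) (Σ-≡0 (λ i → trans (cong (c (suc i) *_) (φv i)) (*-zeroʳ (c (suc i))))) ⟨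
      Σ[ suc k ] (λ i → c i * (φ ∙ (x ◂ v) i))                    ≡⟨ ∙-Σʳ φ c (x ◂ v) ⟨
      φ ∙ (λ b → Σ[ suc k ] (λ i → c i * (x ◂ v) i b))            ≡⟨ Σ-≡0 (λ a → trans (cong (φ a *_) (h a)) (*-zeroʳ (φ a))) ⟩
      0#                                                          ∎)
    tail-only : ∀ j → c zero * x j + Σ[ k ] (λ i → c (suc i) * v i j) ≡ Σ[ k ] (λ i → c (suc i) * v i j)
    tail-only j = 0+ (trans (cong (_* x j) c₀≡0) (*-zeroˡ (x j)))

  LinIndep-tail : ∀ {k n} {v : Fin (suc k) → Vect n} → LinIndep v → LinIndep (v ∘ suc)
  LinIndep-tail {v = v} li c h i = li (0# ◂ c) (λ j → trans (0+ (*-zeroˡ (v zero j))) (h j)) (suc i)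

  -- `fixes` and `inspan` identify the image of `proj` with the span; `choice` witnesses its trace
  -- by members of the family, so that the trace can be compared with the rank.
  record Basis {k n} (v : Fin k → Vect n) : Set where
    field
      dim    : ℕ
      proj   : Proj n dim
      fixes  : ∀ i → Fix proj (v i)
      inspan : ∀ a → InSpan v (Π proj a)
      choice : Fin dim → Fin k
      indep  : LinIndep (v ∘ choice)
      full   : LinIndep v → dim ≡ k
  open Basis public

  Fix⇒InSpan : ∀ {k n d} {v : Fin k → Vect n} (P : Proj n d) → (∀ a → InSpan v (Π P a)) → ∀ x → Fix P x → InSpan v x
  Fix⇒InSpan P s x fx = proj₁ t , λ b → trans (sym (trans (Σ-cong (λ a → trans (*-comm (x a) (Π P a b)) (cong (_* x a) (Π-sym P a b)))) (fx b))) (proj₂ t b)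
    where t = span-Σ x (Π P) s

  basis : ∀ {k n} (v : Fin k → Vect n) → Basis v
  basis {zero} {n} v = record
    { dim = 0 ; proj = zeroProj n ; fixes = λ () ; inspan = λ a → (λ ()) , λ b → refl
    ; choice = λ () ; indep = λ c h () ; full = λ _ → refl }
  basis {suc k} {n} v = step (all? (λ a → Residual.y (proj B) x a ≟ 0#))
    where
    B : Basis (v ∘ suc)
    B = basis (v ∘ suc)
    x : Vect n
    x = v zero
    module R = Residual (proj B) x
    lift : ∀ {u} → InSpan (v ∘ suc) u → InSpan v u
    lift s = let (c , h) = span-weaken {x = x} s in c , h
    step : Dec (∀ a → R.y a ≡ 0#) → Basis v
    step (yes y≡0) = record
      { dim = dim B ; proj = proj B
      ; fixes = λ where
          zero    → R.y≡0⇒Fix y≡0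
          (suc i) → fixes B i
      ; inspan = λ a → lift (inspan B a)
      ; choice = suc ∘ choice B ; indep = indep B
      ; full = λ li → ⊥-elim (dependent li (Fix⇒InSpan (proj B) (inspan B) x (R.y≡0⇒Fix y≡0))) }
      where
      -1≢0 : - 1# ≢ 0#
      -1≢0 eq = 1≢0 (trans (neg-neg 1#) (trans (cong -_ eq) neg-0))
        where
        opaque
          unfolding K
          neg-neg : ∀ a → a ≡ - - a
          neg-neg = solve-∀ ℚ-ring
          neg-0 : - 0# ≡ 0#
          neg-0 = refl
      dependent : LinIndep v → ¬ InSpan (v ∘ suc) x
      dependent li (c , h) = -1≢0 (li ((- 1#) ◂ c) (λ j → trans (cong ((- 1#) * x j +_) (sym (h j))) (cancel (x j))) zero)
        where
        opaque
          unfolding K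
          cancel : ∀ q → (- 1#) * q + q ≡ 0#
          cancel = solve-∀ ℚ-ring
    step (no y≢0) = extendBy (¬∀⟶∃¬ n _ (λ a → R.y a ≟ 0#) y≢0)
      where
      extendBy : ∃ (λ a → R.y a ≢ 0#) → Basis v
      extendBy (a₀ , ya₀) = record
        { dim = suc (dim B) ; proj = R.extend a₀ ya₀
        ; fixes = λ where
            zero    → R.fix-x a₀ ya₀
            (suc i) → R.fix' a₀ ya₀ (v (suc i)) (fixes B i)
        ; inspan = λ a → let (c , h) = span-lin {v = v} 1# (R.ν⁻¹ a₀ ya₀ * R.y a) (lift (inspan B a)) y-inspan
                         in c , λ b → trans (cong (_+ R.ν⁻¹ a₀ ya₀ * R.y a * R.y b) (sym (*-identityˡ (Π (proj B) a b)))) (h b)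
        ; choice = zero ◂ (suc ∘ choice B)
        ; indep = λ c h → LinIndep-cons {v = v ∘ suc ∘ choice B} {x = x} R.y (indep B) (λ i → R.y-orth _ (fixes B (choice B i)))
              (λ yx → R.ν≢0 a₀ ya₀ (trans (sym R.y∙x) yx)) c (λ j → trans (sym (same c j)) (h j))
        ; full = λ li → cong suc (full B (LinIndep-tail {v = v} li)) }
        where
        same : ∀ c j → Σ[ suc (dim B) ] (λ i → c i * v ((zero ◂ (suc ∘ choice B)) i) j) ≡
          Σ[ suc (dim B) ] (λ i → c i * (x ◂ (v ∘ suc ∘ choice B)) i j)
        same c j = refl
        xs-inspan : InSpan v x
        xs-inspan = let (c , h) = span-head {v = v ∘ suc} {x = x} in c , h
        Πx-inspan : InSpan v (λ a → Π (proj B) a ∙ x)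
        Πx-inspan = lift (Fix⇒InSpan (proj B) (inspan B) _ R.Πx-fixed)
        y-inspan : InSpan v R.y
        y-inspan = let (c , h) = span-lin {v = v} 1# (- 1#) xs-inspan Πx-inspan
                   in c , λ b → trans (identity (x b) (Π (proj B) b ∙ x)) (h b)
          where
          opaque
            unfolding K
            identity : ∀ x p → x - p ≡ 1# * x + (- 1#) * p
            identity = solve-∀ ℚ-ring

  -- The squared Frobenius norm of P - Q is d - 2 tr(PQ) + e, and PQ = Q makes tr(PQ) equal to e. So
  -- d - e is a sum of squares; this replaces the exchange argument.
  frobenius : ∀ {n d e} (P : Proj n d) (Q : Proj n e) → (∀ a → Fix P (Π Q a)) → e ℕ.≤ d
  frobenius {n} {d} {e} P Q fPQ = ι-cancel (p≤q⇐0≤q-p (subst (0# ≤_) expand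
      (Σ-≥0 (λ a → Σ-≥0 (λ b → sq-≥0 (Π P a b - Π Q a b))))))
    where
    open ≡-Reasoning
    opaque
      unfolding K
      identity : ∀ p q → (p - q) * (p - q) ≡ p * p + (- (1# + 1#) * (p * q) + q * q)
      identity = solve-∀ ℚ-ring
    opaque
      unfolding K
      finish : ∀ d e → d + (- (1# + 1#) * e + e) ≡ d - e
      finish = solve-∀ ℚ-ring
    expand : ΣΣ n (λ a b → (Π P a b - Π Q a b) * (Π P a b - Π Q a b)) ≡ ι d - ι e
    expand = begin
      ΣΣ n (λ a b → (Π P a b - Π Q a b) * (Π P a b - Π Q a b))
        ≡⟨ ΣΣ-cong (λ a b → identity (Π P a b) (Π Q a b)) ⟩
      ΣΣ n (λ a b → Π P a b * Π P a b + (- (1# + 1#) * (Π P a b * Π Q a b) + Π Q a b * Π Q a b))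
        ≡⟨ trans (ΣΣ-+ {n} _ _) (cong (_ +_) (trans (ΣΣ-+ {n} _ _) (cong (_+ _) (ΣΣ-*ˡ {n} _ _)))) ⟩
      Σ[ n ] (λ a → Π P a ∙ Π P a) + (- (1# + 1#) * Σ[ n ] (λ a → Π P a ∙ Π Q a) + Σ[ n ] (λ a → Π Q a ∙ Π Q a))
        ≡⟨ cong₂ (λ p q → p + (- (1# + 1#) * Σ[ n ] (λ a → Π P a ∙ Π Q a) + q))
             (trans (Σ-cong (λ a → Π-idem P a a)) (Π-tr P)) (trans (Σ-cong (λ a → Π-idem Q a a)) (Π-tr Q)) ⟩
      ι d + (- (1# + 1#) * Σ[ n ] (λ a → Π P a ∙ Π Q a) + ι e)
        ≡⟨ cong (λ q → ι d + (- (1# + 1#) * q + ι e)) (trans (Σ-cong (λ a → fPQ a a)) (Π-tr Q)) ⟩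
      ι d + (- (1# + 1#) * ι e + ι e)
        ≡⟨ finish (ι d) (ι e) ⟩
      ι d - ι e ∎

  steinitz : ∀ {k n d} (P : Proj n d) (z : Fin k → Vect n) → (∀ i → Fix P (z i)) → LinIndep z → k ℕ.≤ d
  steinitz P z fz li = subst (ℕ._≤ _) (full B li) (frobenius P (proj B) (λ a → Fix-span P fz (inspan B a)))
    where B = basis z

-- Positivity of Gram matrices of tensor powers and of their derivatives.

module Gram where

  open RatSum
  open LinAlg
  open import Data.Nat as ℕ using (ℕ; zero; suc)
  open import Data.Fin using (Fin; zero; suc)
  open import Relation.Binary.PropositionalEquality
  open import Tactic.RingSolver using (solve-∀)

  infixr 8 _^_
  _^_ : K → ℕ → K
  x ^ zero  = 1#
  x ^ suc m = x * x ^ m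

  -- For vectors X i and directions P i, the Gram matrix of the derivatives
  -- Σ_p X ⊗ ⋯ ⊗ P ⊗ ⋯ ⊗ X of X^⊗m along P is G m; H m and H′ m are its mixed
  -- products with the X^⊗m themselves.  Splitting off one tensor factor turns
  -- positivity in degree suc m into a sum of instances in degree m.
  module Derivative {I n} (X P : Fin I → Vect n) where

    u f f′ p : Fin I → Fin I → K
    u i k = X i ∙ X k
    f i k = P i ∙ X k
    f′ i k = X i ∙ P k
    p i k = P i ∙ P k

    H H′ G : ℕ → Fin I → Fin I → K
    H zero    i k = 0#
    H (suc m) i k = u i k * H m i k + f i k * u i k ^ m
    H′ zero    i k = 0#
    H′ (suc m) i k = u i k * H′ m i k + f′ i k * u i k ^ m
    G zero    i k = 0#
    G (suc m) i k = u i k * G m i k + f′ i k * H m i k + f i k * H′ m i k + p i k * u i k ^ m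

    term : ℕ → (c e : Fin I → K) → Fin I → Fin I → K
    term m c e i k =
      c i * c k * G m i k + c i * e k * H m i k + e i * c k * H′ m i k + e i * e k * u i k ^ m

    -- The sum is the squared length of Σ (`c i` times the derivative of X_i^⊗m along P_i, plus
    -- `e i` times X_i^⊗m).
    positive : ∀ m c e → 0# ≤ ΣΣ I (term m c e)
    positive zero c e = subst (0# ≤_) (sym square) (sq-≥0 (Σ[ I ] e))
      where
      opaque
        unfolding K
        identity : ∀ ci ck ei ek → ci * ck * 0# + ci * ek * 0# + ei * ck * 0# + ei * ek * 1# ≡ ei * ek
        identity = solve-∀ ℚ-ring
      square : ΣΣ I (term zero c e) ≡ Σ[ I ] e * Σ[ I ] e
      square = trans (ΣΣ-cong (λ i k → identity (c i) (c k) (e i) (e k))) (Σ-product e e)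
    positive (suc m) c e = subst (0# ≤_) split (Σ-≥0 (λ a → positive m (c′ a) (e′ a)))
      where
      open ≡-Reasoning
      c′ e′ : Fin n → Fin I → K
      -- Coordinate `a` of the first tensor factor, by the Leibniz rule: the derivative falls either
      -- on a later factor, which leaves `X i a`, or on the first one, which contributes `P i a` to
      -- the underived part.
      c′ a i = c i * X i a
      e′ a i = c i * P i a + e i * X i a
      opaque
        unfolding K
        identity₁ : ∀ ci ck ei ek xi xk pi pk G H H′ U →
          ci * xi * (ck * xk) * G + ci * xi * (ck * pk + ek * xk) * H + (ci * pi + ei * xi) * (ck * xk) * H′ + (ci * pi + ei * xi) * (ck * pk + ek * xk) * U
          ≡ (ci * ck * G + ci * ek * H + ei * ck * H′ + ei * ek * U) * (xi * xk) + (ci * ck * H + ei * ck * U) * (xi * pk)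
            + (ci * ck * H′ + ci * ek * U) * (pi * xk) + ci * ck * U * (pi * pk)
        identity₁ = solve-∀ ℚ-ring
        identity₂ : ∀ ci ck ei ek u f f′ p G H H′ U →
          (ci * ck * G + ci * ek * H + ei * ck * H′ + ei * ek * U) * u + (ci * ck * H + ei * ck * U) * f′
            + (ci * ck * H′ + ci * ek * U) * f + ci * ck * U * p
          ≡ ci * ck * (u * G + f′ * H + f * H′ + p * U) + ci * ek * (u * H + f * U) + ei * ck * (u * H′ + f′ * U) + ei * ek * (u * U)
        identity₂ = solve-∀ ℚ-ring
      sum₄ : ∀ (A B C D : K) (α β γ δ : Fin n → K) →
        Σ[ n ] (λ a → A * α a + B * β a + C * γ a + D * δ a) ≡ A * Σ[ n ] α + B * Σ[ n ] β + C * Σ[ n ] γ + D * Σ[ n ] δ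
      sum₄ A B C D α β γ δ = trans (Σ-+ {n} _ _) (cong₂ _+_ (trans (Σ-+ {n} _ _) (cong₂ _+_ (trans (Σ-+ {n} _ _)
        (cong₂ _+_ (Σ-*ˡ A α) (Σ-*ˡ B β))) (Σ-*ˡ C γ))) (Σ-*ˡ D δ))
      pointwise : ∀ i k → Σ[ n ] (λ a → term m (c′ a) (e′ a) i k) ≡ term (suc m) c e i k
      pointwise i k = begin
        Σ[ n ] (λ a → term m (c′ a) (e′ a) i k)
          ≡⟨ Σ-cong (λ a → identity₁ (c i) (c k) (e i) (e k) (X i a) (X k a) (P i a) (P k a) (G m i k) (H m i k) (H′ m i k) (u i k ^ m)) ⟩
        _ ≡⟨ sum₄ _ _ _ _ _ _ _ _ ⟩
        _ ≡⟨ identity₂ (c i) (c k) (e i) (e k) (u i k) (f i k) (f′ i k) (p i k) (G m i k) (H m i k) (H′ m i k) (u i k ^ m) ⟩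
        term (suc m) c e i k ∎
      split : Σ[ n ] (λ a → ΣΣ I (term m (c′ a) (e′ a))) ≡ ΣΣ I (term (suc m) c e)
      split = begin
        Σ[ n ] (λ a → Σ[ I ] (λ i → Σ[ I ] (λ k → term m (c′ a) (e′ a) i k))) ≡⟨ Σ-swap {n} {I} _ ⟩
        Σ[ I ] (λ i → Σ[ n ] (λ a → Σ[ I ] (λ k → term m (c′ a) (e′ a) i k))) ≡⟨ Σ-cong {I} (λ i → Σ-swap {n} {I} _) ⟩
        Σ[ I ] (λ i → Σ[ I ] (λ k → Σ[ n ] (λ a → term m (c′ a) (e′ a) i k))) ≡⟨ ΣΣ-cong pointwise ⟩
        ΣΣ I (term (suc m) c e) ∎

    H-closed : ∀ m i k → H (suc m) i k ≡ ι (suc m) * (f i k * u i k ^ m)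
    H-closed zero i k = identity (u i k) (f i k)
      where
      opaque
        unfolding K
        identity : ∀ u f → u * 0# + f * 1# ≡ (1# + 0#) * (f * 1#)
        identity = solve-∀ ℚ-ring
    H-closed (suc m) i k = trans (cong (λ q → u i k * q + f i k * u i k ^ suc m) (H-closed m i k))
        (identity (u i k) (f i k) (u i k ^ m) (ι (suc m)))
      where
      opaque
        unfolding K
        identity : ∀ u f U s → u * (s * (f * U)) + f * (u * U) ≡ (1# + s) * (f * (u * U))
        identity = solve-∀ ℚ-ring

    H′-closed : ∀ m i k → H′ (suc m) i k ≡ ι (suc m) * (f′ i k * u i k ^ m)
    H′-closed zero i k = identity (u i k) (f′ i k)
      where
      opaque
        unfolding K
        identity : ∀ u f → u * 0# + f * 1# ≡ (1# + 0#) * (f * 1#)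
        identity = solve-∀ ℚ-ring
    H′-closed (suc m) i k = trans (cong (λ q → u i k * q + f′ i k * u i k ^ suc m) (H′-closed m i k))
        (identity (u i k) (f′ i k) (u i k ^ m) (ι (suc m)))
      where
      opaque
        unfolding K
        identity : ∀ u f U s → u * (s * (f * U)) + f * (u * U) ≡ (1# + s) * (f * (u * U))
        identity = solve-∀ ℚ-ring

    G₁ : ∀ i k → G 1 i k ≡ p i k
    G₁ i k = identity (u i k) (f i k) (f′ i k) (p i k)
      where
      opaque
        unfolding K
        identity : ∀ u f f′ p → u * 0# + f′ * 0# + f * 0# + p * 1# ≡ p
        identity = solve-∀ ℚ-ring

    -- The mixed second derivative of the power: the two derivatives meet in the same tensor factor,
    -- giving `p`, or in two different ones, giving `f * f′`. Starting at degree two keeps all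
    -- exponents free of subtraction.
    G-closed : ∀ m i k → G (suc (suc m)) i k ≡
      ι (suc (suc m)) * (p i k * (u i k * u i k ^ m) + ι (suc m) * (f i k * f′ i k * u i k ^ m))
    G-closed zero i k = trans (cong (λ q → u i k * q + f′ i k * H 1 i k + f i k * H′ 1 i k + p i k * u i k ^ 1) (G₁ i k))
        (trans (cong₂ (λ q q′ → u i k * p i k + f′ i k * q + f i k * q′ + p i k * u i k ^ 1) (H-closed 0 i k) (H′-closed 0 i k))
          (identity (u i k) (f i k) (f′ i k) (p i k)))
      where
      opaque
        unfolding K
        identity : ∀ u f f′ p → u * p + f′ * ((1# + 0#) * (f * 1#)) + f * ((1# + 0#) * (f′ * 1#)) + p * (u * 1#)
          ≡ (1# + (1# + 0#)) * (p * (u * 1#) + (1# + 0#) * (f * f′ * 1#))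
        identity = solve-∀ ℚ-ring
    G-closed (suc m) i k = trans (cong (λ q → u i k * q + f′ i k * H (suc (suc m)) i k + f i k * H′ (suc (suc m)) i k + p i k * u i k ^ suc (suc m)) (G-closed m i k))
        (trans (cong₂ (λ q q′ → u i k * (ι (suc (suc m)) * (p i k * (u i k * u i k ^ m) + ι (suc m) * (f i k * f′ i k * u i k ^ m)))
          + f′ i k * q + f i k * q′ + p i k * u i k ^ suc (suc m)) (H-closed (suc m) i k) (H′-closed (suc m) i k))
          (identity (u i k) (f i k) (f′ i k) (p i k) (u i k ^ m) (ι m)))
      where
      opaque
        unfolding K
        identity : ∀ u f f′ p U s →
          u * ((1# + (1# + s)) * (p * (u * U) + (1# + s) * (f * f′ * U)))
            + f′ * ((1# + (1# + s)) * (f * (u * U))) + f * ((1# + (1# + s)) * (f′ * (u * U))) + p * (u * (u * U))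
          ≡ (1# + (1# + (1# + s))) * (p * (u * (u * U)) + (1# + (1# + s)) * (f * f′ * (u * U)))
        identity = solve-∀ ℚ-ring

  module Powers {I n} (X : Fin I → Vect n) where

    g : Fin I → Fin I → K
    g i k = X i ∙ X k

    g-sym : ∀ i k → g i k ≡ g k i
    g-sym i k = ∙-comm (X i) (X k)

    S : (Fin I → K) → ℕ → K
    S w m = ΣΣ I (λ i k → w i * w k * g i k ^ m)

    S-≥0 : ∀ w m → 0# ≤ S w m
    S-≥0 w m = subst (0# ≤_) (ΣΣ-cong (λ i k → identity (D.G m i k) (D.H m i k) (D.H′ m i k) (w i) (w k) (g i k ^ m)))
        (D.positive m (λ _ → 0#) w)
      where
      module D = Derivative X X
      opaque
        unfolding K
        identity : ∀ G H H′ wi wk U → 0# * 0# * G + 0# * wk * H + wi * 0# * H′ + wi * wk * U ≡ wi * wk * U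
        identity = solve-∀ ℚ-ring

    module _ {d} (P : Proj n d) (fX : ∀ i → Fix P (X i)) (w : Fin I → K) (s : K) where

      private
        N : Fin I → K
        N i = g i i

        -- As `a` ranges over the coordinates, these directions are the rows of X_i X_iᵀ - s Π. In
        -- the sum over `a` the projection then enters only through its trace, the dimension.
        dir : Fin n → Fin I → Vect n
        dir a i b = X i a * X i b + - s * Π P a b

        module D a = Derivative X (dir a)

        X∙Π : ∀ i a → X i ∙ Π P a ≡ X i a
        X∙Π i a = trans (∙-comm (X i) (Π P a)) (fX i a)

        ∙-lin : ∀ (x y : Vect n) α β (z : Vect n) → (λ b → α * x b + β * y b) ∙ z ≡ α * (x ∙ z) + β * (y ∙ z)
        ∙-lin x y α β z = trans (Σ-cong (λ a → identity α (x a) β (y a) (z a))) (trans (Σ-+ {n} _ _) (cong₂ _+_ (Σ-*ˡ {n} α _) (Σ-*ˡ {n} β _)))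
          where
          opaque
            unfolding K
            identity : ∀ α x β y z → (α * x + β * y) * z ≡ α * (x * z) + β * (y * z)
            identity = solve-∀ ℚ-ring

        f-eq : ∀ a i k → D.f a i k ≡ X i a * g i k + - s * X k a
        f-eq a i k = trans (∙-lin (X i) (Π P a) (X i a) (- s) (X k)) (cong (λ q → X i a * g i k + - s * q) (fX k a))

        f′-eq : ∀ a i k → D.f′ a i k ≡ X k a * g i k + - s * X i a
        f′-eq a i k = trans (∙-comm (X i) (dir a k)) (trans (f-eq a k i) (cong (λ q → X k a * q + - s * X i a) (g-sym k i)))

        p-eq : ∀ a i k → D.p a i k ≡ X i a * (X k a * g i k + - s * X i a) + - s * (X k a * X k a + - s * Π P a a)
        p-eq a i k = trans (∙-lin (X i) (Π P a) (X i a) (- s) (dir a k)) (cong₂ (λ q q′ → X i a * q + - s * q′) (f′-eq a i k)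
          (trans (∙-comm (Π P a) (dir a k)) (trans (∙-lin (X k) (Π P a) (X k a) (- s) (Π P a))
            (cong₂ (λ q q′ → X k a * q + - s * q′) (X∙Π k a) (Π-idem P a a)))))

        sum₄ : ∀ (A B C D : K) (α β γ δ : Fin n → K) →
          Σ[ n ] (λ a → A * α a + B * β a + C * γ a + D * δ a) ≡ A * Σ[ n ] α + B * Σ[ n ] β + C * Σ[ n ] γ + D * Σ[ n ] δ
        sum₄ A B C D α β γ δ = trans (Σ-+ {n} _ _) (cong₂ _+_ (trans (Σ-+ {n} _ _) (cong₂ _+_ (trans (Σ-+ {n} _ _)
          (cong₂ _+_ (Σ-*ˡ A α) (Σ-*ˡ B β))) (Σ-*ˡ C γ))) (Σ-*ˡ D δ))

        Σp : ∀ i k → Σ[ n ] (λ a → D.p a i k) ≡ g i k * g i k + - s * N i + - s * N k + s * s * ι d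
        Σp i k = trans (Σ-cong (λ a → trans (p-eq a i k) (identity (X i a) (X k a) (g i k) s (Π P a a))))
            (trans (sum₄ (g i k) (- s) (- s) (s * s) _ _ _ _) (cong (λ q → g i k * g i k + - s * N i + - s * N k + s * s * q) (Π-tr P)))
          where
          opaque
            unfolding K
            identity : ∀ x y g s π → x * (y * g + - s * x) + - s * (y * y + - s * π) ≡ g * (x * y) + - s * (x * x) + - s * (y * y) + s * s * π
            identity = solve-∀ ℚ-ring

        Σff′ : ∀ i k → Σ[ n ] (λ a → D.f a i k * D.f′ a i k) ≡
          g i k * g i k * g i k + - s * g i k * N i + - s * g i k * N k + s * s * g i k
        Σff′ i k = trans (Σ-cong (λ a → trans (cong₂ _*_ (f-eq a i k) (f′-eq a i k)) (identity (X i a) (X k a) (g i k) s)))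
            (sum₄ (g i k * g i k) (- s * g i k) (- s * g i k) (s * s) _ _ _ _)
          where
          opaque
            unfolding K
            identity : ∀ x y g s → (x * g + - s * y) * (y * g + - s * x) ≡
              g * g * (x * y) + - s * g * (x * x) + - s * g * (y * y) + s * s * (x * y)
            identity = solve-∀ ℚ-ring

        kernel : ℕ → Fin I → Fin I → K
        kernel m i k = ι (suc m) * (g i k * (g i k * g i k ^ m)) + - s * (N i + N k) * (ι (suc m) * g i k ^ m)
          + s * s * (ι d + ι m) * g i k ^ m

        ΣG : ∀ m i k → Σ[ n ] (λ a → D.G a (suc m) i k) ≡ ι (suc m) * kernel m i k
        ΣG zero i k = trans (Σ-cong (λ a → D.G₁ a i k)) (trans (Σp i k) (identity (g i k) s (N i) (N k) (ι d)))
          where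
          opaque
            unfolding K
            identity : ∀ g s x y d → g * g + - s * x + - s * y + s * s * d ≡
              (1# + 0#) * ((1# + 0#) * (g * (g * 1#)) + - s * (x + y) * ((1# + 0#) * 1#) + s * s * (d + 0#) * 1#)
            identity = solve-∀ ℚ-ring
        ΣG (suc m) i k = begin
          Σ[ n ] (λ a → D.G a (suc (suc m)) i k)
            ≡⟨ Σ-cong (λ a → D.G-closed a m i k) ⟩
          Σ[ n ] (λ a → jj * (D.p a i k * (g i k * g i k ^ m) + ι (suc m) * (D.f a i k * D.f′ a i k * g i k ^ m)))
            ≡⟨ Σ-cong (λ a → identity₁ jj (D.p a i k) (g i k * g i k ^ m) (ι (suc m)) (D.f a i k * D.f′ a i k) (g i k ^ m)) ⟩
          Σ[ n ] (λ a → jj * (g i k * g i k ^ m) * D.p a i k + jj * (ι (suc m) * g i k ^ m) * (D.f a i k * D.f′ a i k))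
            ≡⟨ trans (Σ-+ {n} _ _) (cong₂ _+_ (Σ-*ˡ {n} _ _) (Σ-*ˡ {n} _ _)) ⟩
          jj * (g i k * g i k ^ m) * Σ[ n ] (λ a → D.p a i k) + jj * (ι (suc m) * g i k ^ m) * Σ[ n ] (λ a → D.f a i k * D.f′ a i k)
            ≡⟨ cong₂ (λ q q′ → jj * (g i k * g i k ^ m) * q + jj * (ι (suc m) * g i k ^ m) * q′) (Σp i k) (Σff′ i k) ⟩
          _ ≡⟨ identity₂ (g i k) s (N i) (N k) (ι d) (g i k ^ m) (ι m) ⟩
          jj * kernel (suc m) i k ∎
          where
          open ≡-Reasoning
          jj : K
          jj = ι (suc (suc m))
          opaque
            unfolding K
            identity₁ : ∀ jj p U s F V → jj * (p * U + s * (F * V)) ≡ jj * U * p + jj * (s * V) * F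
            identity₁ = solve-∀ ℚ-ring
            identity₂ : ∀ g s x y d U t →
              (1# + (1# + t)) * (g * U) * (g * g + - s * x + - s * y + s * s * d)
                + (1# + (1# + t)) * ((1# + t) * U) * (g * g * g + - s * g * x + - s * g * y + s * s * g)
              ≡ (1# + (1# + t)) * ((1# + (1# + t)) * (g * (g * (g * U))) + - s * (x + y) * ((1# + (1# + t)) * (g * U)) + s * s * (d + (1# + t)) * (g * U))
            identity₂ = solve-∀ ℚ-ring

      -- `positive` in degree m + 1 along every direction `dir a`, summed over `a` and divided by m
      -- + 1. It is quadratic in the free parameter `s`; optimising `s` compares the power sums of
      -- degrees m and m + 2.
      kernel-≥0 : ∀ m → 0# ≤ ΣΣ I (λ i k → w i * w k * (ι (suc m) * (g i k * (g i k * g i k ^ m))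
        + - s * (g i i + g k k) * (ι (suc m) * g i k ^ m) + s * s * (ι d + ι m) * g i k ^ m))
      kernel-≥0 m = *-cancelˡ (ι-≥0 (suc m)) (ι-suc≢0 m)
          (subst₂ _≤_ (sym (*-zeroʳ (ι (suc m)))) total (Σ-≥0 (λ a → D.positive a (suc m) w (λ _ → 0#))))
        where
        open ≡-Reasoning
        opaque
          unfolding K
          identity : ∀ G H H′ wi wk U → wi * wk * G + wi * 0# * H + 0# * wk * H′ + 0# * 0# * U ≡ wi * wk * G
          identity = solve-∀ ℚ-ring
          rearrange : ∀ a b c → a * (b * c) ≡ b * (a * c)
          rearrange = solve-∀ ℚ-ring
        total : Σ[ n ] (λ a → ΣΣ I (D.term a (suc m) w (λ _ → 0#))) ≡ ι (suc m) * ΣΣ I (λ i k → w i * w k * kernel m i k)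
        total = begin
          Σ[ n ] (λ a → ΣΣ I (D.term a (suc m) w (λ _ → 0#)))
            ≡⟨ Σ-cong (λ a → ΣΣ-cong (λ i k → identity (D.G a (suc m) i k) (D.H a (suc m) i k) (D.H′ a (suc m) i k) (w i) (w k) (g i k ^ suc m))) ⟩
          Σ[ n ] (λ a → ΣΣ I (λ i k → w i * w k * D.G a (suc m) i k))
            ≡⟨ trans (Σ-swap {n} {I} _) (Σ-cong {I} (λ i → Σ-swap {n} {I} _)) ⟩
          ΣΣ I (λ i k → Σ[ n ] (λ a → w i * w k * D.G a (suc m) i k))
            ≡⟨ ΣΣ-cong (λ i k → trans (Σ-*ˡ {n} _ _) (cong (w i * w k *_) (ΣG m i k))) ⟩
          ΣΣ I (λ i k → w i * w k * (ι (suc m) * kernel m i k))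
            ≡⟨ ΣΣ-cong (λ i k → rearrange (w i * w k) (ι (suc m)) (kernel m i k)) ⟩
          ΣΣ I (λ i k → ι (suc m) * (w i * w k * kernel m i k))
            ≡⟨ ΣΣ-*ˡ {I} _ _ ⟩
          ι (suc m) * ΣΣ I (λ i k → w i * w k * kernel m i k) ∎

-- Moment bounds as for spherical designs, and bounds for sets with small inner products.

module Spherical where

  open RatSum
  open LinAlg
  open Gram
  open import Data.Nat as ℕ using (ℕ; zero; suc)
  import Data.Nat.Properties as ℕP
  open import Data.Fin using (Fin; zero; suc)
  import Data.Fin.Properties as FinP
  open import Relation.Nullary using (yes; no)
  open import Relation.Binary.PropositionalEquality
  open import Tactic.RingSolver using (solve-∀)

  double : ℕ → ℕ
  double zero    = 0
  double (suc k) = suc (suc (double k))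

  odds : ℕ → ℕ
  odds zero    = 1
  odds (suc k) = suc (double k) ℕ.* odds k

  -- The product D (D + 2) ⋯ (D + 2k - 2), while `odds k` is (2k - 1)!!. For D > 0 the quotient
  -- `odds k / rising D k` is the mean of the 2k-th power of a coordinate on the unit sphere in
  -- dimension D.
  rising : ℕ → ℕ → ℕ
  rising D zero    = 1
  rising D (suc k) = (D ℕ.+ double k) ℕ.* rising D k

  ^-≥0 : ∀ {x} m → 0# ≤ x → 0# ≤ x ^ m
  ^-≥0 zero    h = 0≤1
  ^-≥0 (suc m) h = *-≥0 h (^-≥0 m h)

  even-^-≥0 : ∀ x k → 0# ≤ x ^ double k
  even-^-≥0 x zero    = 0≤1
  even-^-≥0 x (suc k) = subst (0# ≤_) (*-assoc x x (x ^ double k)) (*-≥0 (sq-≥0 x) (even-^-≥0 x k))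

  ^-mono : ∀ {x y} m → 0# ≤ x → x ≤ y → x ^ m ≤ y ^ m
  ^-mono zero    0≤x x≤y = ≤-refl
  ^-mono (suc m) 0≤x x≤y = *-mono-≥0 0≤x (^-≥0 m 0≤x) x≤y (^-mono m 0≤x x≤y)

  *-^ : ∀ x y m → (x * y) ^ m ≡ x ^ m * y ^ m
  *-^ x y zero    = sym (*-identityˡ 1#)
  *-^ x y (suc m) = trans (cong (x * y *_) (*-^ x y m)) (identity x y (x ^ m) (y ^ m))
    where
    opaque
      unfolding K
      identity : ∀ x y a b → x * y * (a * b) ≡ x * a * (y * b)
      identity = solve-∀ ℚ-ring

  module Moments {I n} (X : Fin I → Vect n) {d} (P : Proj n d) (fX : ∀ i → Fix P (X i))
    (D : ℕ) (d≤D : d ℕ.≤ suc D) (w : Fin I → K) where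

    open Powers X public

    D⁺ : ℕ
    D⁺ = suc D

    module _ (N : K) (norm : ∀ i → g i i ≡ N) where

      -- For equal squared lengths `N` the quadratic of `kernel-≥0` is minimised near s = (m + 1) N
      -- / (d + m). The denominator used is D⁺ + m, since only an upper bound for the dimension is
      -- known.
      chain : ∀ m → ι (suc m) * (N * N) * S w m ≤ ι (D⁺ ℕ.+ m) * S w (suc (suc m))
      chain m = *-cancelˡ (ι-≥0 (suc m)) (ι-suc≢0 m) (p≤q-by bound (sym (trans (cong (lhs +_) expand) (finish lhs rhs))))
        where
        open ≡-Reasoning
        T T⁻¹ s S₀ S₂ M lhs rhs : K
        T = ι (D⁺ ℕ.+ m)
        T⁻¹ = inverse T (ι-suc≢0 (D ℕ.+ m))
        M = ι (suc m)
        s = M * N * T⁻¹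
        S₀ = S w m
        S₂ = S w (suc (suc m))
        lhs = M * (M * (N * N) * S₀)
        rhs = M * (T * S₂)
        opaque
          unfolding K
          split : ∀ ww M g² s N t U → ww * (M * g² + - s * (N + N) * (M * U) + s * s * t * U)
            ≡ M * (ww * g²) + (- s * (N + N) * M + s * s * t) * (ww * U)
          split = solve-∀ ℚ-ring
          finish : ∀ a b → a + (b + - a) ≡ b
          finish = solve-∀ ℚ-ring
          algebra : ∀ M N T T⁻¹ a₀ a₂ e → T * (M * a₂ + (- (M * N * T⁻¹) * (N + N) * M + M * N * T⁻¹ * (M * N * T⁻¹) * (T + - e)) * a₀)
              + T * (M * N * T⁻¹ * (M * N * T⁻¹) * e * a₀)
            ≡ M * (T * a₂) + (T * T⁻¹ * (T * T⁻¹) + - ((1# + 1#) * (T * T⁻¹))) * (M * (M * (N * N) * a₀))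
          algebra = solve-∀ ℚ-ring
          minus-one : (1# * 1# + - ((1# + 1#) * 1#)) ≡ - 1#
          minus-one = refl
          neg-one : ∀ a b → a + - 1# * b ≡ a + - b
          neg-one = solve-∀ ℚ-ring
          gap : ∀ t d m → t ≡ d + m → ∀ D → (D + m) + - (D + - d) ≡ t
          gap t d m refl D = gap′ d m D
            where
            gap′ : ∀ d m D → (D + m) + - (D + - d) ≡ d + m
            gap′ = solve-∀ ℚ-ring
        e : K
        e = ι D⁺ - ι d
        0≤e : 0# ≤ e
        0≤e = 0≤q-p (ι-mono d≤D)
        t≡ : T + - e ≡ ι d + ι m
        t≡ = trans (cong (_+ - e) (ι-+ D⁺ m)) (gap (ι d + ι m) (ι d) (ι m) refl (ι D⁺))
        base : K
        base = M * S₂ + (- s * (N + N) * M + s * s * (T + - e)) * S₀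
        0≤base : 0# ≤ base
        0≤base = subst (0# ≤_) (begin
          ΣΣ I (λ i k → w i * w k * (M * (g i k * (g i k * g i k ^ m)) + - s * (g i i + g k k) * (M * g i k ^ m) + s * s * (ι d + ι m) * g i k ^ m))
            ≡⟨ ΣΣ-cong (λ i k → trans (cong₂ (λ a b → w i * w k * (M * (g i k * (g i k * g i k ^ m)) + - s * (a + b) * (M * g i k ^ m) + s * s * (ι d + ι m) * g i k ^ m)) (norm i) (norm k))
                 (split (w i * w k) M (g i k * (g i k * g i k ^ m)) s N (ι d + ι m) (g i k ^ m))) ⟩
          ΣΣ I (λ i k → M * (w i * w k * (g i k * (g i k * g i k ^ m))) + (- s * (N + N) * M + s * s * (ι d + ι m)) * (w i * w k * g i k ^ m))
            ≡⟨ trans (ΣΣ-+ {I} _ _) (cong₂ _+_ (ΣΣ-*ˡ {I} _ _) (ΣΣ-*ˡ {I} _ _)) ⟩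
          M * S₂ + (- s * (N + N) * M + s * s * (ι d + ι m)) * S₀
            ≡⟨ cong (λ q → M * S₂ + (- s * (N + N) * M + s * s * q) * S₀) t≡ ⟨
          base ∎) (kernel-≥0 P fX w s m)
        -- The second summand pays for replacing `d` by the possibly larger `D⁺`; it is nonnegative
        -- because `S₀` is itself a Gram sum.
        bound : 0# ≤ T * base + T * (s * s * e * S₀)
        bound = +-≥0 (*-≥0 (ι-≥0 (D⁺ ℕ.+ m)) 0≤base) (*-≥0 (ι-≥0 (D⁺ ℕ.+ m)) (*-≥0 (*-≥0 (sq-≥0 s) 0≤e) (S-≥0 w m)))
        TT : T * T⁻¹ ≡ 1#
        TT = *-inverseʳ T (ι-suc≢0 (D ℕ.+ m))
        expand : T * base + T * (s * s * e * S₀) ≡ rhs + - lhs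
        expand = begin
          T * base + T * (s * s * e * S₀) ≡⟨ algebra M N T T⁻¹ S₀ S₂ e ⟩
          rhs + (T * T⁻¹ * (T * T⁻¹) + - ((1# + 1#) * (T * T⁻¹))) * lhs ≡⟨ cong (λ q → rhs + (q * q + - ((1# + 1#) * q)) * lhs) TT ⟩
          rhs + (1# * 1# + - ((1# + 1#) * 1#)) * lhs ≡⟨ cong (λ q → rhs + q * lhs) minus-one ⟩
          rhs + - 1# * lhs ≡⟨ neg-one rhs lhs ⟩
          rhs + - lhs ∎

      -- `chain` telescoped through the even degrees: the 2k-th moment is at least that of the
      -- uniform measure on the sphere in dimension `D⁺`.
      moment : ∀ k → ι (odds k) * N ^ double k * S w 0 ≤ ι (rising D⁺ k) * S w (double k)
      moment zero    = ≤-reflexive (identity (S w 0))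
        where
        opaque
          unfolding K
          identity : ∀ s → (1# + 0#) * 1# * s ≡ (1# + 0#) * s
          identity = solve-∀ ℚ-ring
      moment (suc k) = ≤-trans (≤-reflexive (trans (cong (λ q → q * (N * (N * N ^ double k)) * S w 0) (ι-* (suc (double k)) (odds k)))
            (identity₁ (ι (suc (double k))) (ι (odds k)) N (N ^ double k) (S w 0))))
          (≤-trans (*-monoˡ _ (*-≥0 (ι-≥0 (suc (double k))) (sq-≥0 N)) (moment k))
          (≤-trans (≤-reflexive (identity₂ (ι (suc (double k))) (N * N) (ι (rising D⁺ k)) (S w (double k))))
          (≤-trans (*-monoˡ _ (ι-≥0 (rising D⁺ k)) (chain (double k)))
            (≤-reflexive (trans (identity₃ (ι (rising D⁺ k)) (ι (D⁺ ℕ.+ double k)) (S w (double (suc k))))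
              (cong (_* S w (double (suc k))) (sym (ι-* (D⁺ ℕ.+ double k) (rising D⁺ k)))))))))
        where
        opaque
          unfolding K
          identity₁ : ∀ a b N M s → a * b * (N * (N * M)) * s ≡ a * (N * N) * (b * M * s)
          identity₁ = solve-∀ ℚ-ring
          identity₂ : ∀ a N² r s → a * N² * (r * s) ≡ r * (a * N² * s)
          identity₂ = solve-∀ ℚ-ring
          identity₃ : ∀ r t s → r * (t * s) ≡ t * r * s
          identity₃ = solve-∀ ℚ-ring

      -- The test polynomial t^2k (t - s)(t + s)², homogenised with s = p/q.
      F : ℕ → (p q : K) → K → K
      F k p q y = y ^ double k * ((q * y - p * N) * ((q * y + p * N) * (q * y + p * N)))

      -- Expanding `F` leaves four power sums. `chain` bounds the degree 2k + 2 sum by the degree 2k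
      -- one, and the degree 2k + 3 sum by the degree 2k + 1 one; the condition p²(D⁺ + 2k) ≤ q²(2k
      -- + 1) makes the odd part nonnegative. What remains is p N³ times the slack `e` of that
      -- condition times the 2k-th moment.
      test-polynomial-bound : ∀ k p q e → 0# ≤ p → 0# ≤ q → 0# ≤ N → 0# ≤ e → p ≤ q →
        q * q * ι (suc (double k)) ≡ p * p * ι (D⁺ ℕ.+ double k) + e →
        p * (N * (N * N)) * e * (ι (odds k) * N ^ double k * S w 0)
          ≤ ι (rising D⁺ k) * (ι (D⁺ ℕ.+ double k) * ΣΣ I (λ i j → w i * w j * F k p q (g i j)))
      test-polynomial-bound k p q e 0≤p 0≤q 0≤N 0≤e p≤q eq =
          ≤-trans (*-monoˡ _ (*-≥0 (*-≥0 0≤p (*-≥0 0≤N (sq-≥0 N))) 0≤e) (moment k))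
          (≤-trans (≤-reflexive (rearrange _ (ι (rising D⁺ k)) S₀))
            (*-monoˡ _ (ι-≥0 (rising D⁺ k)) lower))
        where
        open ≡-Reasoning
        S₀ S₁ S₂ S₃ T T′ M : K
        S₀ = S w (double k)
        S₁ = S w (suc (double k))
        S₂ = S w (suc (suc (double k)))
        S₃ = S w (suc (suc (suc (double k))))
        T = ι (D⁺ ℕ.+ double k)
        T′ = ι (D⁺ ℕ.+ suc (double k))
        M = ι (suc (double k))
        opaque
          unfolding K
          rearrange : ∀ a r s → a * (r * s) ≡ r * (a * s)
          rearrange = solve-∀ ℚ-ring
          expand-F : ∀ w g U p q N → w * (U * ((q * g + - (p * N)) * ((q * g + p * N) * (q * g + p * N)))) ≡
            q * (q * q) * (w * (g * (g * (g * U)))) + q * q * p * N * (w * (g * (g * U)))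
            + - (q * p * p * (N * N)) * (w * (g * U)) + - (p * p * p * (N * (N * N))) * (w * U)
          expand-F = solve-∀ ℚ-ring
          regroup : ∀ T p q N s₀ s₁ s₂ s₃ M →
            p * (N * (N * N)) * (q * q * M + - (p * p * T)) * s₀ + (q * (q * q * (T * s₃) + - (p * p * (N * N) * (T * s₁))) + p * N * (q * q) * (T * s₂ + - (M * (N * N) * s₀)))
            ≡ T * (q * (q * q) * s₃ + q * q * p * N * s₂ + - (q * p * p * (N * N)) * s₁ + - (p * p * p * (N * (N * N))) * s₀)
          regroup = solve-∀ ℚ-ring
          e-from : ∀ a b c → a ≡ b + c → a + - b ≡ c
          e-from a b c refl = e-from′ b c
            where
            e-from′ : ∀ b c → b + c + - b ≡ c
            e-from′ = solve-∀ ℚ-ring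
          odd-gap : ∀ T p q N s₁ s₃ M →
            (1# + T) * (q * q * (T * s₃) + - (p * p * (N * N) * (T * s₁))) ≡
            q * q * T * ((1# + T) * s₃ + - ((1# + M) * (N * N) * s₁)) + T * (N * N) * s₁ * ((q * q * M + - (p * p * T)) + (q * q + - (p * p)))
          odd-gap = solve-∀ ℚ-ring
        sum-F : ΣΣ I (λ i j → w i * w j * F k p q (g i j)) ≡
          q * (q * q) * S₃ + q * q * p * N * S₂ + - (q * p * p * (N * N)) * S₁ + - (p * p * p * (N * (N * N))) * S₀
        sum-F = trans (ΣΣ-cong (λ i j → expand-F (w i * w j) (g i j) (g i j ^ double k) p q N))
          (trans (ΣΣ-+ {I} _ _) (cong₂ _+_ (trans (ΣΣ-+ {I} _ _) (cong₂ _+_ (trans (ΣΣ-+ {I} _ _)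
            (cong₂ _+_ (ΣΣ-*ˡ {I} _ _) (ΣΣ-*ˡ {I} _ _))) (ΣΣ-*ˡ {I} _ _))) (ΣΣ-*ˡ {I} _ _)))
        T′≡ : T′ ≡ 1# + T
        T′≡ = cong ι (ℕP.+-suc D⁺ (double k))
        e≡ : q * q * M + - (p * p * T) ≡ e
        e≡ = e-from _ _ _ eq
        odd-≥0 : 0# ≤ q * q * (T * S₃) + - (p * p * (N * N) * (T * S₁))
        odd-≥0 = *-cancelˡ (ι-≥0 (suc (D⁺ ℕ.+ double k))) (ι-suc≢0 (D⁺ ℕ.+ double k)) (subst₂ _≤_ (sym (*-zeroʳ (1# + T))) (sym (odd-gap T p q N S₁ S₃ M))
          (+-≥0 (*-≥0 (*-≥0 (sq-≥0 q) (ι-≥0 (D⁺ ℕ.+ double k))) (0≤q-p (subst (λ q → ι (suc (suc (double k))) * (N * N) * S₁ ≤ q * S₃) T′≡ (chain (suc (double k))))))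
            (*-≥0 (*-≥0 (*-≥0 (ι-≥0 (D⁺ ℕ.+ double k)) (sq-≥0 N)) (S-≥0 w (suc (double k))))
              (+-≥0 (subst (0# ≤_) (sym e≡) 0≤e) (0≤q-p (*-mono-≥0 0≤p 0≤p p≤q p≤q))))))
        lower : p * (N * (N * N)) * e * S₀ ≤ T * ΣΣ I (λ i j → w i * w j * F k p q (g i j))
        lower = p≤q-by (+-≥0 (*-≥0 0≤q odd-≥0) (*-≥0 (*-≥0 (*-≥0 0≤p 0≤N) (sq-≥0 q)) (0≤q-p (chain (double k)))))
          (trans (cong (T *_) sum-F) (trans (sym (regroup T p q N S₀ S₁ S₂ S₃ M))
            (cong (λ e → p * (N * (N * N)) * e * S₀ + (q * (q * q * (T * S₃) + - (p * p * (N * N) * (T * S₁)))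
              + p * N * (q * q) * (T * S₂ + - (M * (N * N) * S₀)))) e≡)))

    module _ (κ : K) (0≤κ : 0# ≤ κ) (0≤w : ∀ i → 0# ≤ w i) (large : ∀ i → w i * κ ≤ w i * g i i) where

      W : K
      W = Σ[ I ] w

      -- The optimisation of `chain` in degree 0, now for unequal lengths. The squared lengths enter
      -- linearly with the sign of -s, and s ≥ 0, so a lower bound `κ` on them is enough.
      second-moment : κ * κ * (W * W) ≤ ι D⁺ * S w 2
      second-moment = p≤q-by bound (sym (trans (cong (κ * κ * (W * W) +_) expand) (finish _ _)))
        where
        open ≡-Reasoning
        T T⁻¹ s e : K
        T = ι D⁺
        T⁻¹ = inverse T (ι-suc≢0 D)
        s = κ * T⁻¹
        e = T - ι d
        TT : T * T⁻¹ ≡ 1#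
        TT = *-inverseʳ T (ι-suc≢0 D)
        V : K
        V = Σ[ I ] (λ i → w i * g i i)
        0≤s : 0# ≤ s
        0≤s = *-≥0 0≤κ (0≤inverse (ι-≥0 D⁺))
          where
          0≤inverse : 0# ≤ T → 0# ≤ T⁻¹
          0≤inverse 0≤T = *-cancelˡ 0≤T (ι-suc≢0 D) (subst₂ _≤_ (sym (*-zeroʳ T)) (sym TT) 0≤1)
        0≤W : 0# ≤ W
        0≤W = Σ-≥0 0≤w
        κW≤V : W * κ ≤ V
        κW≤V = subst (_≤ V) (Σ-*ʳ w κ) (Σ-≤ large)
        opaque
          unfolding K
          split : ∀ wi wk g s x y d → wi * wk * ((1# + 0#) * (g * (g * 1#)) + - s * (x + y) * ((1# + 0#) * 1#) + s * s * (d + 0#) * 1#)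
            ≡ (wi * wk * (g * (g * 1#)) + s * s * d * (wi * wk)) + (- s * (wi * x * wk) + - s * (wi * (wk * y)))
          split = solve-∀ ℚ-ring
          finish : ∀ a b → a + (b + - a) ≡ b
          finish = solve-∀ ℚ-ring
          algebra : ∀ κ T T⁻¹ e W V S →
            T * ((S + κ * T⁻¹ * (κ * T⁻¹) * (T + - e) * (W * W)) + (- (κ * T⁻¹) * (V * W) + - (κ * T⁻¹) * (W * V)))
              + (T * (κ * T⁻¹ * (κ * T⁻¹) * e * (W * W)) + (1# + 1#) * (T * (κ * T⁻¹ * W * (V + - (W * κ)))))
            ≡ T * S + (T * T⁻¹ * (T * T⁻¹) + - ((1# + 1#) * (T * T⁻¹))) * (κ * κ * (W * W))
          algebra = solve-∀ ℚ-ring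
          minus-one : ∀ a b → a + (1# * 1# + - ((1# + 1#) * 1#)) * b ≡ a + - b
          minus-one = solve-∀ ℚ-ring
          gap : ∀ d T → d ≡ T + - (T + - d)
          gap = solve-∀ ℚ-ring
        base : K
        base = (S w 2 + s * s * (T + - e) * (W * W)) + (- s * (V * W) + - s * (W * V))
        0≤base : 0# ≤ base
        0≤base = subst (0# ≤_) (begin
          ΣΣ I (λ i k → w i * w k * ((1# + 0#) * (g i k * (g i k * 1#)) + - s * (g i i + g k k) * ((1# + 0#) * 1#) + s * s * (ι d + 0#) * 1#))
            ≡⟨ ΣΣ-cong (λ i k → split (w i) (w k) (g i k) s (g i i) (g k k) (ι d)) ⟩
          ΣΣ I (λ i k → (w i * w k * (g i k * (g i k * 1#)) + s * s * ι d * (w i * w k)) + (- s * (w i * g i i * w k) + - s * (w i * (w k * g k k))))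
            ≡⟨ trans (ΣΣ-+ {I} _ _) (cong₂ _+_ (trans (ΣΣ-+ {I} _ _) (cong (S w 2 +_) (trans (ΣΣ-*ˡ {I} _ _) (cong (s * s * ι d *_) (Σ-product w w)))))
                 (trans (ΣΣ-+ {I} _ _) (cong₂ _+_ (trans (ΣΣ-*ˡ {I} _ _) (cong (- s *_) (Σ-product (λ i → w i * g i i) w)))
                   (trans (ΣΣ-*ˡ {I} _ _) (cong (- s *_) (Σ-product w (λ k → w k * g k k))))))) ⟩
          (S w 2 + s * s * ι d * (W * W)) + (- s * (V * W) + - s * (W * V))
            ≡⟨ cong (λ q → (S w 2 + s * s * q * (W * W)) + (- s * (V * W) + - s * (W * V))) (gap (ι d) T) ⟩
          base ∎) (kernel-≥0 P fX w s 0)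
        rest : K
        rest = T * (s * s * e * (W * W)) + (1# + 1#) * (T * (s * W * (V + - (W * κ))))
        bound : 0# ≤ T * base + rest
        bound = +-≥0 (*-≥0 (ι-≥0 D⁺) 0≤base) (+-≥0 (*-≥0 (ι-≥0 D⁺) (*-≥0 (*-≥0 (sq-≥0 s) (0≤q-p (ι-mono d≤D))) (sq-≥0 W)))
          (*-≥0 (+-≥0 0≤1 0≤1) (*-≥0 (ι-≥0 D⁺) (*-≥0 (*-≥0 0≤s 0≤W) (0≤q-p κW≤V)))))
        expand : T * base + rest ≡ T * S w 2 + - (κ * κ * (W * W))
        expand = trans (algebra κ T T⁻¹ e W V (S w 2)) (trans (cong (λ q → T * S w 2 + (q * q + - ((1# + 1#) * q)) * (κ * κ * (W * W))) TT) (minus-one _ _))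

  Kronecker : ∀ {I} → Fin I → Fin I → K
  Kronecker i k with i FinP.≟ k
  ... | yes _ = 1#
  ... | no _  = 0#

  Σ-Kronecker : ∀ {I} (i : Fin I) (f : Fin I → K) → Σ[ I ] (λ k → Kronecker i k * f k) ≡ f i
  Σ-Kronecker {suc I} zero f = trans (cong₂ _+_ (*-identityˡ (f zero)) (Σ-≡0 {I} (λ k → *-zeroˡ (f (suc k))))) (+-identityʳ (f zero))
  Σ-Kronecker {suc I} (suc i) f = trans (0+ (*-zeroˡ (f zero))) (trans (Σ-cong (λ k → cong (_* f (suc k)) (shift i k))) (Σ-Kronecker i (λ k → f (suc k))))
    where
    shift : ∀ {I} (i k : Fin I) → Kronecker (suc i) (suc k) ≡ Kronecker i k
    shift i k with i FinP.≟ k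
    ... | yes _ = refl
    ... | no _  = refl

  -- All pairs, the diagonal included, are charged `β`; idempotence of the 0-1 weights lets the
  -- diagonal excess `α` be charged once per point.
  ΣΣ-diagonal : ∀ {I} (w : Fin I → K) (φ : Fin I → Fin I → K) (α β : K) → (∀ i → 0# ≤ w i) → (∀ i → w i * w i ≡ w i) →
    (∀ i → w i * φ i i ≤ w i * (α + β)) → (∀ i k → i ≢ k → w i * w k * φ i k ≤ w i * w k * β) →
    ΣΣ I (λ i k → w i * w k * φ i k) ≤ Σ[ I ] w * α + Σ[ I ] w * Σ[ I ] w * β
  ΣΣ-diagonal {I} w φ α β 0≤w ww diag off = ≤-trans (ΣΣ-≤ pointwise) (≤-reflexive total)
    where
    open ≡-Reasoning
    pointwise : ∀ i k → w i * w k * φ i k ≤ Kronecker i k * (w k * α) + w i * (w k * β)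
    pointwise i k with i FinP.≟ k
    ... | yes refl = subst₂ _≤_ (cong (_* φ i i) (sym (ww i)))
            (trans (*-distribˡ-+ (w i) α β) (cong₂ _+_ (sym (*-identityˡ (w i * α)))
              (trans (cong (_* β) (sym (ww i))) (*-assoc (w i) (w i) β)))) (diag i)
    ... | no i≢k = subst (w i * w k * φ i k ≤_) (trans (*-assoc (w i) (w k) β) (sym (0+ (*-zeroˡ (w k * α))))) (off i k i≢k)
    total : ΣΣ I (λ i k → Kronecker i k * (w k * α) + w i * (w k * β)) ≡ Σ[ I ] w * α + Σ[ I ] w * Σ[ I ] w * β
    total = begin
      ΣΣ I (λ i k → Kronecker i k * (w k * α) + w i * (w k * β)) ≡⟨ ΣΣ-+ {I} _ _ ⟩
      ΣΣ I (λ i k → Kronecker i k * (w k * α)) + ΣΣ I (λ i k → w i * (w k * β))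
        ≡⟨ cong₂ _+_ (trans (Σ-cong (λ i → Σ-Kronecker i (λ k → w k * α))) (Σ-*ʳ w α))
             (trans (Σ-product w (λ k → w k * β)) (trans (cong (Σ[ I ] w *_) (Σ-*ʳ w β)) (sym (*-assoc (Σ[ I ] w) (Σ[ I ] w) β)))) ⟩
      Σ[ I ] w * α + Σ[ I ] w * Σ[ I ] w * β ∎

  module SmallProducts {I n} (X : Fin I → Vect n) {d} (P : Proj n d) (fX : ∀ i → Fix P (X i))
    (D : ℕ) (d≤D : d ℕ.≤ suc D) (w : Fin I → K) (0≤w : ∀ i → 0# ≤ w i) (ww : ∀ i → w i * w i ≡ w i) where

    open Moments X P fX D d≤D w

    private
      W′ : K
      W′ = Σ[ I ] w

    -- The squared length of the weighted sum of the vectors is nonnegative.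
    negative-products : ∀ N s → (∀ i → w i * g i i ≤ w i * N) → (∀ i k → i ≢ k → w i * w k * g i k ≤ w i * w k * - s) →
      W′ * (W′ * s) ≤ W′ * (N + s)
    negative-products N s diag off = p≤q-by 0≤S (identity W′ N s)
      where
      opaque
        unfolding K
        identity : ∀ W N s → W * (N + s) ≡ W * (W * s) + (W * (N + s) + W * W * - s)
        identity = solve-∀ ℚ-ring
        cancel : ∀ N s → N ≡ (N + s) + - s
        cancel = solve-∀ ℚ-ring
      0≤S : 0# ≤ W′ * (N + s) + W′ * W′ * - s
      0≤S = ≤-trans (S-≥0 w 1) (ΣΣ-diagonal w (λ i k → g i k ^ 1) (N + s) (- s) 0≤w ww
        (λ i → subst₂ _≤_ (cong (w i *_) (sym (*-identityʳ (g i i)))) (cong (w i *_) (cancel N s)) (diag i))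
        (λ i k i≢k → subst (λ q → w i * w k * q ≤ _) (sym (*-identityʳ (g i k))) (off i k i≢k)))

    -- (t - s)(t + 2s)² = t³ + 3 s t² - 4 s³ has no linear term.
    small-products : ∀ N κ s → 0# ≤ κ → 0# ≤ s → s ≤ N → (∀ i → w i * κ ≤ w i * g i i) → (∀ i → w i * g i i ≤ w i * N) →
      (∀ i → 0# ≤ g i i) → (∀ i k → i ≢ k → w i * w k * g i k ≤ w i * w k * s) →
      W′ * (W′ * ((1# + 1# + 1#) * s * (κ * κ) - (1# + 1# + 1# + 1#) * (s * s * s) * ι (suc D)))
        ≤ W′ * (ι (suc D) * ((N - s) * ((N + (1# + 1#) * s) * (N + (1# + 1#) * s))))
    small-products N κ s 0≤κ 0≤s s≤N low diag 0≤g off =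
        p≤q-by (+-≥0 (*-≥0 0≤T (0≤q-p (≤-trans (≤-reflexive sum-f) upper))) (+-≥0 (*-≥0 0≤T (S-≥0 w 3)) (*-≥0 (*-≥0 (+-≥0 (+-≥0 0≤1 0≤1) 0≤1) 0≤s) (0≤q-p (second-moment κ 0≤κ 0≤w low)))))
          (identity W′ s κ (ι (suc D)) fN (S w 3) (S w 2))
      where
      0≤T : 0# ≤ ι (suc D)
      0≤T = ι-≥0 (suc D)
      two fN : K
      two = 1# + 1#
      fN = (N - s) * ((N + two * s) * (N + two * s))
      f : K → K
      f q = (q - s) * ((q + two * s) * (q + two * s))
      opaque
        unfolding K
        identity : ∀ W s κ T fN s₃ s₂ → W * (T * fN) ≡
          W * (W * ((1# + 1# + 1#) * s * (κ * κ) + - ((1# + 1# + 1# + 1#) * (s * s * s) * T)))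
          + (T * (W * fN + - (s₃ + (1# + 1# + 1#) * s * s₂ + - ((1# + 1# + 1# + 1#) * (s * s * s)) * (W * W)))
            + (T * s₃ + (1# + 1# + 1#) * s * (T * s₂ + - (κ * κ * (W * W)))))
        identity = solve-∀ ℚ-ring
        expand : ∀ w g s → w * ((g + - s) * ((g + (1# + 1#) * s) * (g + (1# + 1#) * s))) ≡
          w * (g * (g * (g * 1#))) + (1# + 1# + 1#) * s * (w * (g * (g * 1#))) + - ((1# + 1# + 1# + 1#) * (s * s * s)) * w
        expand = solve-∀ ℚ-ring
        zero-right : ∀ a b → a ≡ a + b * 0#
        zero-right = solve-∀ ℚ-ring
        move : ∀ w g s A → w * ((g + - s) * A) ≡ (w * g + - (w * s)) * A
        move = solve-∀ ℚ-ring
        plus-zero : ∀ w A → w * A ≡ w * (A + 0#)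
        plus-zero = solve-∀ ℚ-ring
        times-zero : ∀ w → 0# ≡ w * 0#
        times-zero = solve-∀ ℚ-ring
      sum-f : S w 3 + (1# + 1# + 1#) * s * S w 2 + - ((1# + 1# + 1# + 1#) * (s * s * s)) * (W′ * W′) ≡ ΣΣ I (λ i k → w i * w k * f (g i k))
      sum-f = sym (trans (ΣΣ-cong (λ i k → expand (w i * w k) (g i k) s)) (trans (ΣΣ-+ {I} _ _)
        (cong₂ _+_ (trans (ΣΣ-+ {I} _ _) (cong (S w 3 +_) (ΣΣ-*ˡ {I} _ _))) (trans (ΣΣ-*ˡ {I} _ _) (cong (_ *_) (Σ-product w w))))))
      0≤2s : 0# ≤ two * s
      0≤2s = *-≥0 (+-≥0 0≤1 0≤1) 0≤s
      upper : ΣΣ I (λ i k → w i * w k * f (g i k)) ≤ W′ * fN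
      upper = subst (ΣΣ I (λ i k → w i * w k * f (g i k)) ≤_) (sym (zero-right (W′ * fN) (W′ * W′))) (ΣΣ-diagonal w (λ i k → f (g i k)) fN 0# 0≤w ww on-diagonal off-diagonal)
        where
        on-diagonal : ∀ i → w i * f (g i i) ≤ w i * (fN + 0#)
        on-diagonal i = subst (w i * f (g i i) ≤_) (plus-zero (w i) fN) (≤-trans
          (≤-trans (≤-reflexive (move (w i) (g i i) s A)) (≤-trans (*-monoʳ A (sq-≥0 _) (+-monoˡ-≤ (- (w i * s)) (diag i)))
            (≤-reflexive (sym (move (w i) N s A)))))
          (≤-trans (≤-reflexive (sym (*-assoc (w i) (N - s) A))) (≤-trans (monotone i)
            (≤-reflexive (*-assoc (w i) (N - s) ((N + two * s) * (N + two * s)))))))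
          where
          A = (g i i + two * s) * (g i i + two * s)
          opaque
            unfolding K
            spread : ∀ w c g t → w * c * ((g + t) * (g + t)) ≡ c * (w * g * (g + t + t)) + w * c * (t * t)
            spread = solve-∀ ℚ-ring
            spread′ : ∀ w N g t → w * N * (g + t + t) ≡ N * (w * g + w * (t + t))
            spread′ = solve-∀ ℚ-ring
            spread″ : ∀ w N t → N * (w * N + w * (t + t)) ≡ w * N * (N + t + t)
            spread″ = solve-∀ ℚ-ring
          0≤N : 0# ≤ N
          0≤N = ≤-trans 0≤s s≤N
          -- The bound on `g i i` is available only multiplied by `w i`, so the square is expanded
          -- and its factors are replaced one at a time.
          monotone : ∀ i → w i * (N - s) * ((g i i + two * s) * (g i i + two * s)) ≤ w i * (N - s) * ((N + two * s) * (N + two * s))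
          monotone i = ≤-trans (≤-reflexive (spread (w i) (N - s) (g i i) (two * s)))
            (≤-trans (+-monoˡ-≤ _ (*-monoˡ (N - s) (0≤q-p s≤N)
              (≤-trans (*-monoʳ _ (+-≥0 (+-≥0 (0≤g i) 0≤2s) 0≤2s) (diag i))
                (≤-trans (≤-reflexive (spread′ (w i) N (g i i) (two * s)))
                  (≤-trans (*-monoˡ N 0≤N (+-monoˡ-≤ _ (diag i))) (≤-reflexive (spread″ (w i) N (two * s))))))))
            (≤-reflexive (sym (spread (w i) (N - s) N (two * s)))))
        off-diagonal : ∀ i k → i ≢ k → w i * w k * f (g i k) ≤ w i * w k * 0#
        off-diagonal i k i≢k = ≤-trans (≤-reflexive (move (w i * w k) (g i k) s B))
            (≤-trans (a*b≤0 (≤-trans (+-monoˡ-≤ (- (w i * w k * s)) (off i k i≢k)) (≤-reflexive (cancel (w i * w k * s)))) (sq-≥0 (g i k + two * s)))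
              (≤-reflexive (times-zero (w i * w k))))
          where
          B = (g i k + two * s) * (g i k + two * s)
          opaque
            unfolding K
            cancel : ∀ a → a + - a ≡ 0#
            cancel = solve-∀ ℚ-ring

-- Counting and enumerating Boolean predicates on finite sets.

module Count where

  open RatSum using (K; Σ[_]; ι; 0#; 1#)
  open import Data.Nat
  open import Data.Nat.Properties
  open import Data.Fin using (Fin; zero; suc)
  import Data.Fin.Properties as FinP
  open import Data.Bool using (Bool; true; false; not; _∧_)
  open import Data.Product using (∃; _×_; _,_)
  open import Function using (_∘_)
  open import Relation.Nullary.Negation using (contradiction)
  open import Relation.Binary.PropositionalEquality

  Pred : ℕ → Set
  Pred n = Fin n → Bool

  bit : Bool → ℕ
  bit true  = 1
  bit false = 0

  count : ∀ {n} → Pred n → ℕ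
  count {zero}  p = 0
  count {suc n} p = bit (p zero) + count (p ∘ suc)

  infix 4 _⊑_
  _⊑_ : ∀ {n} → Pred n → Pred n → Set
  p ⊑ q = ∀ x → p x ≡ true → q x ≡ true

  bit-mono : ∀ {a b} → (a ≡ true → b ≡ true) → bit a ≤ bit b
  bit-mono {false} h = z≤n
  bit-mono {true} {true} h = ≤-refl
  bit-mono {true} {false} h with () ← h refl

  count-mono : ∀ {n} {p q : Pred n} → p ⊑ q → count p ≤ count q
  count-mono {zero}  h = z≤n
  count-mono {suc n} h = +-mono-≤ (bit-mono (h zero)) (count-mono (h ∘ suc))

  count-cong : ∀ {n} {p q : Pred n} → (∀ x → p x ≡ q x) → count p ≡ count q
  count-cong {zero}  h = refl
  count-cong {suc n} h = cong₂ _+_ (cong bit (h zero)) (count-cong (h ∘ suc))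

  count-strict : ∀ {n} {p q : Pred n} → p ⊑ q → ∀ x → p x ≡ false → q x ≡ true → count p < count q
  count-strict {suc n} {p} {q} h zero px qx = subst₂ _<_ (cong (λ b → bit b + count (p ∘ suc)) (sym px))
    (cong (λ b → bit b + count (q ∘ suc)) (sym qx)) (s≤s (count-mono (h ∘ suc)))
  count-strict {suc n} h (suc x) px qx = +-mono-≤-< (bit-mono (h zero)) (count-strict (h ∘ suc) x px qx)

  count-witness : ∀ {n} {p : Pred n} x → p x ≡ true → 1 ≤ count p
  count-witness {suc n} {p} zero px = subst (λ b → 1 ≤ bit b + count (p ∘ suc)) (sym px) (s≤s z≤n)
  count-witness {suc n} {p} (suc x) px = ≤-trans (count-witness x px) (m≤n+m _ (bit (p zero)))

  find : ∀ {n} {p : Pred n} → 1 ≤ count p → ∃ λ x → p x ≡ true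
  find {suc n} {p} h with p zero in eq
  ... | true  = zero , eq
  ... | false = let (x , px) = find {n} h in suc x , px

  find₂ : ∀ {n} {p : Pred n} → 2 ≤ count p → ∃ λ x → ∃ λ y → x ≢ y × p x ≡ true × p y ≡ true
  find₂ {suc n} {p} h with p zero in eq
  ... | true  = let (x , px) = find {n} (s≤s⁻¹ h) in zero , suc x , (λ ()) , eq , px
  ... | false = let (x , y , x≢y , px , py) = find₂ {n} h in suc x , suc y , (λ e → x≢y (FinP.suc-injective e)) , px , py

  count-true : ∀ n → count {n} (λ _ → true) ≡ n
  count-true zero    = refl
  count-true (suc n) = cong suc (count-true n)

  count-≤ : ∀ {n} (p : Pred n) → count p ≤ n
  count-≤ {n} p = subst (count p ≤_) (count-true n) (count-mono {n} {p} (λ _ _ → refl))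

  count-split : ∀ {n} (p q : Pred n) → count p ≡ count (λ x → p x ∧ q x) + count (λ x → p x ∧ not (q x))
  count-split {zero}  p q = refl
  count-split {suc n} p q with p zero | q zero
  ... | false | _     = count-split (p ∘ suc) (q ∘ suc)
  ... | true  | true  = cong suc (count-split (p ∘ suc) (q ∘ suc))
  ... | true  | false = trans (cong suc (count-split (p ∘ suc) (q ∘ suc))) (sym (+-suc _ _))

  count-not : ∀ {n} (p : Pred n) → count p + count (not ∘ p) ≡ n
  count-not {n} p = trans (sym (count-split (λ _ → true) p)) (count-true n)

  enum : ∀ {n} (p : Pred n) → Fin (count p) → Fin n
  enum {suc n} p i with p zero
  enum {suc n} p zero    | true  = zero
  enum {suc n} p (suc i) | true  = suc (enum (p ∘ suc) i)
  enum {suc n} p i       | false = suc (enum (p ∘ suc) i)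

  enum-∈ : ∀ {n} (p : Pred n) i → p (enum p i) ≡ true
  enum-∈ {suc n} p i with p zero in eq
  enum-∈ {suc n} p zero    | true  = eq
  enum-∈ {suc n} p (suc i) | true  = enum-∈ (p ∘ suc) i
  enum-∈ {suc n} p i       | false = enum-∈ (p ∘ suc) i

  enum-injective : ∀ {n} (p : Pred n) i j → enum p i ≡ enum p j → i ≡ j
  enum-injective {suc n} p i j e with p zero
  enum-injective {suc n} p zero    zero    e | true = refl
  enum-injective {suc n} p (suc i) (suc j) e | true = cong suc (enum-injective (p ∘ suc) i j (FinP.suc-injective e))
  enum-injective {suc n} p i       j       e | false = enum-injective (p ∘ suc) i j (FinP.suc-injective e)

  enum-surjective : ∀ {n} (p : Pred n) x → p x ≡ true → ∃ λ i → enum p i ≡ x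
  enum-surjective {suc n} p x px with p zero in eq
  enum-surjective {suc n} p zero    px | true  = zero , refl
  enum-surjective {suc n} p (suc x) px | true  = let (i , e) = enum-surjective (p ∘ suc) x px in suc i , cong suc e
  enum-surjective {suc n} p zero    px | false = contradiction (trans (sym eq) px) (λ ())
  enum-surjective {suc n} p (suc x) px | false = let (i , e) = enum-surjective (p ∘ suc) x px in i , cong suc e

  ind : Bool → K
  ind true  = 1#
  ind false = 0#

  Σ-ind : ∀ {n} (p : Pred n) → Σ[ n ] (ind ∘ p) ≡ ι (count p)
  Σ-ind {zero}  p = refl
  Σ-ind {suc n} p with p zero
  ... | true  = cong (1# RatSum.+_) (Σ-ind (p ∘ suc))
  ... | false = trans (RatSum.+-identityˡ _) (Σ-ind (p ∘ suc))

  ind-≥0 : ∀ b → 0# RatSum.≤ ind b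
  ind-≥0 true  = RatSum.0≤1
  ind-≥0 false = RatSum.≤-refl

  ind-idem : ∀ b → ind b RatSum.* ind b ≡ ind b
  ind-idem true  = RatSum.*-identityˡ 1#
  ind-idem false = RatSum.*-zeroˡ 0#

-- Rank of graphs and of induced subgraphs; mechanisms that lower it.

module GraphRank where

  import Defs
  import Data.Rational as ℚ
  open ℚ using (ℚ)
  open RatSum
  open LinAlg
  open Count using (Pred; ind)
  open Spherical using (Kronecker; Σ-Kronecker)
  open import Data.Nat as ℕ using (ℕ; zero; suc)
  import Data.Nat.Properties as ℕP
  open import Data.Fin using (Fin; zero; suc; _↑ˡ_; _↑ʳ_)
  open import Data.Bool using (true; false)
  open import Data.Product using (Σ; ∃; _,_; proj₁; proj₂)
  open import Data.Empty using (⊥-elim)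
  open import Function using (_∘_)
  open import Relation.Nullary using (yes; no)
  open import Relation.Binary.PropositionalEquality

  rowK : ∀ {n} → Graph n → Fin n → Vect n
  rowK G u j = ind (adj G u j)

  opaque
    unfolding K

    fromDefs : ∀ {n k} (G : Graph n) (f : Fin k → Fin n) → Defs.LinIndep (λ i → Defs.row G (f i)) → LinIndep (λ i → rowK G (f i))
    fromDefs {k = k} G f li c h = li c (λ j → trans (combination k f c j) (h j))
      where
      entry≡ind : ∀ b → Defs.entry b ≡ ind b
      entry≡ind true  = refl
      entry≡ind false = refl
      combination : ∀ k (f : Fin k → Fin _) (c : Fin k → ℚ) j →
        Defs.Σ[ k ] (λ i → c i ℚ.* Defs.row G (f i) j) ≡ Σ[ k ] (λ i → c i * rowK G (f i) j)
      combination zero    f c j = refl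
      combination (suc k) f c j = cong₂ ℚ._+_ (cong (c zero ℚ.*_) (entry≡ind (adj G (f zero) j))) (combination k (f ∘ suc) (c ∘ suc) j)

    toDefs : ∀ {n k} (G : Graph n) (f : Fin k → Fin n) → LinIndep (λ i → rowK G (f i)) → Defs.LinIndep (λ i → Defs.row G (f i))
    toDefs {k = k} G f li c h = li c (λ j → trans (sym (combination k f c j)) (h j))
      where
      entry≡ind : ∀ b → Defs.entry b ≡ ind b
      entry≡ind true  = refl
      entry≡ind false = refl
      combination : ∀ k (f : Fin k → Fin _) (c : Fin k → ℚ) j →
        Defs.Σ[ k ] (λ i → c i ℚ.* Defs.row G (f i) j) ≡ Σ[ k ] (λ i → c i * rowK G (f i) j)
      combination zero    f c j = refl
      combination (suc k) f c j = cong₂ ℚ._+_ (cong (c zero ℚ.*_) (entry≡ind (adj G (f zero) j))) (combination k (f ∘ suc) (c ∘ suc) j)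

  LinIndep-drop : ∀ {n} j {k} (v : Fin (j ℕ.+ k) → Vect n) → LinIndep v → LinIndep (λ i → v (j ↑ʳ i))
  LinIndep-drop zero    v li = li
  LinIndep-drop (suc j) v li = LinIndep-drop j (v ∘ suc) (LinIndep-tail {v = v} li)

  rowBasis : ∀ {n} (G : Graph n) → Basis (rowK G)
  rowBasis G = basis (rowK G)

  indep-≤-dim : ∀ {n} (G : Graph n) {k} (f : Fin k → Fin n) → LinIndep (rowK G ∘ f) → k ℕ.≤ dim (rowBasis G)
  indep-≤-dim G f = steinitz (proj (rowBasis G)) (rowK G ∘ f) (λ i → fixes (rowBasis G) (f i))

  hasRank-dim : ∀ {n} (G : Graph n) → HasRank G (dim (rowBasis G))
  hasRank-dim G = (choice B , toDefs G (choice B) (indep B)) ,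
      λ g li → ℕP.<-irrefl refl (indep-≤-dim G g (fromDefs G g li))
    where B = rowBasis G

  dim-unique : ∀ {n} (G : Graph n) {r} → HasRank G r → dim (rowBasis G) ≡ r
  dim-unique {n} G {r} ((f , li) , none) = ℕP.≤-antisym upper (indep-≤-dim G f (fromDefs G f li))
    where
    B = rowBasis G
    upper : dim B ℕ.≤ r
    upper with dim B ℕP.≤? r
    ... | yes h = h
    ... | no h  = ⊥-elim (none (choice B ∘ cast) (toDefs G (choice B ∘ cast) (castIndep excess (choice B) (indep B))))
      where
      excess : ∃ λ j → dim B ≡ j ℕ.+ suc r
      excess = dim B ℕ.∸ suc r , sym (ℕP.m∸n+n≡m (ℕP.≰⇒> h))
      cast : Fin (suc r) → Fin (dim B)
      cast i = subst Fin (sym (proj₂ excess)) (proj₁ excess ↑ʳ i)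
      castIndep : ∀ {d} (e : ∃ λ j → d ≡ j ℕ.+ suc r) (φ : Fin d → Fin n) → LinIndep (rowK G ∘ φ) →
        LinIndep (rowK G ∘ φ ∘ λ i → subst Fin (sym (proj₂ e)) (proj₁ e ↑ʳ i))
      castIndep (j , refl) φ = LinIndep-drop j (rowK G ∘ φ)

  hasRank⇒Proj : ∀ {n} (G : Graph n) {r} → HasRank G r → Σ (Proj n r) λ P → ∀ u → Fix P (rowK G u)
  hasRank⇒Proj G h = subst (λ d → Σ (Proj _ d) λ P → ∀ u → Fix P (rowK G u)) (dim-unique G h)
    (proj (rowBasis G) , fixes (rowBasis G))

  LIOn : ∀ {n k} → Pred n → (Fin k → Vect n) → Set
  LIOn {n} {k} C v = (c : Fin k → K) → (∀ j → C j ≡ true → Σ[ k ] (λ i → c i * v i j) ≡ 0#) → ∀ i → c i ≡ 0#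

  -- The subgraph induced on `C` has rank at most `ρ`. Rows and columns are both restricted to `C`,
  -- but the vertices keep their names in `G`.
  RankOn≤ : ∀ {n} → Graph n → Pred n → ℕ → Set
  RankOn≤ {n} G C ρ = ∀ k (f : Fin k → Fin n) → (∀ i → C (f i) ≡ true) → LIOn C (rowK G ∘ f) → k ℕ.≤ ρ

  δ : ∀ {n} → Fin n → Vect n
  δ u = Kronecker u

  δ∙ : ∀ {n} (u : Fin n) x → δ u ∙ x ≡ x u
  δ∙ u x = Σ-Kronecker u x

  cat : ∀ {k q} {A : Set} → (Fin k → A) → (Fin q → A) → Fin (k ℕ.+ q) → A
  cat {zero}  v z = z
  cat {suc k} v z = v zero ◂ cat (v ∘ suc) z

  Σ-cat : ∀ {k q n} (v : Fin k → Vect n) (z : Fin q → Vect n) (c : Fin (k ℕ.+ q) → K) j →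
    Σ[ k ℕ.+ q ] (λ i → c i * cat v z i j) ≡ Σ[ k ] (λ i → c (i ↑ˡ q) * v i j) + Σ[ q ] (λ i → c (k ↑ʳ i) * z i j)
  Σ-cat {zero}  v z c j = sym (+-identityˡ _)
  Σ-cat {suc k} v z c j = trans (cong (c zero * v zero j +_) (Σ-cat (v ∘ suc) z (c ∘ suc) j)) (sym (+-assoc _ _ _))

  cat-zero : ∀ k {q} (c : Fin (k ℕ.+ q) → K) → (∀ i → c (i ↑ˡ q) ≡ 0#) → (∀ i → c (k ↑ʳ i) ≡ 0#) → ∀ i → c i ≡ 0#
  cat-zero zero    c l r i       = r i
  cat-zero (suc k) c l r zero    = l zero
  cat-zero (suc k) c l r (suc i) = cat-zero k (c ∘ suc) (l ∘ suc) r i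

  cat-all : ∀ {k q} {A : Set} {Q : A → Set} (v : Fin k → A) (z : Fin q → A) → (∀ i → Q (v i)) → (∀ i → Q (z i)) → ∀ i → Q (cat v z i)
  cat-all {zero}  v z l r i       = r i
  cat-all {suc k} v z l r zero    = l zero
  cat-all {suc k} {Q = Q} v z l r (suc i) = cat-all {Q = Q} (v ∘ suc) z (l ∘ suc) r i

  -- On `C` the vectors `z` disappear, so independence there kills the coefficients of `v`; those of
  -- `z` follow.
  cat-indep : ∀ {k q n} {C : Pred n} (v : Fin k → Vect n) (z : Fin q → Vect n) →
    LIOn C v → LinIndep z → (∀ i j → C j ≡ true → z i j ≡ 0#) → LinIndep (cat v z)
  cat-indep {k} {q} v z lv lz vanish c h = cat-zero k c left (lz (λ i → c (k ↑ʳ i)) (λ j →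
      trans (sym (0+ (Σ-≡0 (λ i → trans (cong (_* v i j) (left i)) (*-zeroˡ (v i j)))))) (trans (sym (Σ-cat v z c j)) (h j))))
    where
    left : ∀ i → c (i ↑ˡ q) ≡ 0#
    left = lv (λ i → c (i ↑ˡ q)) (λ j Cj → trans (sym (+0 (Σ-≡0 (λ i → trans (cong (c (k ↑ʳ i) *_) (vanish i j Cj)) (*-zeroʳ (c (k ↑ʳ i)))))))
      (trans (sym (Σ-cat v z c j)) (h j)))

  module RankDrop {n r} (G : Graph n) (P : Proj n r) (fR : ∀ u → Fix P (rowK G u)) where

    image : Vect n → Vect n
    image φ y = φ ∙ rowK G y

    image-fixed : ∀ φ → Fix P (image φ)
    image-fixed φ = Fix-span P fR (φ , λ b → Σ-cong (λ k → cong (λ e → φ k * ind e) (Graph.sym G b k)))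

    -- Rows independent on `C` stay independent when `z` is added, and all these vectors lie in the
    -- row space of dimension `r`.
    rank-drop : ∀ {q} (C : Pred n) (z : Fin q → Vect n) → (∀ i → Fix P (z i)) → LinIndep z →
      (∀ i j → C j ≡ true → z i j ≡ 0#) → ∀ {ρ} → r ℕ.≤ ρ ℕ.+ q → RankOn≤ G C ρ
    rank-drop {q} C z fz lz vanish {ρ} r≤ k f Cf lf = ℕP.+-cancelʳ-≤ q k ρ (ℕP.≤-trans
      (steinitz P (cat (rowK G ∘ f) z) (cat-all {Q = Fix P} (rowK G ∘ f) z (fR ∘ f) fz) (cat-indep (rowK G ∘ f) z lf lz vanish)) r≤)

    -- `φ` annihilates `z` and the rows of vertices in `C`, but not the row of `y`. That row is
    -- therefore one more independent vector of the row space.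
    rank-drop⁺ : ∀ {q} (C : Pred n) (z : Fin q → Vect n) → (∀ i → Fix P (z i)) → LinIndep z →
      (∀ i j → C j ≡ true → z i j ≡ 0#) →
      ∀ φ y → image φ y ≢ 0# → (∀ j → C j ≡ true → image φ j ≡ 0#) → (∀ i → φ ∙ z i ≡ 0#) →
      ∀ {ρ} → r ℕ.≤ suc (ρ ℕ.+ q) → RankOn≤ G C ρ
    rank-drop⁺ {q} C z fz lz vanish φ y φy φC φz {ρ} r≤ k f Cf lf = ℕP.+-cancelʳ-≤ q k ρ (ℕ.s≤s⁻¹ (ℕP.≤-trans
      (steinitz P (rowK G y ◂ cat (rowK G ∘ f) z)
        (λ where
          zero    → fR y
          (suc i) → cat-all {Q = Fix P} (rowK G ∘ f) z (fR ∘ f) fz i)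
        (LinIndep-cons φ (cat-indep (rowK G ∘ f) z lf lz vanish)
          (cat-all {Q = λ x → φ ∙ x ≡ 0#} (rowK G ∘ f) z (λ i → φC (f i) (Cf i)) φz) φy)) r≤))

    singleton-indep : ∀ (z : Vect n) y → z y ≢ 0# → LinIndep {1} (λ _ → z)
    singleton-indep z y zy c h zero = a*b≡0 zy (trans (sym (+-identityʳ _)) (h y))

    -- With A the adjacency matrix, Aφ vanishes on `C` and costs one dimension. Isotropy says that
    -- `φ` also annihilates Aφ, so `φ` separates the row of `y` and costs a second one.
    isotropic-drop : ∀ (C : Pred n) φ y → image φ y ≢ 0# → (∀ j → C j ≡ true → image φ j ≡ 0#) → φ ∙ image φ ≡ 0# →
      ∀ {ρ} → r ℕ.≤ suc (suc ρ) → RankOn≤ G C ρ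
    isotropic-drop C φ y φy φC φφ {ρ} r≤ = rank-drop⁺ {1} C (λ _ → image φ) (λ _ → image-fixed φ)
      (singleton-indep (image φ) y φy) (λ _ → φC) φ y φy φC (λ _ → φφ) (subst (λ k → r ℕ.≤ suc k) (ℕP.+-comm 1 ρ) r≤)

-- Arithmetic of `m`, and bounds for vertex sets inducing small rank.

module Bounds where

  open RatSum using (0#; 1#; 1≢0; +0)
  open LinAlg
  open Count
  open GraphRank
  open import Data.Nat hiding (parity)
  open import Data.Nat.Properties
  open import Data.Nat.DivMod
  open import Data.Nat.Tactic.RingSolver using (solve-∀)
  open import Data.Fin using (Fin; zero; suc)
  import Data.Fin.Properties as FinP
  open import Data.Bool using (Bool; true; false; not; _∧_; if_then_else_)
  import Data.Bool.Properties as BoolP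
  open import Data.Product using (∃; _×_; _,_; proj₁; proj₂)
  open import Data.Sum using (_⊎_; inj₁; inj₂)
  open import Data.Empty using (⊥)
  open import Function using (_∘_)
  open import Relation.Nullary using (yes; no)
  open import Relation.Nullary.Decidable using (_→-dec_; _×-dec_)
  open import Relation.Nullary.Negation using (contradiction)
  open import Relation.Binary.PropositionalEquality

  m-even : ∀ h → m (2 * h) ≡ 2 * 2 ^ h ∸ 2
  m-even h = begin
    (if (2 * h) % 2 ≡ᵇ 0 then 2 ^ ((2 * h + 2) / 2) ∸ 2 else 5 * 2 ^ ((2 * h ∸ 3) / 2) ∸ 2)
      ≡⟨ cong (λ q → if q ≡ᵇ 0 then 2 ^ ((2 * h + 2) / 2) ∸ 2 else 5 * 2 ^ ((2 * h ∸ 3) / 2) ∸ 2)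
           (trans (cong (_% 2) (*-comm 2 h)) (m*n%n≡0 h 2)) ⟩
    2 ^ ((2 * h + 2) / 2) ∸ 2
      ≡⟨ cong (λ q → 2 ^ q ∸ 2) (trans (cong (_/ 2) (identity h)) (m*n/n≡m (suc h) 2)) ⟩
    2 ^ suc h ∸ 2 ∎
    where
    open ≡-Reasoning
    identity : ∀ h → 2 * h + 2 ≡ (1 + h) * 2
    identity = solve-∀

  m-odd : ∀ h → m (3 + 2 * h) ≡ 5 * 2 ^ h ∸ 2
  m-odd h = begin
    (if (3 + 2 * h) % 2 ≡ᵇ 0 then 2 ^ ((3 + 2 * h + 2) / 2) ∸ 2 else 5 * 2 ^ (2 * h / 2) ∸ 2)
      ≡⟨ cong (λ q → if q ≡ᵇ 0 then 2 ^ ((3 + 2 * h + 2) / 2) ∸ 2 else 5 * 2 ^ (2 * h / 2) ∸ 2)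
           (trans (cong (_% 2) (identity h)) ([m+kn]%n≡m%n 1 (suc h) 2)) ⟩
    5 * 2 ^ (2 * h / 2) ∸ 2
      ≡⟨ cong (λ q → 5 * 2 ^ q ∸ 2) (trans (cong (_/ 2) (*-comm 2 h)) (m*n/n≡m h 2)) ⟩
    5 * 2 ^ h ∸ 2 ∎
    where
    open ≡-Reasoning
    identity : ∀ h → 3 + 2 * h ≡ 1 + (1 + h) * 2
    identity = solve-∀

  data Parity : ℕ → Set where
    even : ∀ h → Parity (2 * h)
    odd  : ∀ h → Parity (1 + 2 * h)

  parity : ∀ r → Parity r
  parity zero    = even 0
  parity (suc r) with parity r
  ... | even h = odd h
  ... | odd h  = subst Parity (identity h) (even (suc h))
    where
    identity : ∀ h → 2 * (1 + h) ≡ 1 + (1 + 2 * h)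
    identity = solve-∀

  1≤2^ : ∀ h → 1 ≤ 2 ^ h
  1≤2^ h = m^n>0 2 h

  m-step : ∀ r → 2 ≤ r → m r ≤ m (suc r)
  m-step r 2≤r with parity r
  m-step _ 2≤r | even zero = contradiction 2≤r λ ()
  m-step _ 2≤r | even (suc h) = begin
    m (2 * suc h)          ≡⟨ m-even (suc h) ⟩
    2 * (2 * 2 ^ h) ∸ 2    ≤⟨ ∸-monoˡ-≤ 2 (≤-trans (≤-reflexive (sym (*-assoc 2 2 (2 ^ h)))) (*-monoˡ-≤ (2 ^ h) {4} {5} (n≤1+n 4))) ⟩
    5 * 2 ^ h ∸ 2          ≡⟨ m-odd h ⟨
    m (3 + 2 * h)          ≡⟨ cong m (identity h) ⟨
    m (1 + 2 * suc h)      ∎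
    where
    open ≤-Reasoning
    identity : ∀ h → 1 + 2 * (1 + h) ≡ 3 + 2 * h
    identity = solve-∀
  m-step _ 2≤r | odd zero = contradiction 2≤r λ { (s≤s ()) }
  m-step _ 2≤r | odd (suc h) = begin
    m (1 + 2 * suc h)          ≡⟨ cong m (identity h) ⟩
    m (3 + 2 * h)              ≡⟨ m-odd h ⟩
    5 * 2 ^ h ∸ 2              ≤⟨ ∸-monoˡ-≤ 2 (≤-trans (*-monoˡ-≤ (2 ^ h) {5} {8} (m≤m+n 5 3)) (≤-reflexive (identity₂ (2 ^ h)))) ⟩
    2 * (2 * (2 * 2 ^ h)) ∸ 2  ≡⟨ m-even (2 + h) ⟨
    m (2 * (2 + h))            ≡⟨ cong m (identity₃ h) ⟩
    m (suc (1 + 2 * suc h))    ∎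
    where
    open ≤-Reasoning
    identity : ∀ h → 1 + 2 * (1 + h) ≡ 3 + 2 * h
    identity = solve-∀
    identity₂ : ∀ x → 8 * x ≡ 2 * (2 * (2 * x))
    identity₂ = solve-∀
    identity₃ : ∀ h → 2 * (2 + h) ≡ 1 + (1 + 2 * (1 + h))
    identity₃ = solve-∀

  m-mono : ∀ {a b} → 2 ≤ a → a ≤ b → m a ≤ m b
  m-mono {a} 2≤a a≤b = go (≤⇒≤′ a≤b)
    where
    go : ∀ {b} → a ≤′ b → m a ≤ m b
    go (≤′-reflexive refl) = ≤-refl
    go (≤′-step h) = ≤-trans (go h) (m-step _ (≤-trans 2≤a (≤′⇒≤ h)))

  m-double : ∀ r → 2 ≤ r → m (2 + r) ≡ 2 * m r + 2
  m-double r 2≤r with parity r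
  m-double _ 2≤r | even h = begin
    m (2 + 2 * h)                 ≡⟨ cong m (identity h) ⟩
    m (2 * suc h)                 ≡⟨ m-even (suc h) ⟩
    2 * (2 * 2 ^ h) ∸ 2           ≡⟨ lemma (2 ^ h) (1≤2^ h) ⟩
    2 * (2 * 2 ^ h ∸ 2) + 2       ≡⟨ cong (λ q → 2 * q + 2) (m-even h) ⟨
    2 * m (2 * h) + 2             ∎
    where
    open ≡-Reasoning
    identity : ∀ h → 2 + 2 * h ≡ 2 * (1 + h)
    identity = solve-∀
    identity₂ : ∀ x → 2 * (2 * (1 + x)) ≡ 2 + (2 * (2 * x) + 2)
    identity₂ = solve-∀
    identity₃ : ∀ x → 2 * (1 + x) ≡ 2 + 2 * x
    identity₃ = solve-∀
    lemma : ∀ x → 1 ≤ x → 2 * (2 * x) ∸ 2 ≡ 2 * (2 * x ∸ 2) + 2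
    lemma (suc x) _ = trans (cong (_∸ 2) (identity₂ x)) (cong (λ q → 2 * (q ∸ 2) + 2) (sym (identity₃ x)))
  m-double _ 2≤r | odd zero = contradiction 2≤r λ { (s≤s ()) }
  m-double _ 2≤r | odd (suc h) = begin
    m (2 + (1 + 2 * suc h))       ≡⟨ cong m (identity h) ⟩
    m (3 + 2 * suc h)             ≡⟨ m-odd (suc h) ⟩
    5 * (2 * 2 ^ h) ∸ 2           ≡⟨ lemma (2 ^ h) (1≤2^ h) ⟩
    2 * (5 * 2 ^ h ∸ 2) + 2       ≡⟨ cong (λ q → 2 * q + 2) (trans (cong m (identity₄ h)) (m-odd h)) ⟨
    2 * m (1 + 2 * suc h) + 2     ∎
    where
    open ≡-Reasoning
    identity : ∀ h → 2 + (1 + 2 * (1 + h)) ≡ 3 + 2 * (1 + h)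
    identity = solve-∀
    identity₄ : ∀ h → 1 + 2 * (1 + h) ≡ 3 + 2 * h
    identity₄ = solve-∀
    identity₂ : ∀ x → 5 * (2 * (1 + x)) ≡ 2 + (2 * (3 + 5 * x) + 2)
    identity₂ = solve-∀
    identity₃ : ∀ x → 5 * (1 + x) ≡ 2 + (3 + 5 * x)
    identity₃ = solve-∀
    lemma : ∀ x → 1 ≤ x → 5 * (2 * x) ∸ 2 ≡ 2 * (5 * x ∸ 2) + 2
    lemma (suc x) _ = trans (cong (_∸ 2) (identity₂ x)) (cong (λ q → 2 * (q ∸ 2) + 2) (sym (identity₃ x)))

  induced : ∀ {n k} → Graph n → (Fin k → Fin n) → Graph k
  induced G e = record
    { adj = λ i j → adj G (e i) (e j)
    ; sym = λ i j → Graph.sym G (e i) (e j)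
    ; irrefl = λ i → Graph.irrefl G (e i) }

  DistinctOn NonzeroOn : ∀ {n} → Graph n → Pred n → Set
  DistinctOn G C = ∀ x y → C x ≡ true → C y ≡ true → x ≢ y → ∃ λ c → C c ≡ true × adj G x c ≢ adj G y c
  NonzeroOn G C = ∀ x → C x ≡ true → ∃ λ c → C c ≡ true × adj G x c ≡ true

  -- All ranks up to `ρ` are included, because for an induced subgraph only an upper bound on the
  -- rank is known.
  Bounded : ℕ → Set
  Bounded ρ = ∀ {n} (G : Graph n) ρ′ → ρ′ ≤ ρ → Reduced G → HasRank G ρ′ → n ≤ m ρ

  edge-indep : ∀ {n} (G : Graph n) {u v} → adj G u v ≡ true → LinIndep (rowK G ∘ (u ◂ (λ (_ : Fin 1) → v)))
  edge-indep G {u} {v} uv c h = LinIndep-cons {v = λ (_ : Fin 1) → rowK G v} {x = rowK G u} (δ v) single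
      (λ _ → trans (δ∙ v (rowK G v)) (cong ind (Graph.irrefl G v)))
      (λ e → 1≢0 (trans (cong ind (sym uv)) (trans (sym (δ∙ v (rowK G u))) e))) c h
    where
    single : LinIndep (λ (_ : Fin 1) → rowK G v)
    single c h zero = RatSum.a*b≡0 {b = 1#} 1≢0 (trans (cong (c zero RatSum.*_) (cong ind (trans (sym uv) (Graph.sym G u v))))
      (trans (sym (+0 {b = 0#} refl)) (h u)))

  -- A nonempty reduced graph has an edge, whose endpoints have independent rows. So its rank is at
  -- least 2, where the induction hypothesis applies and `m` is monotone.
  bounded : ∀ ρ → 2 ≤ ρ → (∀ ρ′ → 2 ≤ ρ′ → ρ′ ≤ ρ → ∀ n (G : Graph n) → Reduced G → HasRank G ρ′ → n ≤ m ρ′) → Bounded ρ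
  bounded ρ 2≤ρ IH {zero}  G ρ′ ρ′≤ρ red hr = z≤n
  bounded ρ 2≤ρ IH {suc n} G ρ′ ρ′≤ρ red hr =
      ≤-trans (IH ρ′ 2≤ρ′ ρ′≤ρ (suc n) G red hr) (m-mono 2≤ρ′ ρ′≤ρ)
    where
    2≤ρ′ : 2 ≤ ρ′
    2≤ρ′ = subst (2 ≤_) (dim-unique G hr) (indep-≤-dim G (zero ◂ (λ (_ : Fin 1) → proj₁ (proj₁ red zero))) (edge-indep G (proj₂ (proj₁ red zero))))

  bound-nonzero : ∀ {n ρ} (G : Graph n) (C : Pred n) → Bounded ρ → RankOn≤ G C ρ → DistinctOn G C → NonzeroOn G C → count C ≤ m ρ
  bound-nonzero {n} {ρ} G C bd rk dis nz = bd H (dim (rowBasis H)) rank≤ reduced (hasRank-dim H)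
    where
    e = enum C
    H = induced G e
    rank≤ : dim (rowBasis H) ≤ ρ
    rank≤ = rk _ (e ∘ choice (rowBasis H)) (λ i → enum-∈ C _)
      (λ c h → indep (rowBasis H) c (λ j → h (e j) (enum-∈ C j)))
    reduced : Reduced H
    reduced = (λ i → let (c , Cc , ic) = nz (e i) (enum-∈ C i) ; (j , ej) = enum-surjective C c Cc in j , trans (cong (adj G (e i)) ej) ic)
      , λ i j i≢j → let (c , Cc , ne) = dis (e i) (e j) (enum-∈ C i) (enum-∈ C j) (i≢j ∘ enum-injective C i j)
                        (k , ek) = enum-surjective C c Cc
                    in k , λ eq → ne (trans (cong (adj G (e i)) (sym ek)) (trans eq (cong (adj G (e j)) ek)))

  not-true : ∀ {b} → b ≢ true → b ≡ false
  not-true {false} h = refl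
  not-true {true}  h = contradiction refl h

  not-false : ∀ {b} → b ≢ false → b ≡ true
  not-false {true}  h = refl
  not-false {false} h = contradiction refl h

  true≢false : ∀ {b} → b ≡ true → b ≡ false → ⊥
  true≢false refl ()

  search : ∀ {n} (p q : Pred n) → (∃ λ x → p x ≡ true × q x ≡ true) ⊎ (∀ x → p x ≡ true → q x ≡ false)
  search p q with FinP.any? (λ x → (p x BoolP.≟ true) ×-dec (q x BoolP.≟ true))
  ... | yes w = inj₁ w
  ... | no h  = inj₂ (λ x px → not-true (λ qx → h (x , px , qx)))

  RankOn-mono : ∀ {n ρ} (G : Graph n) (C C′ : Pred n) → C′ ⊑ C → RankOn≤ G C ρ → RankOn≤ G C′ ρ
  RankOn-mono G C C′ sub rk k f Cf li = rk k f (λ i → sub (f i) (Cf i)) (λ c h → li c (λ j C′j → h j (sub j C′j)))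

  _is_ : ∀ {n} → Fin n → Fin n → Bool
  x is y with x FinP.≟ y
  ... | yes _ = true
  ... | no _  = false

  is-refl : ∀ {n} (x : Fin n) → (x is x) ≡ true
  is-refl x with x FinP.≟ x
  ... | yes _ = refl
  ... | no h  = contradiction refl h

  is-true : ∀ {n} (x y : Fin n) → (x is y) ≡ true → x ≡ y
  is-true x y h with yes e ← x FinP.≟ y = e

  is-false : ∀ {n} (x y : Fin n) → x ≢ y → (x is y) ≡ false
  is-false x y h = not-true (h ∘ is-true x y)

  ∧-intro : ∀ {a b} → a ≡ true → b ≡ true → a ∧ b ≡ true
  ∧-intro refl refl = refl

  ∧-left : ∀ {a b} → a ∧ b ≡ true → a ≡ true
  ∧-left {true} h = refl

  ∧-right : ∀ {a b} → a ∧ b ≡ true → b ≡ true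
  ∧-right {true} h = h

  not-elim : ∀ {a} → not a ≡ true → a ≡ false
  not-elim {false} h = refl

  not-intro : ∀ {a} → a ≡ false → not a ≡ true
  not-intro refl = refl

  count-is : ∀ {n} (p : Pred n) z → p z ≡ true → count p ≡ suc (count (λ x → p x ∧ not (x is z)))
  count-is p z pz = trans (count-split p (_is z)) (cong (_+ count (λ x → p x ∧ not (x is z))) one)
    where
    single : ∀ {n} (z : Fin n) → count (_is z) ≡ 1
    single {suc n} zero = cong suc (empty n)
      where
      empty : ∀ n → count {n} (λ x → suc x is zero) ≡ 0
      empty zero = refl
      empty (suc n) = empty n
    single {suc n} (suc z) = trans (count-cong (λ x → shift x z)) (single z)
      where
      shift : ∀ {n} (x z : Fin n) → (suc x is suc z) ≡ (x is z)
      shift x z with x FinP.≟ z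
      ... | yes _ = refl
      ... | no _  = refl
    one : count (λ x → p x ∧ (x is z)) ≡ 1
    one = trans (≤-antisym (count-mono {p = λ x → p x ∧ (x is z)} {q = _is z} (λ x → ∧-right {p x}))
      (count-mono {p = _is z} {q = λ x → p x ∧ (x is z)} (λ x h → ∧-intro (trans (cong p (is-true x z h)) pz) h))) (single z)

  -- Distinct rows leave room for one zero row. By symmetry its column is zero on `C` too, so
  -- deleting that vertex keeps the other rows distinct, and they are nonzero.
  bound-distinct : ∀ {n ρ} (G : Graph n) (C : Pred n) → Bounded ρ → RankOn≤ G C ρ → DistinctOn G C → count C ≤ suc (m ρ)
  bound-distinct {n} {ρ} G C bd rk dis with FinP.any? (λ z → (C z BoolP.≟ true) ×-dec FinP.all? (λ c → (C c BoolP.≟ true) →-dec (adj G z c BoolP.≟ false)))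
  ... | no none = m≤n⇒m≤1+n (bound-nonzero G C bd rk dis nz)
    where
    nz : NonzeroOn G C
    nz x Cx with search C (adj G x)
    ... | inj₁ w = w
    ... | inj₂ h = contradiction (x , Cx , h) none
  ... | yes (z , Cz , zero-row) = subst (_≤ suc (m ρ)) (sym (count-is C z Cz)) (s≤s (bound-nonzero G C′ bd (RankOn-mono G C C′ (λ x → ∧-left) rk) dis′ nz′))
    where
    C′ : Pred n
    C′ x = C x ∧ not (x is z)
    column : ∀ x → C x ≡ true → adj G x z ≡ false
    column x Cx = trans (Graph.sym G x z) (zero-row x Cx)
    in-C′ : ∀ {c} → C c ≡ true → c ≢ z → C′ c ≡ true
    in-C′ {c} Cc c≢z = ∧-intro Cc (not-intro (is-false c z c≢z))
    dis′ : DistinctOn G C′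
    dis′ x y Cx Cy x≢y with dis x y (∧-left Cx) (∧-left Cy) x≢y
    ... | c , Cc , ne = c , in-C′ Cc (λ { refl → ne (trans (column x (∧-left Cx)) (sym (column y (∧-left Cy)))) }) , ne
    nz′ : NonzeroOn G C′
    nz′ x Cx with dis x z (∧-left Cx) Cz (λ { refl → true≢false (is-refl z) (not-elim (∧-right {C z} Cx)) })
    ... | c , Cc , ne = c , in-C′ Cc (λ { refl → ne (trans (column x (∧-left Cx)) (sym (Graph.irrefl G z))) }) ,
          not-false (λ xc → ne (trans xc (sym (zero-row c Cc))))

-- Maximal sets of rank at most r - 2, and the distances they force.

module Structure where

  open RatSum using (0#; 1#; 1≢0)
  open LinAlg
  open Count
  open GraphRank
  open Bounds
  open import Data.Nat hiding (parity)
  open import Data.Nat.Properties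
  open import Data.Nat.Tactic.RingSolver using (solve-∀)
  open import Data.Fin using (Fin; zero; suc)
  open import Data.Bool using (Bool; true; false; not; _∧_; _∨_; _xor_)
  import Data.Bool.Properties as BoolP
  open import Data.Product using (∃; _×_; _,_; proj₁; proj₂)
  open import Data.Sum using (_⊎_; inj₁; inj₂)
  open import Data.Empty using (⊥; ⊥-elim)
  open import Function using (_∘_)
  open import Relation.Nullary using (yes; no)
  open import Relation.Nullary.Negation using (contradiction)
  open import Relation.Binary.PropositionalEquality
  import Tactic.RingSolver as RingSolver

  opaque
    unfolding RatSum.K
    sub-self : ∀ a → a RatSum.- a ≡ 0#
    sub-self = RingSolver.solve-∀ RatSum.ℚ-ring
    sub-lin : ∀ a b x → (a RatSum.- b) RatSum.* x ≡ a RatSum.* x RatSum.+ (RatSum.- 1#) RatSum.* (b RatSum.* x)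
    sub-lin = RingSolver.solve-∀ RatSum.ℚ-ring
    sub-neg : ∀ a b → a RatSum.+ (RatSum.- 1#) RatSum.* b ≡ a RatSum.- b
    sub-neg = RingSolver.solve-∀ RatSum.ℚ-ring
    1-0 : 1# RatSum.- 0# ≡ 1#
    1-0 = refl
    0-1≢0 : 0# RatSum.- 1# ≢ 0#
    0-1≢0 ()
    1-0-[0-1]≢0 : (1# RatSum.- 0#) RatSum.- (0# RatSum.- 1#) ≢ 0#
    1-0-[0-1]≢0 ()
    0-1-[1-0]≢0 : (0# RatSum.- 1#) RatSum.- (1# RatSum.- 0#) ≢ 0#
    0-1-[1-0]≢0 ()
    1-[0-1]≢0 : 1# RatSum.- (0# RatSum.- 1#) ≢ 0#
    1-[0-1]≢0 ()
    2≢0 : (1# RatSum.- 0#) RatSum.+ (1# RatSum.- 0#) ≢ 0#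
    2≢0 ()
    -2≢0 : (0# RatSum.- 1#) RatSum.+ (0# RatSum.- 1#) ≢ 0#
    -2≢0 ()
    antisymmetric : ∀ a → (0# RatSum.- a) RatSum.+ (a RatSum.- 0#) ≡ 0#
    antisymmetric = RingSolver.solve-∀ RatSum.ℚ-ring

  _⊖_ : ∀ {n} → Vect n → Vect n → Vect n
  (φ ⊖ ψ) a = φ a RatSum.- ψ a

  ⊖∙ : ∀ {n} (φ ψ x : Vect n) → (φ ⊖ ψ) ∙ x ≡ (φ ∙ x) RatSum.- (ψ ∙ x)
  ⊖∙ {n} φ ψ x = trans (RatSum.Σ-cong (λ a → sub-lin (φ a) (ψ a) (x a)))
    (trans (RatSum.Σ-+ {n} _ _) (trans (cong ((φ ∙ x) RatSum.+_) (RatSum.Σ-*ˡ {n} (RatSum.- 1#) _)) (sub-neg _ _)))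

  ind-sub-≡ : ∀ {a b} → a ≡ b → ind a RatSum.- ind b ≡ 0#
  ind-sub-≡ {a} refl = sub-self (ind a)

  ind-sub-≢ : ∀ {a b} → a ≢ b → ind a RatSum.- ind b ≢ 0#
  ind-sub-≢ {true}  {true}  h e = h refl
  ind-sub-≢ {false} {false} h e = h refl
  ind-sub-≢ {true}  {false} h e = 1≢0 (trans (sym 1-0) e)
  ind-sub-≢ {false} {true}  h e = 0-1≢0 e

  xor-≡ : ∀ {a b} → a xor b ≡ false → a ≡ b
  xor-≡ {true}  {true}  h = refl
  xor-≡ {false} {false} h = refl

  xor-true : ∀ {a b} → a xor b ≡ true → a ≢ b
  xor-true {true} {false} h ()
  xor-true {false} {true} h ()

  side : Bool → Bool → Bool
  side true  b = b
  side false b = not b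

  side-elim : ∀ s {b} → side s b ≡ true → b ≡ s
  side-elim true  h = h
  side-elim false h = not-elim h

  side-intro : ∀ s {b} → b ≡ s → side s b ≡ true
  side-intro true  h = h
  side-intro false h = not-intro h

  ≢-not : ∀ {a b : Bool} → a ≢ b → a ≡ not b
  ≢-not {true}  {true}  h = contradiction refl h
  ≢-not {true}  {false} h = refl
  ≢-not {false} {true}  h = refl
  ≢-not {false} {false} h = contradiction refl h

  count-double : ∀ {n} {p q s t : Pred n} → (∀ x → bit (p x) + bit (q x) + bit (s x) ≡ 2 * bit (t x)) →
    count p + count q + count s ≡ 2 * count t
  count-double {zero} h = refl
  count-double {suc n} {p} {q} {s} {t} h = begin
    bit (p zero) + P + (bit (q zero) + Q) + (bit (s zero) + S)  ≡⟨ identity (bit (p zero)) P (bit (q zero)) Q (bit (s zero)) S ⟩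
    bit (p zero) + bit (q zero) + bit (s zero) + (P + Q + S)     ≡⟨ cong₂ _+_ (h zero) (count-double (h ∘ suc)) ⟩
    2 * bit (t zero) + 2 * count (t ∘ suc)                       ≡⟨ *-distribˡ-+ 2 (bit (t zero)) _ ⟨
    2 * (bit (t zero) + count (t ∘ suc))                         ∎
    where
    open ≡-Reasoning
    P = count (p ∘ suc)
    Q = count (q ∘ suc)
    S = count (s ∘ suc)
    identity : ∀ a b c d e f → a + b + (c + d) + (e + f) ≡ a + c + e + (b + d + f)
    identity = solve-∀

  record Maximal {n} (G : Graph n) (ρ : ℕ) : Set where
    field
      core    : Pred n
      rank    : RankOn≤ G core ρ
      maximal : ∀ C → RankOn≤ G C ρ → count C ≤ count core
  open Maximal

  -- The double negation avoids deciding `RankOn≤`: the continuation receives the current set, and a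
  -- larger set, if ever produced, restarts it with less fuel `j`. This is enough because the goal
  -- is a contradiction.
  exists-maximal : ∀ {n} (G : Graph n) ρ → (Maximal G ρ → ⊥) → ⊥
  exists-maximal {n} G ρ k = go n (λ _ → false) rank₀ (m≤n+m n _)
    where
    rank₀ : RankOn≤ G (λ _ → false) ρ
    rank₀ zero    f Cf li = z≤n
    rank₀ (suc j) f Cf li with () ← Cf zero
    go : ∀ j C → RankOn≤ G C ρ → n ≤ count C + j → ⊥
    go j C rk bound = k (record { core = C ; rank = rk ; maximal = larger j bound })
      where
      larger : ∀ j → n ≤ count C + j → ∀ C′ → RankOn≤ G C′ ρ → count C′ ≤ count C
      larger zero    bound C′ rk′ = ≤-trans (count-≤ C′) (subst (n ≤_) (+-identityʳ (count C)) bound)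
      larger (suc j) bound C′ rk′ with count C′ ≤? count C
      ... | yes h = h
      ... | no h  = ⊥-elim (go j C′ rk′ (≤-trans bound (subst (_≤ count C′ + j) (sym (+-suc (count C) j)) (+-monoˡ-≤ j (≰⇒> h)))))

  module Core {n r₂} (G : Graph n) (red : Reduced G) (P : Proj n (2 + r₂)) (fR : ∀ u → Fix P (rowK G u))
    (M : Maximal G r₂) where

    open RankDrop G P fR

    diff : Fin n → Fin n → Vect n
    diff u v = δ u ⊖ δ v

    diff∙ : ∀ u v x → diff u v ∙ x ≡ x u RatSum.- x v
    diff∙ u v x = trans (⊖∙ (δ u) (δ v) x) (cong₂ RatSum._-_ (δ∙ u x) (δ∙ v x))

    image-diff : ∀ u v y → image (diff u v) y ≡ ind (adj G u y) RatSum.- ind (adj G v y)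
    image-diff u v y = trans (diff∙ u v (rowK G y)) (cong₂ (λ a b → ind a RatSum.- ind b) (Graph.sym G y u) (Graph.sym G y v))

    image-diff-≡ : ∀ {u v y} → adj G u y ≡ adj G v y → image (diff u v) y ≡ 0#
    image-diff-≡ {u} {v} {y} h = trans (image-diff u v y) (ind-sub-≡ h)

    image-diff-≢ : ∀ {u v y} → adj G u y ≢ adj G v y → image (diff u v) y ≢ 0#
    image-diff-≢ {u} {v} {y} h e = ind-sub-≢ h (trans (sym (image-diff u v y)) e)

    K : Pred n
    K = core M

    t₂ : ℕ
    t₂ = count (not ∘ K)

    n≡ : count K + t₂ ≡ n
    n≡ = count-not K

    support-bound : ∀ (Sp : Pred n) → RankOn≤ G (not ∘ Sp) r₂ → t₂ ≤ count Sp
    support-bound Sp rk = +-cancelˡ-≤ (count K) t₂ (count Sp) (begin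
      count K + t₂               ≡⟨ trans n≡ (sym (count-not Sp)) ⟩
      count Sp + count (not ∘ Sp) ≤⟨ +-monoʳ-≤ (count Sp) (maximal M (not ∘ Sp) rk) ⟩
      count Sp + count K         ≡⟨ +-comm (count Sp) (count K) ⟩
      count K + count Sp         ∎)
      where open ≤-Reasoning

    isotropic-support : ∀ φ (Sp : Pred n) y → image φ y ≢ 0# → (∀ j → Sp j ≡ false → image φ j ≡ 0#) →
      φ ∙ image φ ≡ 0# → t₂ ≤ count Sp
    isotropic-support φ Sp y φy vanish φφ = support-bound Sp
      (isotropic-drop (not ∘ Sp) φ y φy (λ j h → vanish j (not-elim h)) φφ ≤-refl)

    differ : Fin n → Fin n → Pred n
    differ u v a = adj G u a xor adj G v a

    dist : Fin n → Fin n → ℕ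
    dist u v = count (differ u v)

    differ-at : ∀ u v → u ≢ v → ∃ λ a → adj G u a ≢ adj G v a
    differ-at = proj₂ red

    -- With zero diagonal, e_u - e_v has quadratic form -2 `adj u v`, so it is isotropic for
    -- nonadjacent vertices. `Sp` may be any set containing the places where the rows differ.
    nonadjacent-support : ∀ u v (Sp : Pred n) → u ≢ v → adj G u v ≡ false → (∀ j → Sp j ≡ false → adj G u j ≡ adj G v j) → t₂ ≤ count Sp
    nonadjacent-support u v Sp u≢v uv agree = let (y , ne) = differ-at u v u≢v in
      isotropic-support (diff u v) Sp y (image-diff-≢ ne) (λ j h → image-diff-≡ (agree j h))
        (trans (diff∙ u v (image (diff u v))) (trans (cong₂ RatSum._-_ (image-diff-≡ at-u) (image-diff-≡ at-v)) (sub-self 0#)))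
      where
      at-u : adj G u u ≡ adj G v u
      at-u = trans (Graph.irrefl G u) (sym (trans (Graph.sym G v u) uv))
      at-v : adj G u v ≡ adj G v v
      at-v = trans uv (sym (Graph.irrefl G v))

    nonadjacent-dist : ∀ u v → u ≢ v → adj G u v ≡ false → t₂ ≤ dist u v
    nonadjacent-dist u v u≢v uv = nonadjacent-support u v (differ u v) u≢v uv (λ j → xor-≡)

    -- Without loops a unit vector is isotropic, and its image is the row of `u`.
    degree-support : ∀ u (Sp : Pred n) → (∀ j → Sp j ≡ false → adj G u j ≡ false) → t₂ ≤ count Sp
    degree-support u Sp vanish = isotropic-support (δ u) Sp (proj₁ (proj₁ red u))
        (λ e → 1≢0 (trans (cong ind (sym (proj₂ (proj₁ red u)))) (trans (sym (image-δ _)) e)))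
        (λ j h → trans (image-δ j) (cong ind (vanish j h)))
        (trans (δ∙ u (image (δ u))) (trans (image-δ u) (cong ind (Graph.irrefl G u))))
      where
      image-δ : ∀ j → image (δ u) j ≡ ind (adj G u j)
      image-δ j = trans (δ∙ u (rowK G j)) (cong ind (Graph.sym G j u))

    -- If the distance is below `t₂`, deleting the places of difference lowers the rank by one and
    -- leaves a reduced graph. Two rows agreeing on the rest would belong to nonadjacent vertices
    -- and differ in fewer than `t₂` places; a zero row would have degree below `t₂`.
    dist-bound : Bounded (suc r₂) → ∀ u v → u ≢ v → t₂ ≤ dist u v ⊎ n ≤ dist u v + m (suc r₂)
    dist-bound bd u v u≢v with t₂ ≤? dist u v
    ... | yes h = inj₁ h
    ... | no h  = inj₂ (begin
      n                                           ≡⟨ count-not (differ u v) ⟨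
      dist u v + count C                          ≤⟨ +-monoʳ-≤ (dist u v) (bound-nonzero G C bd rk dis nz) ⟩
      dist u v + m (suc r₂)                       ∎)
      where
      open ≤-Reasoning
      C : Pred n
      C = not ∘ differ u v
      rk : RankOn≤ G C (suc r₂)
      rk = let (y , ne) = differ-at u v u≢v in
        rank-drop {q = 1} C (λ _ → image (diff u v)) (λ _ → image-fixed (diff u v))
          (singleton-indep (image (diff u v)) y (image-diff-≢ ne)) (λ _ j h → image-diff-≡ (xor-≡ (not-elim h)))
          (≤-reflexive (+-comm 1 (suc r₂)))
      outside : ∀ {j} → differ u v j ≡ false → C j ≡ true
      outside = not-intro
      dis : DistinctOn G C
      dis x y Cx Cy x≢y with search C (differ x y)
      ... | inj₁ (c , Cc , ne) = c , Cc , xor-true ne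
      ... | inj₂ same = contradiction (nonadjacent-support x y (differ u v) x≢y
              (trans (xor-≡ (same y Cy)) (Graph.irrefl G y)) (λ j h → xor-≡ (same j (outside h)))) h
      nz : NonzeroOn G C
      nz x Cx with search C (adj G x)
      ... | inj₁ w = w
      ... | inj₂ zero-row = contradiction (degree-support x (differ u v) (λ j h → zero-row j (outside h))) h

    -- A place where the three rows are not all equal is counted by exactly two of the distances.
    -- Off these places two independent difference rows vanish, so deleting them lowers the rank by
    -- two.
    triple-dist : ∀ u v w → u ≢ v → v ≢ w → u ≢ w → 2 * t₂ ≤ dist u v + dist v w + dist u w
    triple-dist u v w u≢v v≢w u≢w = subst (2 * t₂ ≤_) (sym (count-double {t = any} pointwise)) (*-monoʳ-≤ 2 (support-bound any rk))
      where
      any : Pred n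
      any a = differ u v a ∨ differ v w a
      pointwise : ∀ a → bit (differ u v a) + bit (differ v w a) + bit (differ u w a) ≡ 2 * bit (any a)
      pointwise a with adj G u a | adj G v a | adj G w a
      ... | true  | true  | true  = refl
      ... | true  | true  | false = refl
      ... | true  | false | true  = refl
      ... | true  | false | false = refl
      ... | false | true  | true  = refl
      ... | false | true  | false = refl
      ... | false | false | true  = refl
      ... | false | false | false = refl
      agree : ∀ j → not (any j) ≡ true → adj G u j ≡ adj G v j × adj G w j ≡ adj G v j
      agree j h with adj G u j | adj G v j | adj G w j
      ... | true  | true  | true  = refl , refl
      ... | false | false | false = refl , refl
      pair : Vect n → Vect n → Fin 2 → Vect n
      pair x y = x ◂ (λ (_ : Fin 1) → y)
      z₁ z₂ : Vect n
      z₁ = image (diff u v)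
      z₂ = image (diff w v)
      use : ∀ x y → Fix P x → Fix P y → (∀ j → not (any j) ≡ true → x j ≡ 0#) → (∀ j → not (any j) ≡ true → y j ≡ 0#) →
        ∀ a → x a ≢ 0# → y a ≡ 0# → ∀ b → y b ≢ 0# → RankOn≤ G (not ∘ any) r₂
      use x y fx fy vx vy a xa ya b yb = rank-drop (not ∘ any) (pair x y)
        (λ where
          zero    → fx
          (suc i) → fy)
        (LinIndep-cons (δ a) (singleton-indep y b yb) (λ _ → trans (δ∙ a y) ya) (λ e → xa (trans (sym (δ∙ a x)) e)))
        (λ where
          zero    → vx
          (suc i) → vy)
        (≤-reflexive (+-comm 2 r₂))
      v₁ : ∀ j → not (any j) ≡ true → z₁ j ≡ 0#
      v₁ j h = image-diff-≡ (proj₁ (agree j h))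
      v₂ : ∀ j → not (any j) ≡ true → z₂ j ≡ 0#
      v₂ j h = image-diff-≡ (proj₂ (agree j h))
      rk : RankOn≤ G (not ∘ any) r₂
      -- At a place where `u` and `w` differ, `v` agrees with exactly one of them. So exactly one of
      -- the two differences vanishes there, which separates them.
      rk with differ-at u w u≢w
      ... | a , ne with adj G u a BoolP.≟ adj G v a
      ... | no ua≢va = let (b , wb) = differ-at w v (v≢w ∘ sym) in
        use z₁ z₂ (image-fixed _) (image-fixed _) v₁ v₂ a (image-diff-≢ ua≢va)
          (image-diff-≡ (trans (≢-not (ne ∘ sym)) (sym (≢-not (ua≢va ∘ sym))))) b (image-diff-≢ wb)
      ... | yes ua≡va = let (b , ub) = differ-at u v u≢v in
        use z₂ z₁ (image-fixed _) (image-fixed _) v₂ v₁ a (image-diff-≢ (λ wa≡va → ne (trans ua≡va (sym wa≡va))))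
          (image-diff-≡ ua≡va) b (image-diff-≢ ub)

    record Halving (Y : Pred n) : Set where
      field
        ζ          : ℕ
        left right : Fin ζ → Fin n
        left∈      : ∀ i → Y (left i) ≡ true
        right∈     : ∀ i → Y (right i) ≡ true
        indep      : LinIndep (λ i → image (diff (left i) (right i)))
        size       : count Y ≤ 2 ^ ζ

    -- Pick two members and a vertex `y` telling them apart; split `Y` by adjacency to `y` and
    -- continue in the larger part. All later differences vanish at `y`, so the new one is
    -- independent of them, and a step at most halves the set.
    halving : ∀ fuel (Y : Pred n) → count Y ≤ fuel → Halving Y
    halving fuel Y bound with 2 ≤? count Y
    ... | no h = record { ζ = 0 ; left = λ () ; right = λ () ; left∈ = λ () ; right∈ = λ () ; indep = λ c h () ; size = ≤-pred (≰⇒> h) }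
    halving zero Y bound | yes h = contradiction (≤-trans h bound) λ ()
    halving (suc fuel) Y bound | yes h with find₂ h
    ... | a , b , a≢b , Ya , Yb with differ-at a b a≢b
    ... | y , ne = pick (≤-total (count Y₁) (count Y₀))
      where
      Y₁ Y₀ : Pred n
      Y₁ x = Y x ∧ adj G x y
      Y₀ x = Y x ∧ not (adj G x y)
      split : count Y ≡ count Y₁ + count Y₀
      split = count-split Y (λ x → adj G x y)
      a-or-b : ∀ s → ∃ λ x → Y x ≡ true × adj G x y ≡ s
      a-or-b s with adj G a y BoolP.≟ s
      ... | yes e = a , Ya , e
      ... | no e  = b , Yb , trans (≢-not (ne ∘ sym)) (trans (cong not (≢-not e)) (BoolP.not-involutive s))
      extend : (s : Bool) (Z Z′ : Pred n) → (∀ x → Z x ≡ true → Y x ≡ true × adj G x y ≡ s) → 1 ≤ count Z′ →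
        count Y ≡ count Z + count Z′ → count Z′ ≤ count Z → Halving Y
      extend s Z Z′ Z⊑ nonempty eq big = record
        { ζ = suc (Halving.ζ H) ; left = a ◂ Halving.left H ; right = b ◂ Halving.right H
        ; left∈ = λ where
            zero    → Ya
            (suc i) → proj₁ (Z⊑ _ (Halving.left∈ H i))
        ; right∈ = λ where
            zero    → Yb
            (suc i) → proj₁ (Z⊑ _ (Halving.right∈ H i))
        ; indep = λ c h → LinIndep-cons {v = λ i → image (diff (Halving.left H i) (Halving.right H i))} {x = image (diff a b)}
            (δ y) (Halving.indep H)
            (λ i → trans (δ∙ y _) (image-diff-≡ (trans (proj₂ (Z⊑ _ (Halving.left∈ H i))) (sym (proj₂ (Z⊑ _ (Halving.right∈ H i)))))))
            (λ e → image-diff-≢ {y = y} ne (trans (sym (δ∙ y _)) e)) c h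
        ; size = begin
            count Y               ≡⟨ eq ⟩
            count Z + count Z′    ≤⟨ +-monoʳ-≤ (count Z) big ⟩
            count Z + count Z     ≤⟨ +-mono-≤ (Halving.size H) (Halving.size H) ⟩
            2 ^ Halving.ζ H + 2 ^ Halving.ζ H ≡⟨ cong (2 ^ Halving.ζ H +_) (sym (+-identityʳ _)) ⟩
            2 ^ suc (Halving.ζ H) ∎ }
        where
        open ≤-Reasoning
        H : Halving Z
        H = halving fuel Z (≤-pred (≤-trans (≤-trans (≤-reflexive (+-comm 1 (count Z))) (+-monoʳ-≤ (count Z) nonempty)) (≤-trans (≤-reflexive (sym eq)) bound)))
      pick : count Y₁ ≤ count Y₀ ⊎ count Y₀ ≤ count Y₁ → Halving Y
      pick (inj₁ h) = extend false Y₀ Y₁ (λ x e → ∧-left e , not-elim (∧-right {Y x} e))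
        (let (x , Yx , e) = a-or-b true in count-witness x (∧-intro Yx e)) (trans split (+-comm (count Y₁) (count Y₀))) h
      pick (inj₂ h) = extend true Y₁ Y₀ (λ x e → ∧-left e , ∧-right {Y x} e)
        (let (x , Yx , e) = a-or-b false in count-witness x (∧-intro Yx (not-intro e))) split h

    halve : ∀ Y → Halving Y
    halve Y = halving (count Y) Y ≤-refl

-- Vertices with equal rows on the core: pairing, common pattern, small rank.

module Twins where

  open RatSum using (0#; 1#)
  open LinAlg
  open Count
  open GraphRank
  open Bounds
  open Structure
  open import Data.Nat hiding (parity)
  open import Data.Nat.Properties
  open import Data.Nat.Tactic.RingSolver using (solve-∀)
  open import Data.Fin using (Fin; zero; suc)
  import Data.Fin.Properties as FinP
  open import Data.Bool using (Bool; true; false; not; _∧_)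
  import Data.Bool.Properties as BoolP
  open import Data.Product using (∃; _×_; _,_; proj₁; proj₂)
  open import Data.Sum using (_⊎_; inj₁; inj₂)
  open import Data.Empty using (⊥; ⊥-elim)
  open import Function using (_∘_)
  open import Relation.Nullary using (Dec; yes; no; does)
  open import Relation.Nullary.Decidable using (_→-dec_; _×-dec_; ¬?; dec-true)
  open import Relation.Nullary.Negation using (contradiction)
  open import Relation.Binary.PropositionalEquality

  b≢not-b : ∀ b → b ≢ not b
  b≢not-b true  ()
  b≢not-b false ()

  module TwinClasses {n r₂} (G : Graph n) (red : Reduced G) (P : Proj n (2 + r₂)) (fR : ∀ u → Fix P (rowK G u))
    (M : Maximal G r₂) (bd : Bounded r₂) (large : 2 * m r₂ + 3 ≤ n)
    (d₀ : Fin n) (d₀∉ : Maximal.core M d₀ ≡ false) where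

    open Core G red P fR M
    open RankDrop G P fR

    SameOnCore : Fin n → Fin n → Set
    SameOnCore x y = ∀ c → K c ≡ true → adj G x c ≡ adj G y c

    HasTwin : Fin n → Set
    HasTwin x = ∃ λ y → K y ≡ true × x ≢ y × SameOnCore x y

    hasTwin? : ∀ x → Dec (HasTwin x)
    hasTwin? x = FinP.any? (λ y → (K y BoolP.≟ true) ×-dec (¬? (x FinP.≟ y) ×-dec
      FinP.all? (λ c → (K c BoolP.≟ true) →-dec (adj G x c BoolP.≟ adj G y c))))

    tw : Pred n
    tw x = does (hasTwin? x)

    tw-elim : ∀ {x} → tw x ≡ true → HasTwin x
    tw-elim {x} h with yes w ← hasTwin? x = w

    tw-intro : ∀ {x} → HasTwin x → tw x ≡ true
    tw-intro {x} w = dec-true (hasTwin? x) w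

    same-sym : ∀ {x y} → SameOnCore x y → SameOnCore y x
    same-sym s c Kc = sym (s c Kc)

    same-column : ∀ {x y z} → SameOnCore x y → K z ≡ true → adj G z x ≡ adj G z y
    same-column {x} {y} {z} s Kz = trans (Graph.sym G z x) (trans (s z Kz) (Graph.sym G y z))

    -- Twins differ on the whole complement of the core: otherwise a smaller
    -- set than the complement could be deleted to lower the rank by two.
    twins-differ : ∀ {x y} → K y ≡ true → x ≢ y → SameOnCore x y → ∀ d → K d ≡ false → adj G x d ≢ adj G y d
    twins-differ {x} {y} Ky x≢y same d d∉ eq = <-irrefl refl (≤-<-trans
      (nonadjacent-dist x y x≢y (trans (same y Ky) (Graph.irrefl G y)))
      (count-strict {p = differ x y} {q = not ∘ K} (λ a h → not-intro (not-true (λ Ka → xor-true h (same a Ka))))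
        d (not-true (λ h → xor-true h eq)) (not-intro d∉)))

    opaque
      -- Twins differ at every vertex outside the core, in particular at `d₀`. Adjacency to `d₀`
      -- therefore names the two members of each pair.
      X : Bool → Pred n
      X s x = (K x ∧ tw x) ∧ side s (adj G x d₀)

    U : Pred n
    U x = K x ∧ not (tw x)

    opaque
      unfolding X

      X-K : ∀ {s x} → X s x ≡ true → K x ≡ true
      X-K {s} {x} h = ∧-left (∧-left h)

      X-tw : ∀ {s x} → X s x ≡ true → tw x ≡ true
      X-tw {s} {x} h = ∧-right {K x} (∧-left h)

      X-side : ∀ {s x} → X s x ≡ true → adj G x d₀ ≡ s
      X-side {s} {x} h = side-elim s (∧-right {K x ∧ tw x} h)

      X-intro : ∀ {s x} → K x ≡ true → HasTwin x → adj G x d₀ ≡ s → X s x ≡ true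
      X-intro {s} Kx t e = ∧-intro (∧-intro Kx (tw-intro t)) (side-intro s e)

      count-core : count K ≡ count (X true) + count (X false) + count U
      count-core = trans (count-split K tw) (cong (_+ count U) (count-split (λ x → K x ∧ tw x) (λ x → adj G x d₀)))

    Partner : Bool → Fin n → Set
    Partner s x = ∃ λ y → X (not s) y ≡ true × x ≢ y × SameOnCore x y

    partner : ∀ {s x} → X s x ≡ true → Partner s x
    partner {s} {x} h with tw-elim (X-tw h)
    ... | y , Ky , x≢y , same = y , X-intro Ky (x , X-K h , x≢y ∘ sym , same-sym same)
      (trans (≢-not (twins-differ Ky x≢y same d₀ d₀∉ ∘ sym)) (cong not (X-side h))) , x≢y , same

    u : ℕ
    u = count U

    Q : Bool → Pred n
    Q s x = K x ∧ not (X (not s) x)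

    count-Q : ∀ s → count (Q s) + count (X (not s)) ≡ count K
    count-Q s = sym (trans (count-split K (X (not s))) (trans (+-comm (count (λ x → K x ∧ X (not s) x)) (count (Q s)))
      (cong (count (Q s) +_) (≤-antisym (count-mono {p = λ x → K x ∧ X (not s) x} (λ x → ∧-right {K x}))
        (count-mono {q = λ x → K x ∧ X (not s) x} (λ x h → ∧-intro (X-K {not s} {x} h) h))))))

    -- By symmetry twins have equal columns on the core as well, so discarding one member of each
    -- pair loses no information about rows.
    reduce-column : ∀ s c → K c ≡ true → ∃ λ c′ → Q s c′ ≡ true × (∀ x → K x ≡ true → adj G x c ≡ adj G x c′)
    reduce-column s c Kc = by-case (X (not s) c BoolP.≟ true)
      where
      by-case : Dec (X (not s) c ≡ true) → ∃ λ c′ → Q s c′ ≡ true × (∀ x → K x ≡ true → adj G x c ≡ adj G x c′)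
      by-case (no h)  = c , ∧-intro Kc (not-intro (not-true h)) , λ x Kx → refl
      by-case (yes h) = c′ , ∧-intro (X-K {not (not s)} {c′} Xc′) (not-intro (not-true other)) , λ x Kx → same-column same Kx
        where
        p = partner {not s} {c} h
        c′ = proj₁ p
        Xc′ : X (not (not s)) c′ ≡ true
        Xc′ = proj₁ (proj₂ p)
        same : SameOnCore c c′
        same = proj₂ (proj₂ (proj₂ p))
        other : X (not s) c′ ≢ true
        other h′ = b≢not-b (not s) (trans (sym (X-side {not s} {c′} h′)) (X-side {not (not s)} {c′} Xc′))

    -- Rows agreeing on `Q s` agree on the whole core, so their vertices are twins. Twins lie on
    -- opposite sides of `d₀`, and one of those sides was removed.
    Q-distinct : ∀ s → DistinctOn G (Q s)
    Q-distinct s x y Qx Qy x≢y with search K (differ x y)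
    ... | inj₁ (c , Kc , ne) = let (c′ , Qc′ , col) = reduce-column s c Kc in
          c′ , Qc′ , λ e → xor-true ne (trans (col x (∧-left Qx)) (trans e (sym (col y (∧-left Qy)))))
    ... | inj₂ none = ⊥-elim (decide (adj G x d₀ BoolP.≟ s))
      where
      same : SameOnCore x y
      same c Kc = xor-≡ (none c Kc)
      not-in : ∀ {z} → Q s z ≡ true → HasTwin z → adj G z d₀ ≢ not s
      not-in {z} Qz t e = true≢false (X-intro (∧-left Qz) t e) (not-elim (∧-right {K z} Qz))
      decide : Dec (adj G x d₀ ≡ s) → ⊥
      decide (no e) = not-in Qx (y , ∧-left Qy , x≢y , same) (≢-not e)
      decide (yes e) = not-in Qy (x , ∧-left Qx , x≢y ∘ sym , same-sym same)
        (trans (≢-not (twins-differ (∧-left Qy) x≢y same d₀ d₀∉ ∘ sym)) (cong not e))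

    Q-rank : ∀ s → RankOn≤ G (Q s) r₂
    Q-rank s = RankOn-mono G K (Q s) (λ x → ∧-left) (Maximal.rank M)

    Q-bound : ∀ s → count (Q s) ≤ suc (m r₂)
    Q-bound s = bound-distinct G (Q s) bd (Q-rank s) (Q-distinct s)

    Q-total : count (Q true) + count (Q false) + t₂ ≡ n + u
    Q-total = begin
      q₁ + q₀ + t₂                     ≡⟨ cong (_+ t₂) (sym (+-cancelʳ-≡ (x₁ + x₀) _ _ (trans sum (identity₁ q₁ q₀ x₀ x₁)))) ⟩
      count K + u + t₂                 ≡⟨ identity₂ (count K) u t₂ ⟩
      count K + t₂ + u                 ≡⟨ cong (_+ u) n≡ ⟩
      n + u                            ∎
      where
      open ≡-Reasoning
      q₁ = count (Q true)
      q₀ = count (Q false)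
      x₁ = count (X true)
      x₀ = count (X false)
      identity₁ : ∀ a b c d → (a + c) + (b + d) ≡ a + b + (d + c)
      identity₁ = solve-∀
      identity₂ : ∀ a b c → a + b + c ≡ a + c + b
      identity₂ = solve-∀
      identity₃ : ∀ a b c → a + c + (b + c) ≡ a + b + c + c
      identity₃ = solve-∀
      identity₄ : ∀ k a u → k + u + a ≡ k + (a + u)
      identity₄ = solve-∀
      sum : count K + u + (x₁ + x₀) ≡ (q₁ + x₀) + (q₀ + x₁)
      sum = trans (identity₄ (count K) (x₁ + x₀) u) (trans (cong (count K +_) (sym count-core)) (cong₂ _+_ (sym (count-Q true)) (sym (count-Q false))))

    -- `Q true` and `Q false` cover the core and overlap exactly in `U`, so their sizes sum to n -
    -- t₂ + u. Each is at most m(r₂) + 1, while n ≥ 2 m(r₂) + 3.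
    u<t₂ : u < t₂
    u<t₂ = +-cancelˡ-≤ (2 * m r₂ + 2) (suc u) t₂ (begin
      2 * m r₂ + 2 + suc u              ≡⟨ identity₁ (m r₂) u ⟩
      2 * m r₂ + 3 + u                  ≤⟨ +-monoˡ-≤ u large ⟩
      n + u                             ≡⟨ Q-total ⟨
      count (Q true) + count (Q false) + t₂ ≤⟨ +-monoˡ-≤ t₂ (+-mono-≤ (Q-bound true) (Q-bound false)) ⟩
      suc (m r₂) + suc (m r₂) + t₂      ≡⟨ identity₂ (m r₂) t₂ ⟩
      2 * m r₂ + 2 + t₂                 ∎)
      where
      open ≤-Reasoning
      identity₁ : ∀ m u → 2 * m + 2 + (1 + u) ≡ 2 * m + 3 + u
      identity₁ = solve-∀
      identity₂ : ∀ m t → 1 + m + (1 + m) + t ≡ 2 * m + 2 + t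
      identity₂ = solve-∀

    -- The core is the disjoint union of `X s` and `Q (not s)`, and the latter has at most m(r₂) + 1
    -- ≤ (n - 1)/2 vertices.
    t₂-large : ∀ s → n + 1 ≤ 2 * t₂ + 2 * count (X s)
    t₂-large s = +-cancelˡ-≤ (2 * m r₂ + 2) _ _ (begin
      2 * m r₂ + 2 + (n + 1)            ≡⟨ identity₁ (m r₂) n ⟩
      2 * m r₂ + 3 + n                  ≤⟨ +-monoˡ-≤ n large ⟩
      n + n                             ≡⟨ cong₂ _+_ (sym n-split) (sym n-split) ⟩
      q + x + t₂ + (q + x + t₂)         ≤⟨ +-mono-≤ (+-monoˡ-≤ t₂ (+-monoˡ-≤ x q≤)) (+-monoˡ-≤ t₂ (+-monoˡ-≤ x q≤)) ⟩
      suc (m r₂) + x + t₂ + (suc (m r₂) + x + t₂) ≡⟨ identity₂ (m r₂) x t₂ ⟩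
      2 * m r₂ + 2 + (2 * t₂ + 2 * x)   ∎)
      where
      open ≤-Reasoning
      q = count (Q (not s))
      x = count (X s)
      q≤ : q ≤ suc (m r₂)
      q≤ = Q-bound (not s)
      n-split : q + x + t₂ ≡ n
      n-split = trans (cong (_+ t₂) (trans (cong (λ s′ → q + count (X s′)) (sym (BoolP.not-involutive s))) (count-Q (not s)))) n≡
      identity₁ : ∀ m n → 2 * m + 2 + (n + 1) ≡ 2 * m + 3 + n
      identity₁ = solve-∀
      identity₂ : ∀ m x t → 1 + m + x + t + (1 + m + x + t) ≡ 2 * m + 2 + (2 * t + 2 * x)
      identity₂ = solve-∀

    -- An isotropic combination supported off the core and vanishing at d₀ is zero, by maximality.
    vanish-off-core : ∀ φ → (∀ c → K c ≡ true → image φ c ≡ 0#) → image φ d₀ ≡ 0# → φ ∙ image φ ≡ 0# → ∀ d → image φ d ≡ 0#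
    vanish-off-core φ onK at-d₀ φφ d with image φ d RatSum.≟ 0#
    ... | yes e = e
    ... | no ne = ⊥-elim (<-irrefl refl (≤-<-trans
      (isotropic-support φ Sp d ne outside φφ)
      (count-strict {p = Sp} {q = not ∘ K} (λ x → ∧-left) d₀ (not-true (λ h → true≢false (is-refl d₀) (not-elim (∧-right {not (K d₀)} h)))) (not-intro d₀∉))))
      where
      Sp : Pred n
      Sp x = not (K x) ∧ not (x is d₀)
      outside : ∀ j → Sp j ≡ false → image φ j ≡ 0#
      outside j h with K j in Kj
      ... | true = onK j Kj
      ... | false = trans (cong (image φ) (is-true j d₀ (not-false (λ e → true≢false (not-intro e) h)))) at-d₀

    ⊖-image : ∀ φ ψ y → image (φ ⊖ ψ) y ≡ image φ y RatSum.- image ψ y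
    ⊖-image φ ψ y = ⊖∙ φ ψ (rowK G y)

    zero-sub : ∀ {a b} → a ≡ 0# → b ≡ 0# → a RatSum.- b ≡ 0#
    zero-sub refl refl = sub-self 0#

    diff-core : ∀ {x y} → SameOnCore x y → ∀ c → K c ≡ true → image (diff x y) c ≡ 0#
    diff-core same c Kc = image-diff-≡ (same c Kc)

    -- The difference of the two twin differences is supported on the core and has zero image there,
    -- hence is isotropic. Its image also vanishes at `d₀`, as both pairs are oriented alike, so it
    -- vanishes everywhere.
    pattern-unique : ∀ {s x y} → X s x ≡ true → X s y ≡ true → ∀ d → K d ≡ false → adj G x d ≡ adj G y d
    pattern-unique {s} {x} {y} Xx Xy d d∉ = through (partner Xx) (partner Xy)
     where
     through : Partner s x → Partner s y → adj G x d ≡ adj G y d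
     through (x′ , Xx′ , x≢x′ , samex) (y′ , Xy′ , y≢y′ , samey) =
        conclude (adj G x d) (adj G y d) (≢-not (twins-differ (X-K Xx′) x≢x′ samex d d∉ ∘ sym)) (≢-not (twins-differ (X-K Xy′) y≢y′ samey d d∉ ∘ sym))
          (trans (sym (eval d)) (vanish-off-core φ onK at-d₀ isotropic d))
      where
      φ : Vect n
      φ = diff x x′ ⊖ diff y y′
      eval : ∀ j → image φ j ≡ (ind (adj G x j) RatSum.- ind (adj G x′ j)) RatSum.- (ind (adj G y j) RatSum.- ind (adj G y′ j))
      eval j = trans (⊖-image (diff x x′) (diff y y′) j) (cong₂ RatSum._-_ (image-diff x x′ j) (image-diff y y′ j))
      onK : ∀ c → K c ≡ true → image φ c ≡ 0#
      onK c Kc = trans (⊖-image (diff x x′) (diff y y′) c) (zero-sub (diff-core samex c Kc) (diff-core samey c Kc))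
      at-d₀ : image φ d₀ ≡ 0#
      at-d₀ = trans (eval d₀) (trans (cong₂ RatSum._-_ (cong₂ (λ a b → ind a RatSum.- ind b) (X-side Xx) (X-side Xx′)) (cong₂ (λ a b → ind a RatSum.- ind b) (X-side Xy) (X-side Xy′))) (sub-self _))
      isotropic : φ ∙ image φ ≡ 0#
      isotropic = trans (⊖∙ (diff x x′) (diff y y′) (image φ)) (zero-sub
        (trans (diff∙ x x′ (image φ)) (zero-sub (onK x (X-K Xx)) (onK x′ (X-K Xx′))))
        (trans (diff∙ y y′ (image φ)) (zero-sub (onK y (X-K Xy)) (onK y′ (X-K Xy′)))))
      conclude : ∀ a b {a′ b′} → a′ ≡ not a → b′ ≡ not b → (ind a RatSum.- ind a′) RatSum.- (ind b RatSum.- ind b′) ≡ 0# → a ≡ b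
      conclude true  true  _    _    _ = refl
      conclude false false _    _    _ = refl
      conclude true  false refl refl e = contradiction e 1-0-[0-1]≢0
      conclude false true  refl refl e = contradiction e 0-1-[1-0]≢0

    -- Two members with equal rows on `X s` also agree on the other side, through the partners, and
    -- outside the core, by `pattern-unique`. They are nonadjacent and can differ only on `U`, which
    -- has fewer than `t₂` elements.
    X-distinct : ∀ s → DistinctOn G (X s)
    X-distinct s x y Xx Xy x≢y with search (X s) (differ x y)
    ... | inj₁ (c , Xc , ne) = c , Xc , xor-true ne
    ... | inj₂ none = ⊥-elim (<-irrefl refl (≤-<-trans (nonadjacent-support x y U x≢y nonadjacent agree) u<t₂))
      where
      same : ∀ c → X s c ≡ true → adj G x c ≡ adj G y c
      same c Xc = xor-≡ (none c Xc)
      nonadjacent : adj G x y ≡ false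
      nonadjacent = trans (same y Xy) (Graph.irrefl G y)
      agree : ∀ j → U j ≡ false → adj G x j ≡ adj G y j
      agree j Uj with K j in Kj
      ... | false = pattern-unique Xx Xy j Kj
      ... | true with adj G j d₀ BoolP.≟ s
      ... | yes e = same j (X-intro Kj (tw-elim (not-false (λ h → true≢false (not-intro h) Uj))) e)
      ... | no e = through (partner {not s} (X-intro Kj (tw-elim (not-false (λ h → true≢false (not-intro h) Uj))) (≢-not e)))
        where
        through : Partner (not s) j → adj G x j ≡ adj G y j
        through (j′ , Xj′ , _ , samej) = trans (same-column samej (X-K Xx))
          (trans (same j′ (subst (λ b → X b j′ ≡ true) (BoolP.not-involutive s) Xj′)) (sym (same-column samej (X-K Xy))))

    X-bound : ∀ s {ρ} → Bounded ρ → RankOn≤ G (X s) ρ → count (X s) ≤ suc (m ρ)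
    X-bound s bdρ rk = bound-distinct G (X s) bdρ rk (X-distinct s)

    module _ (x₀ : Fin n) (Xx₀ : X true x₀ ≡ true) where

      opaque
        Y : Bool → Pred n
        Y e d = not (K d) ∧ side e (adj G x₀ d)

        Y-∉ : ∀ {e d} → Y e d ≡ true → K d ≡ false
        Y-∉ h = not-elim (∧-left h)

        Y-side : ∀ {e d} → Y e d ≡ true → adj G x₀ d ≡ e
        Y-side {e} {d} h = side-elim e (∧-right {not (K d)} h)

        Y-intro : ∀ {e d} → K d ≡ false → adj G x₀ d ≡ e → Y e d ≡ true
        Y-intro {e} d∉ h = ∧-intro (not-intro d∉) (side-intro e h)

        Y-total : t₂ ≡ count (Y true) + count (Y false)
        Y-total = count-split (not ∘ K) (adj G x₀)

      -- Outside the core, members of `X true` all have the pattern of `x₀` and members of `X false`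
      -- the complementary one; `Y e` is a level set of this pattern.
      Y-constant : ∀ {s e d d′ x} → Y e d ≡ true → Y e d′ ≡ true → X s x ≡ true → adj G x d ≡ adj G x d′
      Y-constant {true} {e} Yd Yd′ Xx = trans (pattern-unique Xx Xx₀ _ (Y-∉ {e} Yd)) (trans (trans (Y-side Yd) (sym (Y-side Yd′))) (sym (pattern-unique Xx Xx₀ _ (Y-∉ {e} Yd′))))
      Y-constant {false} {e} {d} {d′} {x} Yd Yd′ Xx = through (partner Xx)
       where
       through : Partner false x → adj G x d ≡ adj G x d′
       through (x′ , Xx′ , x≢x′ , same) = trans (opp Yd) (trans (cong not (Y-constant {true} Yd Yd′ Xx′)) (sym (opp Yd′)))
        where
        opp : ∀ {d} → Y e d ≡ true → adj G x d ≡ not (adj G x′ d)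
        opp Yd = ≢-not (twins-differ (X-K Xx′) x≢x′ same _ (Y-∉ {e} Yd))

      -- Differences of members of `Y e` vanish on `X s`, and `halve` supplies logarithmically many
      -- independent ones.
      X-rank : ∀ s e {ρ} → 2 + r₂ ≤ ρ + Halving.ζ (halve (Y e)) → RankOn≤ G (X s) ρ
      X-rank s e le = rank-drop (X s) (λ i → image (diff (left i) (right i))) (λ i → image-fixed _) (Halving.indep (halve (Y e)))
        (λ i x Xx → image-diff-≡ (trans (Graph.sym G _ x) (trans (Y-constant {s} {e} (left∈ i) (right∈ i) Xx) (Graph.sym G x _)))) le
        where open Halving (halve (Y e)) hiding (indep)

      -- The twin difference `z₁` and the difference `z₂` of `d` and `d′` both vanish on `X s`. The
      -- combination producing `z₁` also annihilates both, so it separates the row of `d₀` and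
      -- contributes the third dimension.
      X-rank-3 : ∀ s e {d d′ ρ} → d ≢ d′ → Y e d ≡ true → Y e d′ ≡ true → 2 + r₂ ≤ 3 + ρ → RankOn≤ G (X s) ρ
      X-rank-3 s e {d} {d′} {ρ} d≢d′ Yd Yd′ le = through (partner Xx₀)
       where
       through : Partner true x₀ → RankOn≤ G (X s) ρ
       through (x₁ , Xx₁ , x₀≢x₁ , same) = rank-drop⁺ (X s) z
          (λ where
            zero    → image-fixed _
            (suc i) → image-fixed _)
          -- Summing the entries at `d` and `d′` gives 0 for `z₂`, by symmetry of the matrix, but 2
          -- or -2 for `z₁`, whose entries on `Y e` share one sign.
          (LinIndep-cons ψ (singleton-indep z₂ (proj₁ (differ-at d d′ d≢d′)) (image-diff-≢ (proj₂ (differ-at d d′ d≢d′))))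
            (λ _ → trans (ψ∙ z₂) (trans (cong₂ RatSum._+_ (trans (image-diff d d′ d) (cong (λ b → ind b RatSum.- ind (adj G d′ d)) (Graph.irrefl G d)))
              (trans (image-diff d d′ d′) (cong₂ (λ a b → ind a RatSum.- ind b) (Graph.sym G d d′) (Graph.irrefl G d′)))) (antisymmetric (ind (adj G d′ d)))))
            (λ e₀ → two e (trans (sym (trans (ψ∙ z₁) (cong₂ RatSum._+_ (z₁-value Yd) (z₁-value Yd′)))) e₀)))
          (λ where
            zero    → z₁-vanish
            (suc i) → z₂-vanish)
          (diff x₀ x₁) d₀ (image-diff-≢ (twins-differ (X-K Xx₁) x₀≢x₁ same d₀ d₀∉)) z₁-vanish
          (λ where
            zero    → trans (diff∙ x₀ x₁ z₁) (zero-sub (z₁-vanishK x₀ (X-K Xx₀)) (z₁-vanishK x₁ (X-K Xx₁)))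
            (suc i) → trans (diff∙ x₀ x₁ z₂) (zero-sub (z₂-vanish′ Xx₀) (z₂-vanish′ Xx₁)))
          (≤-trans le (≤-reflexive (identity ρ)))
        where
        identity : ∀ ρ → 3 + ρ ≡ 1 + (ρ + 2)
        identity = solve-∀
        z₁ z₂ ψ : Vect n
        z₁ = image (diff x₀ x₁)
        z₂ = image (diff d d′)
        ψ a = δ d a RatSum.+ δ d′ a
        z : Fin 2 → Vect n
        z = z₁ ◂ (λ (_ : Fin 1) → z₂)
        ψ∙ : ∀ x → ψ ∙ x ≡ x d RatSum.+ x d′
        ψ∙ x = trans (RatSum.Σ-cong (λ a → distrib (δ d a) (δ d′ a) (x a))) (trans (RatSum.Σ-+ {n} _ _) (cong₂ RatSum._+_ (δ∙ d x) (δ∙ d′ x)))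
          where
          distrib : ∀ a b c → (a RatSum.+ b) RatSum.* c ≡ a RatSum.* c RatSum.+ b RatSum.* c
          distrib a b c = trans (RatSum.*-comm (a RatSum.+ b) c) (trans (RatSum.*-distribˡ-+ c a b) (cong₂ RatSum._+_ (RatSum.*-comm c a) (RatSum.*-comm c b)))
        z₁-vanishK : ∀ c → K c ≡ true → z₁ c ≡ 0#
        z₁-vanishK = diff-core same
        z₁-vanish : ∀ j → X s j ≡ true → z₁ j ≡ 0#
        z₁-vanish j Xj = z₁-vanishK j (X-K {s} Xj)
        z₂-vanish′ : ∀ {s j} → X s j ≡ true → z₂ j ≡ 0#
        z₂-vanish′ {s} {j} Xj = image-diff-≡ (trans (Graph.sym G d j) (trans (Y-constant {s} {e} Yd Yd′ Xj) (Graph.sym G j d′)))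
        z₂-vanish : ∀ j → X s j ≡ true → z₂ j ≡ 0#
        z₂-vanish j = z₂-vanish′ {s} {j}
        z₁-value : ∀ {d} → Y e d ≡ true → z₁ d ≡ ind e RatSum.- ind (not e)
        z₁-value {d} Yd = trans (image-diff x₀ x₁ d) (cong₂ (λ a b → ind a RatSum.- ind b) (Y-side Yd)
          (trans (≢-not (twins-differ (X-K Xx₁) x₀≢x₁ same d (Y-∉ {e} Yd) ∘ sym)) (cong not (Y-side Yd))))
        two : ∀ e → (ind e RatSum.- ind (not e)) RatSum.+ (ind e RatSum.- ind (not e)) ≢ 0#
        two true  = 2≢0
        two false = -2≢0

      -- A vertex isolated in the core is joined to everything outside the core, so Y true is the whole complement.
      large-class : ∃ λ e → t₂ ≤ 2 * count (Y e) × 2 ≤ count (Y e)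
      large-class with FinP.any? (λ z → (K z BoolP.≟ true) ×-dec FinP.all? (λ c → (K c BoolP.≟ true) →-dec (adj G z c BoolP.≟ false)))
      ... | yes (z , Kz , zero-row) = true , ≤-trans t₂≤ (m≤m+n _ _) , ≤-trans 2≤t₂ t₂≤
        where
        full-row : ∀ {y} → (∀ c → K c ≡ true → adj G y c ≡ false) → ∀ d → K d ≡ false → adj G y d ≡ true
        full-row {y} zr d d∉ = not-false (λ e → <-irrefl refl (≤-<-trans
          (degree-support y (adj G y) (λ j h → h))
          (count-strict {p = adj G y} {q = not ∘ K} (λ a h → not-intro (not-true (λ Ka → true≢false h (zr a Ka)))) d e (not-intro d∉))))
        untwinned : tw z ≡ false
        untwinned = not-true (λ t → let (z′ , Kz′ , z≢z′ , same) = tw-elim t in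
          twins-differ Kz′ z≢z′ same d₀ d₀∉ (trans (full-row zero-row d₀ d₀∉) (sym (full-row (λ c Kc → trans (sym (same c Kc)) (zero-row c Kc)) d₀ d₀∉))))
        2≤t₂ : 2 ≤ t₂
        2≤t₂ = ≤-trans (s≤s (count-witness {p = U} z (∧-intro Kz (not-intro untwinned)))) u<t₂
        joined : ∀ d → K d ≡ false → adj G x₀ d ≡ true
        joined d d∉ = through (partner Xx₀)
         where
         through : Partner true x₀ → adj G x₀ d ≡ true
         through (x₁ , Xx₁ , x₀≢x₁ , same) = conclude (adj G x₀ d) (≢-not (twins-differ (X-K Xx₁) x₀≢x₁ same d d∉ ∘ sym)) (trans (sym (eval d d∉)) (vanish-off-core φ onK at-d₀ isotropic d))
          where
          φ : Vect n
          φ = δ z ⊖ diff x₀ x₁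
          image-δ : ∀ j → image (δ z) j ≡ ind (adj G z j)
          image-δ j = trans (δ∙ z (rowK G j)) (cong ind (Graph.sym G j z))
          eval : ∀ j → K j ≡ false → image φ j ≡ 1# RatSum.- (ind (adj G x₀ j) RatSum.- ind (adj G x₁ j))
          eval j j∉ = trans (⊖-image (δ z) (diff x₀ x₁) j) (cong₂ RatSum._-_ (trans (image-δ j) (cong ind (full-row zero-row j j∉))) (image-diff x₀ x₁ j))
          onK : ∀ c → K c ≡ true → image φ c ≡ 0#
          onK c Kc = trans (⊖-image (δ z) (diff x₀ x₁) c) (zero-sub (trans (image-δ c) (cong ind (zero-row c Kc))) (diff-core same c Kc))
          at-d₀ : image φ d₀ ≡ 0#
          at-d₀ = trans (eval d₀ d₀∉) (trans (cong (λ q → 1# RatSum.- q) (trans (cong₂ (λ a b → ind a RatSum.- ind b) (X-side Xx₀) (X-side Xx₁)) 1-0)) (sub-self 1#))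
          isotropic : φ ∙ image φ ≡ 0#
          isotropic = trans (⊖∙ (δ z) (diff x₀ x₁) (image φ)) (zero-sub (trans (δ∙ z (image φ)) (onK z Kz))
            (trans (diff∙ x₀ x₁ (image φ)) (zero-sub (onK x₀ (X-K Xx₀)) (onK x₁ (X-K Xx₁)))))
          conclude : ∀ a {a′} → a′ ≡ not a → 1# RatSum.- (ind a RatSum.- ind a′) ≡ 0# → a ≡ true
          conclude true  _    _ = refl
          conclude false refl e = contradiction e 1-[0-1]≢0
        t₂≤ : t₂ ≤ count (Y true)
        t₂≤ = count-mono {p = not ∘ K} (λ d h → Y-intro (not-elim h) (joined d (not-elim h)))
      ... | no none = pick (≤-total (count (Y true)) (count (Y false)))
        where
        nonzero : ∀ s → NonzeroOn G (Q s)
        nonzero s x Qx with search K (adj G x)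
        ... | inj₁ (c , Kc , xc) = let (c′ , Qc′ , col) = reduce-column s c Kc in c′ , Qc′ , trans (sym (col x (∧-left Qx))) xc
        ... | inj₂ zr = contradiction (x , ∧-left Qx , zr) none
        3≤t₂ : 3 ≤ t₂
        3≤t₂ = +-cancelˡ-≤ (2 * m r₂) 3 t₂ (begin
          2 * m r₂ + 3                          ≤⟨ large ⟩
          n                                     ≤⟨ m≤m+n n u ⟩
          n + u                                 ≡⟨ Q-total ⟨
          count (Q true) + count (Q false) + t₂ ≤⟨ +-monoˡ-≤ t₂ (+-mono-≤ (q≤ true) (q≤ false)) ⟩
          m r₂ + m r₂ + t₂                      ≡⟨ cong (λ q → m r₂ + q + t₂) (sym (+-identityʳ (m r₂))) ⟩
          2 * m r₂ + t₂                         ∎)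
          where
          open ≤-Reasoning
          q≤ : ∀ s → count (Q s) ≤ m r₂
          q≤ s = bound-nonzero G (Q s) bd (Q-rank s) (Q-distinct s) (nonzero s)
        two≤ : ∀ y → 3 ≤ 2 * y → 2 ≤ y
        two≤ zero ()
        two≤ (suc zero) (s≤s (s≤s ()))
        two≤ (suc (suc y)) _ = s≤s (s≤s z≤n)
        twice : ∀ {a b} → b ≤ a → t₂ ≡ a + b → t₂ ≤ 2 * a
        twice {a} {b} h eq = ≤-trans (≤-reflexive eq) (≤-trans (+-monoʳ-≤ a h) (≤-reflexive (cong (a +_) (sym (+-identityʳ a)))))
        pick : count (Y true) ≤ count (Y false) ⊎ count (Y false) ≤ count (Y true) → ∃ λ e → t₂ ≤ 2 * count (Y e) × 2 ≤ count (Y e)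
        pick (inj₁ h) = let le = twice h (trans Y-total (+-comm (count (Y true)) (count (Y false)))) in false , le , two≤ _ (≤-trans 3≤t₂ le)
        pick (inj₂ h) = let le = twice h Y-total in true , le , two≤ _ (≤-trans 3≤t₂ le)

-- The ±1 rows of the adjacency matrix and a Plotkin-type bound.

module Signed where

  open RatSum
  open LinAlg
  open Spherical
  open Count hiding (Pred)
  open Count using (Pred)
  open GraphRank
  open import Data.Nat as ℕ using (ℕ; zero; suc)
  import Data.Nat.Properties as ℕP
  open import Data.Fin using (Fin; zero; suc)
  open import Data.Fin.Properties using (all?; ¬∀⟶∃¬)
  open import Data.Bool using (Bool; true; false; _∧_; _xor_)
  open import Data.Product using (Σ; ∃; _×_; _,_)
  open import Function using (_∘_)
  open import Relation.Nullary using (yes; no)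
  open import Relation.Binary.PropositionalEquality
  open import Tactic.RingSolver using (solve-∀)

  two : K
  two = 1# + 1#

  sgn : Bool → K
  sgn true  = - 1#
  sgn false = 1#

  Fix-lin : ∀ {n d} (Q : Proj n d) {x y : Vect n} α β → Fix Q x → Fix Q y → Fix Q (λ a → α * x a + β * y a)
  Fix-lin Q {x} {y} α β fx fy = Fix-span Q {v = x ◂ (λ (_ : Fin 1) → y)}
    (λ where
      zero    → fx
      (suc i) → fy)
    (α ◂ (λ _ → β) , λ b → cong (α * x b +_) (sym (+-identityʳ (β * y b))))

  extend-by : ∀ {n d} (P : Proj n d) (x : Vect n) →
    ∃ λ e → e ℕ.≤ suc d × Σ (Proj n e) λ Q → Fix Q x × (∀ z → Fix P z → Fix Q z)
  extend-by {n} {d} P x with all? (λ a → Residual.y P x a ≟ 0#)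
  ... | yes y≡0 = d , ℕP.n≤1+n d , P , Residual.y≡0⇒Fix P x y≡0 , λ z fz → fz
  ... | no y≢0  = let (a , ya) = ¬∀⟶∃¬ n _ (λ a → Residual.y P x a ≟ 0#) y≢0 in
    suc d , ℕP.≤-refl , Residual.extend P x a ya , Residual.fix-x P x a ya , Residual.fix' P x a ya

  signed : ∀ {n} → Graph n → Pred n → Fin n → Vect n
  signed G L u a = ind (L a) * sgn (adj G u a)

  -- On `L` a signed row is 1 minus twice the 0-1 row. So the indicator of `L` together with the
  -- restricted rows spans everything, in dimension at most r + 1.
  signed-proj : ∀ {n r} (G : Graph n) (P : Proj n r) → (∀ u → Fix P (rowK G u)) → ∀ L →
    ∃ λ d → d ℕ.≤ suc r × Σ (Proj n d) λ Q → ∀ u → Fix Q (signed G L u)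
  signed-proj {n} {r} G P fR L = combine (extend-by (proj B) (ind ∘ L))
    where
    v : Fin n → Vect n
    v u a = ind (L a) * rowK G u a
    B : Basis v
    B = basis v
    dim≤r : dim B ℕ.≤ r
    dim≤r = steinitz P (rowK G ∘ choice B) (λ i → fR (choice B i)) (λ c h → indep B c (λ j →
      trans (Σ-cong (λ i → rearrange (c i) (ind (L j)) (rowK G (choice B i) j))) (trans (Σ-*ˡ {dim B} (ind (L j)) _) (trans (cong (ind (L j) *_) (h j)) (*-zeroʳ (ind (L j)))))))
      where
      opaque
        unfolding K
        rearrange : ∀ c l x → c * (l * x) ≡ l * (c * x)
        rearrange = solve-∀ ℚ-ring
    combine : (∃ λ e → e ℕ.≤ suc (dim B) × Σ (Proj n e) λ Q → Fix Q (ind ∘ L) × (∀ z → Fix (proj B) z → Fix Q z)) →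
      ∃ λ d → d ℕ.≤ suc r × Σ (Proj n d) λ Q → ∀ u → Fix Q (signed G L u)
    combine (e , e≤ , Q , fL , fix) = e , ℕP.≤-trans e≤ (ℕ.s≤s dim≤r) , Q ,
        λ u a → trans (∙-cong {x = Π Q a} (λ _ → refl) (λ b → value (L b) (adj G u b))) (trans (Fix-lin Q 1# (- two) fL (fix (v u) (fixes B u)) a) (sym (value (L a) (adj G u a))))
      where
      opaque
        unfolding K
        value : ∀ l b → ind l * sgn b ≡ 1# * ind l + - two * (ind l * ind b)
        value true  true  = refl
        value true  false = refl
        value false true  = refl
        value false false = refl

  module _ {n} (G : Graph n) (L : Pred n) where

    distL : Fin n → Fin n → ℕ
    distL u v = count (λ a → L a ∧ (adj G u a xor adj G v a))

    product : ∀ u v → signed G L u ∙ signed G L v ≡ ι (count L) - two * ι (distL u v)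
    product u v = trans (Σ-cong (λ a → value (L a) (adj G u a) (adj G v a)))
        (trans (Σ-+ {n} _ _) (cong₂ _+_ (Σ-ind L) (trans (Σ-*ˡ {n} (- two) _) (trans (cong (- two *_) (Σ-ind (λ a → L a ∧ (adj G u a xor adj G v a)))) (neg-* two _)))))
      where
      opaque
        unfolding K
        value : ∀ l a b → ind l * sgn a * (ind l * sgn b) ≡ ind l + - two * ind (l ∧ (a xor b))
        value true  true  true  = refl
        value true  true  false = refl
        value true  false true  = refl
        value true  false false = refl
        value false true  true  = refl
        value false true  false = refl
        value false false true  = refl
        value false false false = refl
        neg-* : ∀ a b → - a * b ≡ - (a * b)
        neg-* = solve-∀ ℚ-ring

    distL-self : ∀ u → distL u u ≡ 0
    distL-self u = trans (count-cong (λ a → same (L a) (adj G u a))) (none n)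
      where
      same : ∀ l b → l ∧ (b xor b) ≡ false
      same true  true  = refl
      same true  false = refl
      same false _     = refl
      none : ∀ n → count {n} (λ _ → false) ≡ 0
      none zero    = refl
      none (suc n) = none n

    norm : ∀ u → signed G L u ∙ signed G L u ≡ ι (count L)
    norm u = trans (product u u) (trans (cong (λ k → ι (count L) - two * ι k) (distL-self u)) (identity (ι (count L)) two))
      where
      opaque
        unfolding K
        identity : ∀ a t → a + - (t * 0#) ≡ a
        identity = solve-∀ ℚ-ring

    -- If the members of Y pairwise differ in more than half of L, their ±1 rows
    -- have negative inner products and t (t + N) ≤ 0 off the diagonal.
    plotkin : ∀ {r} (P : Proj n r) → (∀ u → Fix P (rowK G u)) → ∀ (Y : Pred n) →
      (∀ u v → u ≢ v → Y u ≡ true → Y v ≡ true → suc (count L) ℕ.≤ 2 ℕ.* distL u v) →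
      1 ℕ.≤ count L → count Y ℕ.≤ 2 ℕ.* suc r
    plotkin {r} P fR Y far nonempty with signed-proj G P fR L
    ... | d , d≤ , Q , fQ = conclude (count Y) refl
      where
      w : Fin n → K
      w = ind ∘ Y
      open Moments (signed G L) Q fQ r d≤ w hiding (W)
      N W : K
      N = ι (count L)
      W = ι (count Y)
      Σw : Σ[ n ] w ≡ W
      Σw = Σ-ind Y
      opaque
        unfolding K
        split : ∀ w N g → w * (g * (g * 1#) + N * (g * 1#)) ≡ w * (g * (g * 1#)) + N * (w * (g * 1#))
        split = solve-∀ ℚ-ring
        at-N : ∀ N → N * (N * 1#) + N * (N * 1#) ≡ (1# + 1#) * (N * N) + 0#
        at-N = solve-∀ ℚ-ring
        factor : ∀ g N → g * (g * 1#) + N * (g * 1#) ≡ g * (g + N)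
        factor = solve-∀ ℚ-ring
        rest : ∀ N t d → t ≡ (1# + 1#) * d → N + - t + N ≡ (1# + 1#) * (N + - d)
        rest N t d refl = rest′ N d
          where
          rest′ : ∀ N d → N + - ((1# + 1#) * d) + N ≡ (1# + 1#) * (N + - d)
          rest′ = solve-∀ ℚ-ring
        tidy : ∀ s a → s * a + s * s * 0# ≡ s * a
        tidy = solve-∀ ℚ-ring
        tidy₂ : ∀ D W N → D * (W * ((1# + 1#) * (N * N))) ≡ N * N * (W * ((1# + 1#) * D))
        tidy₂ = solve-∀ ℚ-ring
        two-ι : (1# + 1#) ≡ ι 2
        two-ι = refl
      φ : Fin n → Fin n → K
      φ i k = g i k * (g i k * 1#) + N * (g i k * 1#)
      upper : ΣΣ n (λ i k → w i * w k * φ i k) ≤ W * ((1# + 1#) * (N * N))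
      upper = subst (ΣΣ n (λ i k → w i * w k * φ i k) ≤_) (trans (tidy (Σ[ n ] w) _) (cong (_* ((1# + 1#) * (N * N))) Σw))
        (ΣΣ-diagonal w φ ((1# + 1#) * (N * N)) 0# (λ i → ind-≥0 (Y i)) (λ i → ind-idem (Y i)) on-diagonal off-diagonal)
        where
        on-diagonal : ∀ i → w i * φ i i ≤ w i * ((1# + 1#) * (N * N) + 0#)
        on-diagonal i = ≤-reflexive (cong (w i *_) (trans (cong (λ q → q * (q * 1#) + N * (q * 1#)) (norm i)) (at-N N)))
        φ≤0 : ∀ i k → suc (count L) ℕ.≤ 2 ℕ.* distL i k → φ i k ≤ 0#
        φ≤0 i k h = ≤-trans (≤-reflexive (factor (g i k) N)) (a*b≤0 g≤0 0≤g+N)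
          where
          2d : two * ι (distL i k) ≡ ι (2 ℕ.* distL i k)
          2d = trans (cong (_* ι (distL i k)) two-ι) (sym (ι-* 2 (distL i k)))
          g≤0 : g i k ≤ 0#
          g≤0 = ≤-trans (≤-reflexive (product i k)) (≤-trans (+-monoˡ-≤ _ (ι-mono (ℕP.≤-trans (ℕP.n≤1+n (count L)) h))) (≤-reflexive (trans (cong (λ q → ι (2 ℕ.* distL i k) - q) 2d) (cancel _))))
            where
            opaque
              unfolding K
              cancel : ∀ a → a + - a ≡ 0#
              cancel = solve-∀ ℚ-ring
          0≤g+N : 0# ≤ g i k + N
          0≤g+N = subst (0# ≤_) (sym (trans (cong (_+ N) (product i k)) (rest N (two * ι (distL i k)) (ι (distL i k)) refl)))
            (*-≥0 (+-≥0 0≤1 0≤1) (0≤q-p (ι-mono (count-mono {p = λ a → L a ∧ (adj G i a xor adj G k a)} {q = L} (λ a → left (L a))))))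
            where
            left : ∀ l {b} → l ∧ b ≡ true → l ≡ true
            left true _ = refl
        off-diagonal : ∀ i k → i ≢ k → w i * w k * φ i k ≤ w i * w k * 0#
        off-diagonal i k i≢k with Y i in Yi | Y k in Yk
        ... | true  | true  = *-monoˡ _ (*-≥0 0≤1 0≤1) (φ≤0 i k (far i k i≢k Yi Yk))
        ... | true  | false = ≤-reflexive (vanish (φ i k))
          where
          opaque
            unfolding K
            vanish : ∀ x → 1# * 0# * x ≡ 1# * 0# * 0#
            vanish = solve-∀ ℚ-ring
        ... | false | b = ≤-reflexive (vanish (ind b) (φ i k))
          where
          opaque
            unfolding K
            vanish : ∀ b x → 0# * b * x ≡ 0# * b * 0#
            vanish = solve-∀ ℚ-ring
      -- Adding the nonnegative N · `S w 1` to the second moment gives the sum of `φ`, of which only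
      -- the diagonal contributes positively.
      lower : N * N * (W * W) ≤ ι (suc r) * (W * ((1# + 1#) * (N * N)))
      lower = ≤-trans (subst (λ q → N * N * (q * q) ≤ ι (suc r) * S w 2) Σw
          (second-moment N (ι-≥0 (count L)) (λ i → ind-≥0 (Y i)) (λ i → ≤-reflexive (cong (w i *_) (sym (norm i))))))
        (*-monoˡ _ (ι-≥0 (suc r)) (≤-trans (p≤q-by (*-≥0 (ι-≥0 (count L)) (S-≥0 w 1)) expand) upper))
        where
        expand : ΣΣ n (λ i k → w i * w k * φ i k) ≡ S w 2 + N * S w 1
        expand = trans (ΣΣ-cong (λ i k → split (w i * w k) N (g i k))) (trans (ΣΣ-+ {n} _ _) (cong (S w 2 +_) (ΣΣ-*ˡ {n} N _)))
      NN≢0 : N * N ≢ 0#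
      NN≢0 e = N≢0 (a*b≡0 N≢0 e)
        where
        N≢0 : N ≢ 0#
        N≢0 = positive (count L) nonempty
          where
          positive : ∀ k → 1 ℕ.≤ k → ι k ≢ 0#
          positive (suc k) _ = ι-suc≢0 k
      conclude : ∀ y → count Y ≡ y → count Y ℕ.≤ 2 ℕ.* suc r
      conclude zero    e = subst (ℕ._≤ 2 ℕ.* suc r) (sym e) ℕ.z≤n
      conclude (suc y) e = ι-cancel (subst (W ≤_) (trans (cong (_* ι (suc r)) two-ι) (sym (ι-* 2 (suc r))))
        (*-cancelˡ (ι-≥0 (count Y)) (λ W≡0 → ι-suc≢0 y (trans (cong ι (sym e)) W≡0))
          (*-cancelˡ (sq-≥0 N) NN≢0 (subst (N * N * (W * W) ≤_) (tidy₂ (ι (suc r)) W N) lower))))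

-- Few vertices lie in a cap around a given vertex.

module Caps where

  open RatSum
  open LinAlg
  open Spherical
  open Count
  open GraphRank
  open Signed
  open import Data.Nat as ℕ using (ℕ; zero; suc)
  import Data.Nat.Properties as ℕP
  open import Data.Fin using (Fin; zero; suc)
  open import Data.Bool using (true; false; _xor_)
  open import Data.Product using (Σ; ∃; _×_; proj₁; proj₂)
  open import Function using (_∘_)
  open import Relation.Nullary using (yes; no)
  open import Relation.Binary.PropositionalEquality
  open import Tactic.RingSolver using (solve-∀)

  opaque
    unfolding K
    0*-vanish : ∀ x y → 0# * x ≡ 0# * y
    0*-vanish = solve-∀ ℚ-ring
    1*0*-vanish : ∀ x y → 1# * 0# * x ≡ 1# * 0# * y
    1*0*-vanish = solve-∀ ℚ-ring
    0*b*-vanish : ∀ b x y → 0# * b * x ≡ 0# * b * y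
    0*b*-vanish = solve-∀ ℚ-ring

  weighted₁ : ∀ {n} (Y : Pred n) (x y : Fin n → K) → (∀ i → Y i ≡ true → x i ≤ y i) → ∀ i → ind (Y i) * x i ≤ ind (Y i) * y i
  weighted₁ Y x y h i with Y i in Yi
  ... | true  = *-monoˡ 1# 0≤1 (h i Yi)
  ... | false = ≤-reflexive (0*-vanish (x i) (y i))

  weighted₂ : ∀ {n} (Y : Pred n) (φ : Fin n → Fin n → K) β → (∀ i k → i ≢ k → Y i ≡ true → Y k ≡ true → φ i k ≤ β) →
    ∀ i k → i ≢ k → ind (Y i) * ind (Y k) * φ i k ≤ ind (Y i) * ind (Y k) * β
  weighted₂ Y φ β h i k i≢k with Y i in Yi | Y k in Yk
  ... | true  | true  = *-monoˡ _ (*-≥0 0≤1 0≤1) (h i k i≢k Yi Yk)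
  ... | true  | false = ≤-reflexive (1*0*-vanish (φ i k) β)
  ... | false | b     = ≤-reflexive (0*b*-vanish (ind b) (φ i k) β)

  all : ∀ {n} → Pred n
  all _ = true

  module _ {n} (G : Graph n) where

    dist : Fin n → Fin n → ℕ
    dist u v = count (λ a → adj G u a xor adj G v a)

    inner : Fin n → Fin n → K
    inner u v = signed G all u ∙ signed G all v

    inner-dist : ∀ u v → inner u v ≡ ι n - two * ι (dist u v)
    inner-dist u v = trans (product G all u v) (cong (λ k → ι k - two * ι (dist u v)) (count-true n))

    inner-self : ∀ u → inner u u ≡ ι n
    inner-self u = trans (norm G all u) (cong ι (count-true n))

  -- Vertices in a cap around v, projected orthogonally to v.  The triple
  -- condition bounds the products of the projections.
  module Cap {n r} (G : Graph n) (P : Proj n r) (fR : ∀ u → Fix P (rowK G u)) (v : Fin n) (n≢0 : ι n ≢ 0#)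
    (U : Pred n) (a b : ℕ)
    (triple : ∀ i k → i ≢ k → U i ≡ true → U k ≡ true → 599 ℕ.* n ℕ.≤ 600 ℕ.* (dist G i k ℕ.+ dist G i v ℕ.+ dist G k v))
    (lower : ∀ i → U i ≡ true → a ℕ.* n ℕ.+ b ℕ.* (2 ℕ.* dist G i v) ℕ.≤ b ℕ.* n) where

    private
      N ν A B : K
      N = ι n
      ν = inverse N n≢0
      A = ι a
      B = ι b
      Nν : N * ν ≡ 1#
      Nν = *-inverseʳ N n≢0
      g : Fin n → Fin n → K
      g = inner G
      t : Fin n → K
      t i = g i v * ν

      x : Fin n → Vect n
      x i c = 1# * signed G all i c + - t i * signed G all v c

      q : Fin n → Fin n → K
      q i k = x i ∙ x k

      ∙-lin : ∀ (x y : Vect n) α β (z : Vect n) → (λ b → α * x b + β * y b) ∙ z ≡ α * (x ∙ z) + β * (y ∙ z)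
      ∙-lin x y α β z = trans (Σ-cong (λ a → identity α (x a) β (y a) (z a))) (trans (Σ-+ {n} _ _) (cong₂ _+_ (Σ-*ˡ {n} α _) (Σ-*ˡ {n} β _)))
        where
        opaque
          unfolding K
          identity : ∀ α x β y z → (α * x + β * y) * z ≡ α * (x * z) + β * (y * z)
          identity = solve-∀ ℚ-ring

      x∙ : ∀ i z → x i ∙ z ≡ 1# * (signed G all i ∙ z) + - t i * (signed G all v ∙ z)
      x∙ i z = ∙-lin (signed G all i) (signed G all v) 1# (- t i) z

      q-value : ∀ i k → N * q i k ≡ N * g i k - g i v * g k v
      q-value i k = begin
        N * q i k
          ≡⟨ cong (N *_) (x∙ i (x k)) ⟩
        N * (1# * (signed G all i ∙ x k) + - t i * (signed G all v ∙ x k))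
          ≡⟨ cong₂ (λ p q → N * (1# * p + - t i * q)) (trans (∙-comm _ (x k)) (x∙ k _)) (trans (∙-comm _ (x k)) (x∙ k _)) ⟩
        N * (1# * (1# * g k i + - t k * g v i) + - t i * (1# * g k v + - t k * g v v))
          ≡⟨ cong₂ (λ p q → N * (1# * (1# * p + - t k * q) + - t i * (1# * g k v + - t k * g v v))) (∙-comm _ (signed G all i)) (∙-comm _ (signed G all i)) ⟩
        N * (1# * (1# * g i k + - t k * g i v) + - t i * (1# * g k v + - t k * g v v))
          ≡⟨ cong (λ p → N * (1# * (1# * g i k + - t k * g i v) + - t i * (1# * g k v + - t k * p))) (inner-self G v) ⟩
        N * (1# * (1# * g i k + - (g k v * ν) * g i v) + - (g i v * ν) * (1# * g k v + - (g k v * ν) * N))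
          ≡⟨ identity₁ N ν (g i k) (g i v) (g k v) ⟩
        N * g i k + (N * ν * (N * ν) - (1# + 1#) * (N * ν)) * (g i v * g k v)
          ≡⟨ cong (λ p → N * g i k + (p * p - (1# + 1#) * p) * (g i v * g k v)) Nν ⟩
        N * g i k + (1# * 1# - (1# + 1#) * 1#) * (g i v * g k v)
          ≡⟨ identity₂ (N * g i k) (g i v * g k v) ⟩
        N * g i k - g i v * g k v ∎
        where
        open ≡-Reasoning
        opaque
          unfolding K
          identity₁ : ∀ N ν g x y → N * (1# * (1# * g + - (y * ν) * x) + - (x * ν) * (1# * y + - (y * ν) * N)) ≡
            N * g + (N * ν * (N * ν) + - ((1# + 1#) * (N * ν))) * (x * y)
          identity₁ = solve-∀ ℚ-ring
          identity₂ : ∀ a b → a + (1# * 1# + - ((1# + 1#) * 1#)) * b ≡ a + - b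
          identity₂ = solve-∀ ℚ-ring

      0≤N : 0# ≤ N
      0≤N = ι-≥0 n

      lower-K : ∀ i → U i ≡ true → A * N ≤ B * g i v
      lower-K i Ui = subst (A * N ≤_) (sym (cong (B *_) (inner-dist G i v)))
          (subst₂ _≤_ (cancel (A * N) (B * (two * ι (dist G i v)))) (distrib B N (two * ι (dist G i v)))
            (+-monoˡ-≤ (- (B * (two * ι (dist G i v)))) (subst₂ _≤_ left (ι-* b n) (ι-mono (lower i Ui)))))
        where
        opaque
          unfolding K
          cancel : ∀ x y → x + y + - y ≡ x
          cancel = solve-∀ ℚ-ring
          distrib : ∀ B N x → B * N + - (B * x) ≡ B * (N + - x)
          distrib = solve-∀ ℚ-ring
          two-ι : ι 2 ≡ two
          two-ι = refl
        left : ι (a ℕ.* n ℕ.+ b ℕ.* (2 ℕ.* dist G i v)) ≡ A * N + B * (two * ι (dist G i v))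
        left = trans (ι-+ (a ℕ.* n) (b ℕ.* (2 ℕ.* dist G i v))) (cong₂ _+_ (ι-* a n) (trans (ι-* b (2 ℕ.* dist G i v)) (cong (B *_) (trans (ι-* 2 (dist G i v)) (cong (_* ι (dist G i v)) two-ι)))))

      triple-K : ∀ i k → i ≢ k → U i ≡ true → U k ≡ true → ι 300 * (g i k + g i v + g k v) ≤ ι 301 * N
      triple-K i k i≢k Ui Uk = subst₂ _≤_ (sym (trans (cong (ι 300 *_) (cong₂ _+_ (cong₂ _+_ (inner-dist G i k) (inner-dist G i v)) (inner-dist G k v))) (identity₁ N D₁ D₂ D₃))) (identity₂ N)
          (+-monoʳ-≤ (ι 900 * N) (neg-antimono (subst₂ _≤_ (ι-* 599 n) right (ι-mono (triple i k i≢k Ui Uk)))))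
        where
        D₁ D₂ D₃ : K
        D₁ = ι (dist G i k)
        D₂ = ι (dist G i v)
        D₃ = ι (dist G k v)
        right : ι (600 ℕ.* (dist G i k ℕ.+ dist G i v ℕ.+ dist G k v)) ≡ ι 600 * (D₁ + D₂ + D₃)
        right = trans (ι-* 600 (dist G i k ℕ.+ dist G i v ℕ.+ dist G k v)) (cong (ι 600 *_) (trans (ι-+ (dist G i k ℕ.+ dist G i v) (dist G k v)) (cong (_+ D₃) (ι-+ (dist G i k) (dist G i v)))))
        neg-antimono : ∀ {x y} → x ≤ y → - y ≤ - x
        neg-antimono {x} {y} h = subst₂ _≤_ (flip₁ x y) (flip₂ x y) (+-monoˡ-≤ (- x + - y) h)
          where
          opaque
            unfolding K
            flip₁ : ∀ x y → x + (- x + - y) ≡ - y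
            flip₁ = solve-∀ ℚ-ring
            flip₂ : ∀ x y → y + (- x + - y) ≡ - x
            flip₂ = solve-∀ ℚ-ring
        opaque
          unfolding K
          ring₁ : ∀ N x y z c₉ c₃ c₆ → c₉ ≡ (1# + 1# + 1#) * c₃ → c₆ ≡ (1# + 1#) * c₃ →
            c₃ * (N + - ((1# + 1#) * x) + (N + - ((1# + 1#) * y)) + (N + - ((1# + 1#) * z))) ≡ c₉ * N + - (c₆ * (x + y + z))
          ring₁ N x y z _ c₃ _ refl refl = ring₁′ N x y z c₃
            where
            ring₁′ : ∀ N x y z c₃ → c₃ * (N + - ((1# + 1#) * x) + (N + - ((1# + 1#) * y)) + (N + - ((1# + 1#) * z))) ≡ (1# + 1# + 1#) * c₃ * N + - ((1# + 1#) * c₃ * (x + y + z))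
            ring₁′ = solve-∀ ℚ-ring
          factor : ∀ x y N → x * N + - (y * N) ≡ (x + - y) * N
          factor = solve-∀ ℚ-ring
          ι900 : ι 900 ≡ (1# + 1# + 1#) * ι 300
          ι900 = refl
          ι600 : ι 600 ≡ (1# + 1#) * ι 300
          ι600 = refl
          ι301 : ι 900 + - ι 599 ≡ ι 301
          ι301 = refl
        identity₁ : ∀ N x y z → ι 300 * (N - two * x + (N - two * y) + (N - two * z)) ≡ ι 900 * N + - (ι 600 * (x + y + z))
        identity₁ N x y z = ring₁ N x y z (ι 900) (ι 300) (ι 600) ι900 ι600
        identity₂ : ∀ N → ι 900 * N + - (ι 599 * N) ≡ ι 301 * N
        identity₂ N = trans (factor (ι 900) (ι 599) N) (cong (_* N) ι301)

      N-cancel : ∀ {y z} → N * y ≤ N * z → y ≤ z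
      N-cancel = *-cancelˡ 0≤N n≢0

      -- 300 b² times the products of the projections.
      scale : K
      scale = ι 300 * (B * B)

      -- Write x, y for the normalised products with `v`. The triple condition bounds the normalised
      -- product of the pair by 301/300 - x - y. Subtracting xy gives 601/300 - (1 + x)(1 + y), and
      -- x, y ≥ a/b.
      q-upper : ∀ i k → i ≢ k → U i ≡ true → U k ≡ true → scale * q i k ≤ (ι 601 * (B * B) - ι 300 * ((A + B) * (A + B))) * N
      q-upper i k i≢k Ui Uk = N-cancel (≤-trans (≤-reflexive (trans (rearrange N scale (q i k)) (cong (scale *_) (q-value i k))))
          (p≤q-by (+-≥0 (*-≥0 (*-≥0 (sq-≥0 B) 0≤N) (0≤q-p (triple-K i k i≢k Ui Uk)))
                     (*-≥0 (ι-≥0 300) (0≤q-p (*-mono-≥0 0≤C 0≤C (C≤ i Ui) (C≤ k Uk)))))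
            (identity′ (ι 300) (ι 301) (ι 601) ι601 A B N (g i k) (g i v) (g k v))))
        where
        C : K
        C = (A + B) * N
        0≤C : 0# ≤ C
        0≤C = *-≥0 (+-≥0 (ι-≥0 a) (ι-≥0 b)) 0≤N
        C≤ : ∀ i → U i ≡ true → C ≤ B * (N + g i v)
        C≤ i Ui = subst₂ _≤_ (distrib₁ A B N) (distrib₂ B N (g i v)) (+-monoˡ-≤ (B * N) (lower-K i Ui))
          where
          opaque
            unfolding K
            distrib₁ : ∀ A B N → A * N + B * N ≡ (A + B) * N
            distrib₁ = solve-∀ ℚ-ring
            distrib₂ : ∀ B N g → B * g + B * N ≡ B * (N + g)
            distrib₂ = solve-∀ ℚ-ring
        opaque
          unfolding K
          rearrange : ∀ a b c → a * (b * c) ≡ b * (a * c)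
          rearrange = solve-∀ ℚ-ring
          ι601 : ι 601 ≡ ι 301 + ι 300
          ι601 = refl
          identity′ : ∀ c₀ c₁ c₂ → c₂ ≡ c₁ + c₀ → ∀ A B N g x y → N * ((c₂ * (B * B) + - (c₀ * ((A + B) * (A + B)))) * N) ≡
            c₀ * (B * B) * (N * g + - (x * y)) + (B * B * N * (c₁ * N + - (c₀ * (g + x + y))) + c₀ * (B * (N + x) * (B * (N + y)) + - ((A + B) * N * ((A + B) * N))))
          identity′ c₀ c₁ _ refl = identity″ c₀ c₁
            where
            identity″ : ∀ c₀ c₁ A B N g x y → N * (((c₁ + c₀) * (B * B) + - (c₀ * ((A + B) * (A + B)))) * N) ≡
              c₀ * (B * B) * (N * g + - (x * y)) + (B * B * N * (c₁ * N + - (c₀ * (g + x + y))) + c₀ * (B * (N + x) * (B * (N + y)) + - ((A + B) * N * ((A + B) * N))))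
            identity″ = solve-∀ ℚ-ring

      q-self≤N : ∀ i → q i i ≤ N
      q-self≤N i = N-cancel (≤-trans (≤-reflexive (trans (q-value i i) (cong (λ p → N * p - g i v * g i v) (inner-self G i))))
        (p≤q-by (sq-≥0 (g i v)) (identity (N * N) (g i v * g i v))))
        where
        opaque
          unfolding K
          identity : ∀ a b → a ≡ a + - b + b
          identity = solve-∀ ℚ-ring

      w : Fin n → K
      w = ind ∘ U

      W : K
      W = ι (count U)

    module _ (b≢0 : ι b ≢ 0#) where

      private
        scale≢0 : scale ≢ 0#
        scale≢0 e = b≢0 (a*b≡0 b≢0 (a*b≡0 (ι-suc≢0 299) (trans (*-comm (B * B) (ι 300)) e)))

        0≤scale : 0# ≤ scale
        0≤scale = *-≥0 (ι-≥0 300) (sq-≥0 B)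

        -- The unit in which the integer constants below are measured: n is `scale` units. It
        -- cancels at the end, leaving an inequality between natural numbers.
        ω : K
        ω = N * inverse scale scale≢0

        N≡ : N ≡ scale * ω
        N≡ = sym (trans (rearrange scale N (inverse scale scale≢0)) (trans (cong (N *_) (*-inverseʳ scale scale≢0)) (*-identityʳ N)))
          where
          opaque
            unfolding K
            rearrange : ∀ a b c → a * (b * c) ≡ b * (a * c)
            rearrange = solve-∀ ℚ-ring

        0≤ω : 0# ≤ ω
        0≤ω = *-cancelˡ 0≤scale scale≢0 (subst₂ _≤_ (sym (*-zeroʳ scale)) N≡ 0≤N)

        ω≢0 : ω ≢ 0#
        ω≢0 e = n≢0 (trans N≡ (trans (cong (scale *_) e) (*-zeroʳ scale)))

        q≤ : ∀ E → E ≡ ι 601 * (B * B) - ι 300 * ((A + B) * (A + B)) → ∀ i k → i ≢ k → U i ≡ true → U k ≡ true → q i k ≤ E * ω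
        q≤ E eq i k i≢k Ui Uk = *-cancelˡ 0≤scale scale≢0 (≤-trans (q-upper i k i≢k Ui Uk) (≤-reflexive
          (trans (cong₂ _*_ (sym eq) N≡) (rearrange E scale ω))))
          where
          opaque
            unfolding K
            rearrange : ∀ a b c → a * (b * c) ≡ b * (a * c)
            rearrange = solve-∀ ℚ-ring

        sp : ∃ λ d → d ℕ.≤ suc r × Σ (Proj n d) λ Q → ∀ u → Fix Q (signed G all u)
        sp = signed-proj G P fR all
        Q : Proj n (proj₁ sp)
        Q = proj₁ (proj₂ (proj₂ sp))
        fx : ∀ i → Fix Q (x i)
        fx i = Fix-lin Q 1# (- t i) (proj₂ (proj₂ (proj₂ sp)) i) (proj₂ (proj₂ (proj₂ sp)) v)

        module Sm = SmallProducts x Q fx r (proj₁ (proj₂ sp)) w (λ i → ind-≥0 (U i)) (λ i → ind-idem (U i))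

        scale-ι : scale ≡ ι (300 ℕ.* (b ℕ.* b))
        scale-ι = sym (trans (ι-* 300 (b ℕ.* b)) (cong (ι 300 *_) (ι-* b b)))

        W-cancel : ∀ {c d} → count U ≢ 0 → W * c ≤ W * d → c ≤ d
        W-cancel ne = *-cancelˡ (ι-≥0 (count U)) (λ e → ne (zero-ι (count U) e))
          where
          zero-ι : ∀ k → ι k ≡ 0# → k ≡ 0
          zero-ι zero    _ = refl
          zero-ι (suc k) e with () ← ι-suc≢0 k e

        diag : ∀ i → w i * q i i ≤ w i * N
        diag = weighted₁ U (λ i → q i i) (λ _ → N) (λ i _ → q-self≤N i)

      -- The case (1 + a/b)² ≥ 601/300: the projections have pairwise products at most -e units,
      -- which bounds their number, without reference to the dimension, once `e` is positive.
      cap-negative : ∀ e → 601 ℕ.* (b ℕ.* b) ℕ.+ e ≡ 300 ℕ.* ((a ℕ.+ b) ℕ.* (a ℕ.+ b)) → count U ℕ.* e ℕ.≤ 300 ℕ.* (b ℕ.* b) ℕ.+ e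
      cap-negative e eq with count U ℕP.≟ 0
      ... | yes z = subst (λ k → k ℕ.* e ℕ.≤ 300 ℕ.* (b ℕ.* b) ℕ.+ e) (sym z) ℕ.z≤n
      ... | no nz = ι-cancel (subst₂ _≤_ (sym (ι-* (count U) e)) (sym (trans (ι-+ (300 ℕ.* (b ℕ.* b)) e) (cong (_+ ι e) (sym scale-ι))))
          (*-cancelˡ 0≤ω ω≢0 (subst₂ _≤_ (move₁ W (ι e) ω) (trans (cong (_+ ι e * ω) N≡) (move₂ scale (ι e) ω)) (W-cancel nz bound))))
        where
        opaque
          unfolding K
          move₁ : ∀ W e ω → W * (e * ω) ≡ ω * (W * e)
          move₁ = solve-∀ ℚ-ring
          move₂ : ∀ s e ω → s * ω + e * ω ≡ ω * (s + e)
          move₂ = solve-∀ ℚ-ring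
          neg-* : ∀ e ω → - e * ω ≡ - (e * ω)
          neg-* = solve-∀ ℚ-ring
          solve-e : ∀ x y e → x + e ≡ y → - e ≡ x - y
          solve-e x y e refl = solve-e′ x e
            where
            solve-e′ : ∀ x e → - e ≡ x + - (x + e)
            solve-e′ = solve-∀ ℚ-ring
        E≡ : - ι e ≡ ι 601 * (B * B) - ι 300 * ((A + B) * (A + B))
        E≡ = solve-e _ _ (ι e) (trans (cong (_+ ι e) (sym (trans (ι-* 601 (b ℕ.* b)) (cong (ι 601 *_) (ι-* b b)))))
          (trans (sym (ι-+ (601 ℕ.* (b ℕ.* b)) e)) (trans (cong ι eq) (trans (ι-* 300 ((a ℕ.+ b) ℕ.* (a ℕ.+ b)))
            (cong (ι 300 *_) (trans (ι-* (a ℕ.+ b) (a ℕ.+ b)) (cong₂ _*_ (ι-+ a b) (ι-+ a b))))))))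
        bound : W * (W * (ι e * ω)) ≤ W * (N + ι e * ω)
        bound = subst (λ z → z * (z * (ι e * ω)) ≤ z * (N + ι e * ω)) (Σ-ind U) (Sm.negative-products N (ι e * ω) diag
          (λ i k i≢k → weighted₂ U q (- (ι e * ω)) (λ i k i≢k Ui Uk → subst (q i k ≤_) (neg-* (ι e) ω) (q≤ (- ι e) E≡ i k i≢k Ui Uk)) i k i≢k))

      -- The opposite case: the products of projections are at most `e` units, and `small-products`
      -- applies because the cap is also cut off at 9/20, which keeps the projections long. `f` is N
      -- - s in units, and `c` the coefficient 3sκ² - 4s³D.
      cap-small : (∀ i → U i ≡ true → 20 ℕ.* n ℕ.≤ 9 ℕ.* n ℕ.+ 20 ℕ.* (2 ℕ.* dist G i v)) → (∀ i → U i ≡ true → 0# ≤ inner G i v) →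
        ∀ e f c → 300 ℕ.* ((a ℕ.+ b) ℕ.* (a ℕ.+ b)) ℕ.+ e ≡ 601 ℕ.* (b ℕ.* b) → e ℕ.+ f ≡ 300 ℕ.* (b ℕ.* b) →
        4 ℕ.* (e ℕ.* e ℕ.* e) ℕ.* suc r ℕ.+ c ≡ 3 ℕ.* e ℕ.* (239 ℕ.* (b ℕ.* b) ℕ.* (239 ℕ.* (b ℕ.* b))) →
        count U ℕ.* c ℕ.≤ suc r ℕ.* (f ℕ.* ((e ℕ.+ f ℕ.+ 2 ℕ.* e) ℕ.* (e ℕ.+ f ℕ.+ 2 ℕ.* e)))
      cap-small upper 0≤g e f c eq₁ eq₂ eq₃ with count U ℕP.≟ 0
      ... | yes z = subst (λ k → k ℕ.* c ℕ.≤ suc r ℕ.* (f ℕ.* ((e ℕ.+ f ℕ.+ 2 ℕ.* e) ℕ.* (e ℕ.+ f ℕ.+ 2 ℕ.* e)))) (sym z) ℕ.z≤n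
      ... | no nz = ι-cancel (subst₂ _≤_ (sym (ι-* (count U) c)) (sym rhs-ι) (*-cancelˡ 0≤ω³ ω³≢0
          (subst₂ _≤_ (trans (move₁ W (ι e) κ₀ (ι (suc r)) ω) (cong (λ z → ω * (ω * ω) * (W * z)) c≡))
            (trans (cong (λ N → ι (suc r) * ((N - s) * ((N + (1# + 1#) * s) * (N + (1# + 1#) * s)))) N≡′) (move₂ (ι (suc r)) (ι e) (ι f) ω))
            (W-cancel nz bound))))
        where
        κ₀ s : K
        -- A projection has squared length at least 1 - (9/20)² = 319/400 of n, and 300 · 319/400 =
        -- 239.25; the remainder is the constant 100 in `ι-const`.
        κ₀ = ι (239 ℕ.* (b ℕ.* b))
        s = ι e * ω
        opaque
          unfolding K
          move₁ : ∀ W e k D ω → W * ((1# + 1# + 1#) * (e * ω) * (k * ω * (k * ω)) + - ((1# + 1# + 1# + 1#) * (e * ω * (e * ω) * (e * ω)) * D)) ≡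
            ω * (ω * ω) * (W * ((1# + 1# + 1#) * e * (k * k) + - ((1# + 1# + 1# + 1#) * (e * e * e) * D)))
          move₁ = solve-∀ ℚ-ring
          move₂ : ∀ D e f ω → D * (((e + f) * ω + - (e * ω)) * (((e + f) * ω + (1# + 1#) * (e * ω)) * ((e + f) * ω + (1# + 1#) * (e * ω)))) ≡
            ω * (ω * ω) * (D * (f * ((e + f + (1# + 1#) * e) * (e + f + (1# + 1#) * e))))
          move₂ = solve-∀ ℚ-ring
          solve-e : ∀ x y e → x + e ≡ y → e ≡ y - x
          solve-e x y e refl = solve-e′ x e
            where
            solve-e′ : ∀ x e → e ≡ x + e + - x
            solve-e′ = solve-∀ ℚ-ring
          two-ι : ι 2 ≡ 1# + 1#
          two-ι = refl
          three-ι : ι 3 ≡ 1# + 1# + 1#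
          three-ι = refl
          four-ι : ι 4 ≡ 1# + 1# + 1# + 1#
          four-ι = refl
        E≡ : ι e ≡ ι 601 * (B * B) - ι 300 * ((A + B) * (A + B))
        E≡ = solve-e _ _ (ι e) (trans (cong (_+ ι e) (sym (trans (ι-* 300 ((a ℕ.+ b) ℕ.* (a ℕ.+ b))) (cong (ι 300 *_) (trans (ι-* (a ℕ.+ b) (a ℕ.+ b)) (cong₂ _*_ (ι-+ a b) (ι-+ a b)))))))
          (trans (sym (ι-+ (300 ℕ.* ((a ℕ.+ b) ℕ.* (a ℕ.+ b))) e)) (trans (cong ι eq₁) (trans (ι-* 601 (b ℕ.* b)) (cong (ι 601 *_) (ι-* b b))))))
        ef≡ : ι e + ι f ≡ scale
        ef≡ = trans (sym (ι-+ e f)) (trans (cong ι eq₂) (sym scale-ι))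
        N≡′ : N ≡ (ι e + ι f) * ω
        N≡′ = trans N≡ (cong (_* ω) (sym ef≡))
        c≡ : (1# + 1# + 1#) * ι e * (κ₀ * κ₀) - (1# + 1# + 1# + 1#) * (ι e * ι e * ι e) * ι (suc r) ≡ ι c
        c≡ = sym (solve-e _ _ (ι c) (trans (cong (_+ ι c) (sym left)) (trans (sym (ι-+ (4 ℕ.* (e ℕ.* e ℕ.* e) ℕ.* suc r) c)) (trans (cong ι eq₃) right))))
          where
          left : ι (4 ℕ.* (e ℕ.* e ℕ.* e) ℕ.* suc r) ≡ (1# + 1# + 1# + 1#) * (ι e * ι e * ι e) * ι (suc r)
          left = trans (ι-* (4 ℕ.* (e ℕ.* e ℕ.* e)) (suc r)) (cong (_* ι (suc r)) (trans (ι-* 4 (e ℕ.* e ℕ.* e)) (cong₂ _*_ four-ι (trans (ι-* (e ℕ.* e) e) (cong (_* ι e) (ι-* e e))))))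
          right : ι (3 ℕ.* e ℕ.* (239 ℕ.* (b ℕ.* b) ℕ.* (239 ℕ.* (b ℕ.* b)))) ≡ (1# + 1# + 1#) * ι e * (κ₀ * κ₀)
          right = trans (ι-* (3 ℕ.* e) (239 ℕ.* (b ℕ.* b) ℕ.* (239 ℕ.* (b ℕ.* b)))) (cong₂ _*_ (trans (ι-* 3 e) (cong (_* ι e) three-ι)) (ι-* (239 ℕ.* (b ℕ.* b)) (239 ℕ.* (b ℕ.* b))))
        rhs-ι : ι (suc r ℕ.* (f ℕ.* ((e ℕ.+ f ℕ.+ 2 ℕ.* e) ℕ.* (e ℕ.+ f ℕ.+ 2 ℕ.* e)))) ≡ ι (suc r) * (ι f * ((ι e + ι f + (1# + 1#) * ι e) * (ι e + ι f + (1# + 1#) * ι e)))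
        rhs-ι = trans (ι-* (suc r) (f ℕ.* ((e ℕ.+ f ℕ.+ 2 ℕ.* e) ℕ.* (e ℕ.+ f ℕ.+ 2 ℕ.* e)))) (cong (ι (suc r) *_) (trans (ι-* f ((e ℕ.+ f ℕ.+ 2 ℕ.* e) ℕ.* (e ℕ.+ f ℕ.+ 2 ℕ.* e))) (cong (ι f *_) (trans (ι-* (e ℕ.+ f ℕ.+ 2 ℕ.* e) (e ℕ.+ f ℕ.+ 2 ℕ.* e)) (cong₂ _*_ inside inside)))))
          where
          inside : ι (e ℕ.+ f ℕ.+ 2 ℕ.* e) ≡ ι e + ι f + (1# + 1#) * ι e
          inside = trans (ι-+ (e ℕ.+ f) (2 ℕ.* e)) (cong₂ _+_ (ι-+ e f) (trans (ι-* 2 e) (cong (_* ι e) two-ι)))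
        0≤ω³ : 0# ≤ ω * (ω * ω)
        0≤ω³ = *-≥0 0≤ω (sq-≥0 ω)
        ω³≢0 : ω * (ω * ω) ≢ 0#
        ω³≢0 h = ω≢0 (a*b≡0 (λ h′ → ω≢0 (a*b≡0 ω≢0 h′)) h)
        0≤s : 0# ≤ s
        0≤s = *-≥0 (ι-≥0 e) 0≤ω
        s≤N : s ≤ N
        s≤N = p≤q-by (*-≥0 (ι-≥0 f) 0≤ω) (trans N≡′ (distrib (ι e) (ι f) ω))
          where
          opaque
            unfolding K
            distrib : ∀ e f ω → (e + f) * ω ≡ e * ω + f * ω
            distrib = solve-∀ ℚ-ring
        upper-K : ∀ i → U i ≡ true → ι 20 * g i v ≤ ι 9 * N
        upper-K i Ui = subst₂ _≤_ (trans (distrib (ι 20) N (two * ι (dist G i v))) (sym (cong (ι 20 *_) (inner-dist G i v)))) (cancel (ι 9 * N) (ι 20 * (two * ι (dist G i v))))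
            (+-monoˡ-≤ (- (ι 20 * (two * ι (dist G i v)))) (subst₂ _≤_ (ι-* 20 n) right (ι-mono (upper i Ui))))
          where
          opaque
            unfolding K
            cancel : ∀ x y → x + y + - y ≡ x
            cancel = solve-∀ ℚ-ring
            distrib : ∀ B N x → B * N + - (B * x) ≡ B * (N + - x)
            distrib = solve-∀ ℚ-ring
          right : ι (9 ℕ.* n ℕ.+ 20 ℕ.* (2 ℕ.* dist G i v)) ≡ ι 9 * N + ι 20 * (two * ι (dist G i v))
          right = trans (ι-+ (9 ℕ.* n) (20 ℕ.* (2 ℕ.* dist G i v))) (cong₂ _+_ (ι-* 9 n) (trans (ι-* 20 (2 ℕ.* dist G i v)) (cong (ι 20 *_) (trans (ι-* 2 (dist G i v)) (cong (_* ι (dist G i v)) two-ι)))))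
        κ≤q : ∀ i → U i ≡ true → κ₀ * ω ≤ q i i
        κ≤q i Ui = *-cancelˡ (ι-≥0 400) (ι-suc≢0 399) (≤-trans κ-bound (N-cancel (≤-trans (p≤q-by
            (0≤q-p (*-mono-≥0 (*-≥0 (ι-≥0 20) (0≤g i Ui)) (*-≥0 (ι-≥0 20) (0≤g i Ui)) (upper-K i Ui) (upper-K i Ui)))
            (identity (ι 9) (ι 20) (ι 319) (ι 400) ι400 ι319 N (g i v)))
          (≤-reflexive (trans (cong (ι 400 *_) (sym (trans (q-value i i) (cong (λ p → N * p - g i v * g i v) (inner-self G i))))) (rearrange (ι 400) N (q i i)))))))
          where
          opaque
            unfolding K
            ι400 : ι 400 ≡ ι 20 * ι 20
            ι400 = refl
            ι319 : ι 319 ≡ ι 400 + - (ι 9 * ι 9)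
            ι319 = refl
            ι-const : ι 319 * ι 300 ≡ ι 400 * ι 239 + ι 100
            ι-const = refl
            identity : ∀ c₉ c₂₀ c₃ c₄ → c₄ ≡ c₂₀ * c₂₀ → c₃ ≡ c₄ + - (c₉ * c₉) → ∀ N x →
              c₄ * (N * N + - (x * x)) ≡ N * (c₃ * N) + (c₉ * N * (c₉ * N) + - (c₂₀ * x * (c₂₀ * x)))
            identity c₉ c₂₀ _ _ refl refl = identity′ c₉ c₂₀
              where
              identity′ : ∀ c₉ c₂₀ N x → c₂₀ * c₂₀ * (N * N + - (x * x)) ≡ N * ((c₂₀ * c₂₀ + - (c₉ * c₉)) * N) + (c₉ * N * (c₉ * N) + - (c₂₀ * x * (c₂₀ * x)))
              identity′ = solve-∀ ℚ-ring
            rearrange : ∀ a b c → a * (b * c) ≡ b * (a * c)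
            rearrange = solve-∀ ℚ-ring
            spread : ∀ c₃₁₉ c₃₀₀ c₄₀₀ c₂₃₉ c₁₀₀ → c₃₁₉ * c₃₀₀ ≡ c₄₀₀ * c₂₃₉ + c₁₀₀ → ∀ B² ω →
              c₃₁₉ * (c₃₀₀ * B² * ω) ≡ c₄₀₀ * (c₂₃₉ * B² * ω) + c₁₀₀ * B² * ω
            spread c₃₁₉ c₃₀₀ c₄₀₀ c₂₃₉ c₁₀₀ h B² ω = trans (s₁ c₃₁₉ c₃₀₀ B² ω) (trans (cong (λ z → z * (B² * ω)) h) (s₂ c₄₀₀ c₂₃₉ c₁₀₀ B² ω))
              where
              s₁ : ∀ a b c d → a * (b * c * d) ≡ a * b * (c * d)
              s₁ = solve-∀ ℚ-ring
              s₂ : ∀ a b e c d → (a * b + e) * (c * d) ≡ a * (b * c * d) + e * c * d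
              s₂ = solve-∀ ℚ-ring
          κ₀-ι : κ₀ ≡ ι 239 * (B * B)
          κ₀-ι = trans (ι-* 239 (b ℕ.* b)) (cong (ι 239 *_) (ι-* b b))
          κ-bound : ι 400 * (κ₀ * ω) ≤ ι 319 * N
          κ-bound = p≤q-by (*-≥0 (*-≥0 (ι-≥0 100) (sq-≥0 B)) 0≤ω) (trans (cong (ι 319 *_) N≡) (trans (spread (ι 319) (ι 300) (ι 400) (ι 239) (ι 100) ι-const (B * B) ω)
            (cong (λ z → ι 400 * (z * ω) + ι 100 * (B * B) * ω) (sym κ₀-ι))))
        bound : W * (W * ((1# + 1# + 1#) * s * (κ₀ * ω * (κ₀ * ω)) - (1# + 1# + 1# + 1#) * (s * s * s) * ι (suc r)))
          ≤ W * (ι (suc r) * ((N - s) * ((N + (1# + 1#) * s) * (N + (1# + 1#) * s))))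
        bound = subst (λ z → z * (z * ((1# + 1# + 1#) * s * (κ₀ * ω * (κ₀ * ω)) - (1# + 1# + 1# + 1#) * (s * s * s) * ι (suc r)))
            ≤ z * (ι (suc r) * ((N - s) * ((N + (1# + 1#) * s) * (N + (1# + 1#) * s))))) (Σ-ind U)
          (Sm.small-products N (κ₀ * ω) s (*-≥0 (ι-≥0 (239 ℕ.* (b ℕ.* b))) 0≤ω) 0≤s s≤N
            (weighted₁ U (λ _ → κ₀ * ω) (λ i → q i i) κ≤q) diag (λ i → Σ-≥0 (λ c → sq-≥0 (x i c)))
            (weighted₂ U q s (q≤ (ι e) E≡)))

-- The linear programming inequality for the ±1 rows.

module LP where

  open RatSum
  open LinAlg
  open Gram
  open Spherical
  open Count
  open GraphRank
  open Bounds using (_is_; is-false)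
  open Signed using (signed; signed-proj; two)
  open Caps
  open import Data.Nat as ℕ using (ℕ; zero; suc)
  import Data.Nat.Properties as ℕP
  open import Data.Fin using (Fin; zero; suc)
  import Data.Fin.Properties as FinP
  open import Data.Bool using (true; false; not; _∧_; T)
  open import Data.Product using (Σ; ∃; _×_; proj₁; proj₂)
  open import Data.Unit using (tt)
  open import Relation.Nullary using (Dec; yes; no)
  open import Relation.Nullary.Negation using (contradiction)
  open import Relation.Binary.PropositionalEquality
  open import Tactic.RingSolver using (solve-∀)

  Kronecker-refl : ∀ {n} (u : Fin n) → Kronecker u u ≡ 1#
  Kronecker-refl u with u FinP.≟ u
  ... | yes _ = refl
  ... | no h  = contradiction refl h

  Kronecker-≢ : ∀ {n} {u v : Fin n} → u ≢ v → Kronecker u v ≡ 0#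
  Kronecker-≢ {u = u} {v} h with u FinP.≟ v
  ... | yes e = contradiction e h
  ... | no _  = refl

  <ᵇ-true : ∀ a b → (a ℕ.<ᵇ b) ≡ true → a ℕ.< b
  <ᵇ-true a b h = ℕP.<ᵇ⇒< a b (subst T (sym h) tt)

  <ᵇ-false : ∀ a b → (a ℕ.<ᵇ b) ≡ false → b ℕ.≤ a
  <ᵇ-false a b h = ℕP.≮⇒≥ (λ a<b → subst T h (ℕP.<⇒<ᵇ a<b))

  ≤ᵇ-true : ∀ a b → (a ℕ.≤ᵇ b) ≡ true → a ℕ.≤ b
  ≤ᵇ-true a b h = ℕP.≤ᵇ⇒≤ a b (subst T (sym h) tt)

  ≤ᵇ-false : ∀ a b → (a ℕ.≤ᵇ b) ≡ false → b ℕ.< a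
  ≤ᵇ-false a b h = ℕP.≰⇒> (λ a≤b → subst T h (ℕP.≤⇒≤ᵇ a≤b))

  ι-^ : ∀ a k → ι (a ℕ.^ k) ≡ ι a ^ k
  ι-^ a zero    = +-identityʳ 1#
  ι-^ a (suc k) = trans (ι-* a (a ℕ.^ k)) (cong (ι a *_) (ι-^ a k))

  ι-∸ : ∀ {a b} → b ℕ.≤ a → ι (a ℕ.∸ b) ≡ ι a - ι b
  ι-∸ {a} {b} b≤a = trans (identity (ι (a ℕ.∸ b)) (ι b)) (cong (_- ι b) (trans (sym (ι-+ (a ℕ.∸ b) b)) (cong ι (ℕP.m∸n+n≡m b≤a))))
    where
    opaque
      unfolding K
      identity : ∀ x y → x ≡ x + y + - y
      identity = solve-∀ ℚ-ring

  -- 20^(2k+3) times the value of the test polynomial at t = c/20, times q³.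
  height : (k p q c : ℕ) → ℕ
  height k p q c = c ℕ.^ double k ℕ.* ((c ℕ.* q ℕ.∸ 20 ℕ.* p) ℕ.* ((c ℕ.* q ℕ.+ 20 ℕ.* p) ℕ.* (c ℕ.* q ℕ.+ 20 ℕ.* p)))

  module _ {n} (G : Graph n) (p q : ℕ) where

    -- As ⟨u,v⟩ = n - 2 `dist`, this says that the normalised product t exceeds s = p/q. `outer` and
    -- `nearby` divide the range at t = 9/20, since the two caps are bounded by different arguments.
    close : Fin n → Pred n
    close u v = not (u is v) ∧ (p ℕ.* n ℕ.+ q ℕ.* (2 ℕ.* dist G u v) ℕ.<ᵇ q ℕ.* n)

    outer : Fin n → Pred n
    outer u v = close u v ∧ (20 ℕ.* n ℕ.≤ᵇ 9 ℕ.* n ℕ.+ 20 ℕ.* (2 ℕ.* dist G u v))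

    nearby : Fin n → Pred n
    nearby u v = close u v ∧ not (20 ℕ.* n ℕ.≤ᵇ 9 ℕ.* n ℕ.+ 20 ℕ.* (2 ℕ.* dist G u v))

  module LinearProgram {n r} (G : Graph n) (P : Proj n r) (fR : ∀ u → Fix P (rowK G u)) (n≢0 : ι n ≢ 0#)
    (k p q e L₁ L₂ : ℕ) (p≤q : p ℕ.≤ q) (20p≤9q : 20 ℕ.* p ℕ.≤ 9 ℕ.* q)
    (gap : p ℕ.* p ℕ.* (suc r ℕ.+ double k) ℕ.+ e ≡ q ℕ.* q ℕ.* suc (double k))
    (separated : ∀ u v → u ≢ v → 20 ℕ.* n ℕ.≤ 12 ℕ.* n ℕ.+ 20 ℕ.* (2 ℕ.* dist G u v))
    (few-outer : ∀ u → count (outer G p q u) ℕ.≤ L₁) (few-nearby : ∀ u → count (nearby G p q u) ℕ.≤ L₂) where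

    private
      N p′ q′ c₂₀ : K
      N = ι n
      p′ = ι p
      q′ = ι q
      c₂₀ = ι 20
      0≤N : 0# ≤ N
      0≤N = ι-≥0 n

      sp : ∃ λ d → d ℕ.≤ suc r × Σ (Proj n d) λ Q → ∀ u → Fix Q (signed G all u)
      sp = signed-proj G P fR all

      one : Fin n → K
      one _ = 1#

      module Mo = Moments (signed G all) (proj₁ (proj₂ (proj₂ sp))) (proj₂ (proj₂ (proj₂ sp))) r (proj₁ (proj₂ sp)) one

      g : Fin n → Fin n → K
      g = inner G

      F : K → K
      F = Mo.F N (inner-self G) k p′ q′

      h : ℕ → K
      h c = ι (height k p q c)

      M : K
      M = N ^ double k * (N * (N * N))

      0≤M : 0# ≤ M
      0≤M = *-≥0 (^-≥0 (double k) 0≤N) (*-≥0 0≤N (sq-≥0 N))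

      power₂₀ : K
      power₂₀ = c₂₀ ^ double k * (c₂₀ * (c₂₀ * c₂₀))

      0≤power₂₀ : 0# ≤ power₂₀
      0≤power₂₀ = *-≥0 (^-≥0 (double k) (ι-≥0 20)) (*-≥0 (ι-≥0 20) (sq-≥0 c₂₀))

      F-scaled : ∀ x → power₂₀ * F x ≡ (c₂₀ * x) ^ double k * ((q′ * (c₂₀ * x) - c₂₀ * p′ * N) * ((q′ * (c₂₀ * x) + c₂₀ * p′ * N) * (q′ * (c₂₀ * x) + c₂₀ * p′ * N)))
      F-scaled x = trans (identity c₂₀ (c₂₀ ^ double k) x (x ^ double k) q′ p′ N) (cong (_* ((q′ * (c₂₀ * x) - c₂₀ * p′ * N) * ((q′ * (c₂₀ * x) + c₂₀ * p′ * N) * (q′ * (c₂₀ * x) + c₂₀ * p′ * N)))) (sym (*-^ c₂₀ x (double k))))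
        where
        opaque
          unfolding K
          identity : ∀ c C x X q p N → C * (c * (c * c)) * (X * ((q * x + - (p * N)) * ((q * x + p * N) * (q * x + p * N)))) ≡
            C * X * ((q * (c * x) + - (c * p * N)) * ((q * (c * x) + c * p * N) * (q * (c * x) + c * p * N)))
          identity = solve-∀ ℚ-ring

      h-value : ∀ c → 20 ℕ.* p ℕ.≤ c ℕ.* q → h c ≡ ι c ^ double k * ((ι c * q′ - c₂₀ * p′) * ((ι c * q′ + c₂₀ * p′) * (ι c * q′ + c₂₀ * p′)))
      h-value c le = trans (ι-* (c ℕ.^ double k) _) (cong₂ _*_ (ι-^ c (double k)) (trans (ι-* (c ℕ.* q ℕ.∸ 20 ℕ.* p) _) (cong₂ _*_
          (trans (ι-∸ le) (cong₂ _-_ (ι-* c q) (ι-* 20 p))) (trans (ι-* (c ℕ.* q ℕ.+ 20 ℕ.* p) _) (cong₂ _*_ plus plus)))))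
        where
        plus : ι (c ℕ.* q ℕ.+ 20 ℕ.* p) ≡ ι c * q′ + c₂₀ * p′
        plus = trans (ι-+ (c ℕ.* q) (20 ℕ.* p)) (cong₂ _+_ (ι-* c q) (ι-* 20 p))

      F-upper : ∀ c x → 20 ℕ.* p ℕ.≤ c ℕ.* q → p′ * N ≤ q′ * x → 0# ≤ x → c₂₀ * x ≤ ι c * N → power₂₀ * F x ≤ M * h c
      F-upper c x le close 0≤x y≤ = ≤-trans (≤-reflexive (F-scaled x)) (≤-trans
          (*-mono-≥0 (^-≥0 (double k) 0≤y) (*-≥0 0≤minus (sq-≥0 _)) (≤-trans (^-mono (double k) 0≤y y≤) (≤-reflexive (*-^ (ι c) N (double k))))
            (*-mono-≥0 0≤minus (sq-≥0 _) minus≤ (*-mono-≥0 0≤plus 0≤plus plus≤ plus≤)))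
          (≤-reflexive (trans (identity (ι c ^ double k) (N ^ double k) (ι c * q′) (c₂₀ * p′) N) (cong (M *_) (sym (h-value c le))))))
        where
        y : K
        y = c₂₀ * x
        0≤y : 0# ≤ y
        0≤y = *-≥0 (ι-≥0 20) 0≤x
        opaque
          unfolding K
          identity : ∀ C M a b N → C * M * ((a + - b) * N * ((a + b) * N * ((a + b) * N))) ≡ M * (N * (N * N)) * (C * ((a + - b) * ((a + b) * (a + b))))
          identity = solve-∀ ℚ-ring
          distrib₋ : ∀ q c N b → q * (c * N) + - (b * N) ≡ (c * q + - b) * N
          distrib₋ = solve-∀ ℚ-ring
          distrib₊ : ∀ q c N b → q * (c * N) + b * N ≡ (c * q + b) * N
          distrib₊ = solve-∀ ℚ-ring
          shuffle : ∀ q c x p N → q * (c * x) + - (c * p * N) ≡ c * (q * x + - (p * N))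
          shuffle = solve-∀ ℚ-ring
        0≤minus : 0# ≤ q′ * y - c₂₀ * p′ * N
        0≤minus = subst (0# ≤_) (sym (shuffle q′ c₂₀ x p′ N)) (*-≥0 (ι-≥0 20) (0≤q-p close))
        minus≤ : q′ * y - c₂₀ * p′ * N ≤ (ι c * q′ - c₂₀ * p′) * N
        minus≤ = subst (q′ * y - c₂₀ * p′ * N ≤_) (distrib₋ q′ (ι c) N (c₂₀ * p′)) (+-monoˡ-≤ _ (*-monoˡ q′ (ι-≥0 q) y≤))
        0≤plus : 0# ≤ q′ * y + c₂₀ * p′ * N
        0≤plus = +-≥0 (*-≥0 (ι-≥0 q) 0≤y) (*-≥0 (*-≥0 (ι-≥0 20) (ι-≥0 p)) 0≤N)
        plus≤ : q′ * y + c₂₀ * p′ * N ≤ (ι c * q′ + c₂₀ * p′) * N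
        plus≤ = subst (q′ * y + c₂₀ * p′ * N ≤_) (distrib₊ q′ (ι c) N (c₂₀ * p′)) (+-monoˡ-≤ _ (*-monoˡ q′ (ι-≥0 q) y≤))

      F-negative : ∀ x → q′ * x ≤ p′ * N → power₂₀ * F x ≤ 0#
      F-negative x le = ≤-trans (*-monoˡ power₂₀ 0≤power₂₀ (≤-trans (*-monoˡ (x ^ double k) (even-^-≥0 x k)
          (a*b≤0 (≤-trans (+-monoˡ-≤ (- (p′ * N)) le) (≤-reflexive (cancel (p′ * N)))) (sq-≥0 _))) (≤-reflexive (*-zeroʳ (x ^ double k)))))
        (≤-reflexive (*-zeroʳ power₂₀))
        where
        opaque
          unfolding K
          cancel : ∀ a → a + - a ≡ 0#
          cancel = solve-∀ ℚ-ring

      two-ι : ι 2 ≡ two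
      two-ι = cong (1# +_) (+-identityʳ 1#)

      2d : ∀ c u v → ι (c ℕ.* (2 ℕ.* dist G u v)) ≡ ι c * (two * ι (dist G u v))
      2d c u v = trans (ι-* c (2 ℕ.* dist G u v)) (cong (ι c *_) (trans (ι-* 2 (dist G u v)) (cong (_* ι (dist G u v)) two-ι)))

      from-upper : ∀ a c u v → c ℕ.* n ℕ.≤ a ℕ.* n ℕ.+ c ℕ.* (2 ℕ.* dist G u v) → ι c * g u v ≤ ι a * N
      from-upper a c u v le = subst₂ _≤_ (trans (distrib (ι c) N (two * ι (dist G u v))) (sym (cong (ι c *_) (inner-dist G u v)))) (cancel (ι a * N) (ι c * (two * ι (dist G u v))))
          (+-monoˡ-≤ (- (ι c * (two * ι (dist G u v)))) (subst₂ _≤_ (ι-* c n) (trans (ι-+ (a ℕ.* n) _) (cong₂ _+_ (ι-* a n) (2d c u v))) (ι-mono le)))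
        where
        opaque
          unfolding K
          cancel : ∀ x y → x + y + - y ≡ x
          cancel = solve-∀ ℚ-ring
          distrib : ∀ B N x → B * N + - (B * x) ≡ B * (N + - x)
          distrib = solve-∀ ℚ-ring

      from-lower : ∀ a c u v → a ℕ.* n ℕ.+ c ℕ.* (2 ℕ.* dist G u v) ℕ.≤ c ℕ.* n → ι a * N ≤ ι c * g u v
      from-lower a c u v le = subst₂ _≤_ (cancel (ι a * N) (ι c * (two * ι (dist G u v)))) (trans (distrib (ι c) N (two * ι (dist G u v))) (sym (cong (ι c *_) (inner-dist G u v))))
          (+-monoˡ-≤ (- (ι c * (two * ι (dist G u v)))) (subst₂ _≤_ (trans (ι-+ (a ℕ.* n) _) (cong₂ _+_ (ι-* a n) (2d c u v))) (ι-* c n) (ι-mono le)))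
        where
        opaque
          unfolding K
          cancel : ∀ x y → x + y + - y ≡ x
          cancel = solve-∀ ℚ-ring
          distrib : ∀ B N x → B * N + - (B * x) ≡ B * (N + - x)
          distrib = solve-∀ ℚ-ring

      20p≤12q : 20 ℕ.* p ℕ.≤ 12 ℕ.* q
      20p≤12q = ℕP.≤-trans 20p≤9q (ℕP.*-monoˡ-≤ q {9} {12} (ℕP.m≤m+n 9 3))

      bound : Fin n → Fin n → K
      bound u v = Kronecker u v * h 20 + ind (outer G p q u v) * h 9 + ind (nearby G p q u v) * h 12

      opaque
        unfolding K
        pick₁ : ∀ a b c → 0# * a + 1# * b + 0# * c ≡ b
        pick₁ = solve-∀ ℚ-ring
        pick₂ : ∀ a b c → 0# * a + 0# * b + 1# * c ≡ c
        pick₂ = solve-∀ ℚ-ring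
        pick₀ : ∀ a b c → 0# * a + 0# * b + 0# * c ≡ 0#
        pick₀ = solve-∀ ℚ-ring

      -- Up to p/q the polynomial is nonpositive; the outer range ends at 9/20; the nearby range
      -- ends at 12/20 by the separation of all pairs.
      off-diagonal : ∀ u v → u ≢ v → power₂₀ * F (g u v) ≤ M * (0# * h 20 + ind (outer G p q u v) * h 9 + ind (nearby G p q u v) * h 12)
      off-diagonal u v u≢v rewrite is-false u v u≢v with p ℕ.* n ℕ.+ q ℕ.* (2 ℕ.* dist G u v) ℕ.<ᵇ q ℕ.* n in eq₁
      ... | false = subst (power₂₀ * F (g u v) ≤_) (sym (trans (cong (M *_) (pick₀ (h 20) (h 9) (h 12))) (*-zeroʳ M))) (F-negative (g u v) (from-upper p q u v (<ᵇ-false _ _ eq₁)))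
      ... | true with 20 ℕ.* n ℕ.≤ᵇ 9 ℕ.* n ℕ.+ 20 ℕ.* (2 ℕ.* dist G u v) in eq₂
      ... | true  = subst (λ z → power₂₀ * F (g u v) ≤ M * z) (sym (pick₁ (h 20) (h 9) (h 12)))
              (F-upper 9 (g u v) 20p≤9q low (nonneg low) (from-upper 9 20 u v (≤ᵇ-true _ _ eq₂)))
        where
        low : p′ * N ≤ q′ * g u v
        low = from-lower p q u v (ℕP.<⇒≤ (<ᵇ-true _ _ eq₁))
        nonneg : p′ * N ≤ q′ * g u v → 0# ≤ g u v
        nonneg le = *-cancelˡ (ι-≥0 q) q≢0 (subst (_≤ q′ * g u v) (sym (*-zeroʳ q′)) (≤-trans (*-≥0 (ι-≥0 p) 0≤N) le))
          where
          q≢0 : q′ ≢ 0#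
          q≢0 = positive q (<ᵇ-true _ _ eq₁)
            where
            positive : ∀ q → p ℕ.* n ℕ.+ q ℕ.* (2 ℕ.* dist G u v) ℕ.< q ℕ.* n → ι q ≢ 0#
            positive (suc q) _ = ι-suc≢0 q
      ... | false = subst (λ z → power₂₀ * F (g u v) ≤ M * z) (sym (pick₂ (h 20) (h 9) (h 12)))
              (F-upper 12 (g u v) 20p≤12q low (nonneg low) (from-upper 12 20 u v (separated u v u≢v)))
        where
        low : p′ * N ≤ q′ * g u v
        low = from-lower p q u v (ℕP.<⇒≤ (<ᵇ-true _ _ eq₁))
        nonneg : p′ * N ≤ q′ * g u v → 0# ≤ g u v
        nonneg le = *-cancelˡ (ι-≥0 q) q≢0 (subst (_≤ q′ * g u v) (sym (*-zeroʳ q′)) (≤-trans (*-≥0 (ι-≥0 p) 0≤N) le))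
          where
          q≢0 : q′ ≢ 0#
          q≢0 = positive q (<ᵇ-true _ _ eq₁)
            where
            positive : ∀ q → p ℕ.* n ℕ.+ q ℕ.* (2 ℕ.* dist G u v) ℕ.< q ℕ.* n → ι q ≢ 0#
            positive (suc q) _ = ι-suc≢0 q

      on-diagonal : ∀ u → power₂₀ * F (g u u) ≤ M * h 20
      on-diagonal u = F-upper 20 (g u u) (ℕP.*-monoʳ-≤ 20 p≤q) (subst (λ z → p′ * N ≤ q′ * z) (sym (inner-self G u)) (*-monoʳ N 0≤N (ι-mono p≤q)))
        (subst (0# ≤_) (sym (inner-self G u)) 0≤N) (≤-reflexive (cong (c₂₀ *_) (inner-self G u)))

      pointwise : ∀ u v → power₂₀ * F (g u v) ≤ M * bound u v
      pointwise u v = by-case (u FinP.≟ v)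
        where
        rest : K → K
        rest z = z * h 20 + ind (outer G p q u v) * h 9 + ind (nearby G p q u v) * h 12
        by-case : Dec (u ≡ v) → power₂₀ * F (g u v) ≤ M * bound u v
        by-case (no u≢v) = subst (λ z → power₂₀ * F (g u v) ≤ M * rest z) (sym (Kronecker-≢ u≢v)) (off-diagonal u v u≢v)
        by-case (yes refl) = ≤-trans (on-diagonal u) (*-monoˡ M 0≤M (p≤q-by
          (+-≥0 (*-≥0 (ind-≥0 (outer G p q u u)) (ι-≥0 (height k p q 9))) (*-≥0 (ind-≥0 (nearby G p q u u)) (ι-≥0 (height k p q 12))))
          (trans (cong rest (Kronecker-refl u)) (trans (cong (λ z → z + ind (outer G p q u u) * h 9 + ind (nearby G p q u u) * h 12) (*-identityˡ (h 20))) (+-assoc _ _ _)))))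

      R : K
      R = h 20 + ι L₁ * h 9 + ι L₂ * h 12

      row-bound : ∀ u → Σ[ n ] (λ v → bound u v) ≤ R
      row-bound u = ≤-trans (≤-reflexive (trans (Σ-+ {n} _ _) (cong₂ _+_ (trans (Σ-+ {n} _ _) (cong₂ _+_ (Σ-Kronecker u (λ _ → h 20)) (trans (Σ-*ʳ {n} _ (h 9)) (cong (_* h 9) (Σ-ind (outer G p q u))))))
          (trans (Σ-*ʳ {n} _ (h 12)) (cong (_* h 12) (Σ-ind (nearby G p q u)))))))
        (+-mono-≤ (+-monoʳ-≤ (h 20) (*-monoʳ (h 9) (ι-≥0 (height k p q 9)) (ι-mono (few-outer u)))) (*-monoʳ (h 12) (ι-≥0 (height k p q 12)) (ι-mono (few-nearby u))))

      upper : power₂₀ * ΣΣ n (λ u v → 1# * 1# * F (g u v)) ≤ M * (N * R)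
      upper = ≤-trans (≤-reflexive (trans (sym (ΣΣ-*ˡ {n} power₂₀ _)) (ΣΣ-cong (λ u v → cong (power₂₀ *_) (ones (F (g u v)))))))
        (≤-trans (ΣΣ-≤ pointwise) (≤-trans (≤-reflexive (ΣΣ-*ˡ {n} M bound)) (*-monoˡ M 0≤M (≤-trans (Σ-≤ row-bound) (≤-reflexive (Σ-const n R))))))
        where
        opaque
          unfolding K
          ones : ∀ x → 1# * 1# * x ≡ x
          ones = solve-∀ ℚ-ring

      S₀ : Mo.S one 0 ≡ N * N
      S₀ = trans (ΣΣ-cong {n} (λ u v → ones)) (trans (Σ-cong {n} (λ u → Σ-const n 1#)) (trans (Σ-const n (N * 1#)) (cong (N *_) (*-identityʳ N))))
        where
        opaque
          unfolding K
          ones : 1# * 1# * 1# ≡ 1#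
          ones = refl

      Rι : ι (height k p q 20 ℕ.+ L₁ ℕ.* height k p q 9 ℕ.+ L₂ ℕ.* height k p q 12) ≡ R
      Rι = trans (ι-+ (height k p q 20 ℕ.+ L₁ ℕ.* height k p q 9) _) (cong₂ _+_ (trans (ι-+ (height k p q 20) _) (cong (h 20 +_) (ι-* L₁ _))) (ι-* L₂ _))

      T⁺ : ℕ
      T⁺ = suc r ℕ.+ double k

      main : power₂₀ * (p′ * (N * (N * N)) * ι e * (ι (odds k) * N ^ double k * (N * N))) ≤ ι (rising (suc r) k) * (ι T⁺ * (M * (N * R)))
      main = ≤-trans (*-monoˡ power₂₀ 0≤power₂₀ (subst (λ z → p′ * (N * (N * N)) * ι e * (ι (odds k) * N ^ double k * z) ≤ ι (rising (suc r) k) * (ι T⁺ * ΣΣ n (λ u v → 1# * 1# * F (g u v)))) S₀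
          (Mo.test-polynomial-bound N (inner-self G) k p′ q′ (ι e) (ι-≥0 p) (ι-≥0 q) 0≤N (ι-≥0 e) (ι-mono p≤q) gap-K)))
        (≤-trans (≤-reflexive (shuffle power₂₀ (ι (rising (suc r) k)) (ι T⁺) (ΣΣ n (λ u v → 1# * 1# * F (g u v))))) (*-monoˡ _ (ι-≥0 (rising (suc r) k)) (*-monoˡ _ (ι-≥0 T⁺) upper)))
        where
        opaque
          unfolding K
          shuffle : ∀ c a b x → c * (a * (b * x)) ≡ a * (b * (c * x))
          shuffle = solve-∀ ℚ-ring
        gap-K : q′ * q′ * ι (suc (double k)) ≡ p′ * p′ * ι T⁺ + ι e
        gap-K = trans (sym (trans (ι-* (q ℕ.* q) (suc (double k))) (cong (_* ι (suc (double k))) (ι-* q q))))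
          (trans (cong ι (sym gap)) (trans (ι-+ (p ℕ.* p ℕ.* T⁺) e) (cong (_+ ι e) (trans (ι-* (p ℕ.* p) T⁺) (cong (_* ι T⁺) (ι-* p p))))))

      M≢0 : M * N ≢ 0#
      M≢0 eq = M≢0′ (a*b≡0 n≢0 eq)
        where
        N^≢0 : ∀ j → N ^ j ≢ 0#
        N^≢0 zero    eq = 1≢0 eq
        N^≢0 (suc j) eq = n≢0 (a*b≡0 (N^≢0 j) eq)
        M≢0′ : M ≢ 0#
        M≢0′ eq = N^≢0 (double k) (a*b≡0 (λ eq′ → n≢0 (a*b≡0 (λ eq″ → n≢0 (a*b≡0 n≢0 eq″)) eq′)) eq)

    -- The sum of `F` over all pairs is bounded below by the moments and above row by row. The
    -- common factor N^(2k + 4) cancels, leaving a bound linear in `n`.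
    linear-program : 20 ℕ.^ (3 ℕ.+ double k) ℕ.* (p ℕ.* e ℕ.* odds k ℕ.* n) ℕ.≤
      rising (suc r) k ℕ.* (suc r ℕ.+ double k) ℕ.* (height k p q 20 ℕ.+ L₁ ℕ.* height k p q 9 ℕ.+ L₂ ℕ.* height k p q 12)
    linear-program = ι-cancel (subst₂ _≤_ (sym left) (sym right) (*-cancelˡ (*-≥0 0≤M 0≤N) M≢0 (subst₂ _≤_ (rearrange₁ power₂₀ p′ N (N ^ double k) (ι e) (ι (odds k)))
        (rearrange₂ (ι (rising (suc r) k)) (ι T⁺) M N R) main)))
      where
      opaque
        unfolding K
        rearrange₁ : ∀ c p N X e o → c * (p * (N * (N * N)) * e * (o * X * (N * N))) ≡ X * (N * (N * N)) * N * (c * (p * e * o * N))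
        rearrange₁ = solve-∀ ℚ-ring
        rearrange₂ : ∀ a b M N R → a * (b * (M * (N * R))) ≡ M * N * (a * b * R)
        rearrange₂ = solve-∀ ℚ-ring
        regroup : ∀ c C → c * (c * (c * C)) ≡ C * (c * (c * c))
        regroup = solve-∀ ℚ-ring
      left : ι (20 ℕ.^ (3 ℕ.+ double k) ℕ.* (p ℕ.* e ℕ.* odds k ℕ.* n)) ≡ power₂₀ * (p′ * ι e * ι (odds k) * N)
      left = trans (ι-* (20 ℕ.^ (3 ℕ.+ double k)) _) (cong₂ _*_ (trans (ι-^ 20 (3 ℕ.+ double k)) (regroup c₂₀ (c₂₀ ^ double k)))
        (trans (ι-* (p ℕ.* e ℕ.* odds k) n) (cong (_* N) (trans (ι-* (p ℕ.* e) (odds k)) (cong (_* ι (odds k)) (ι-* p e))))))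
      right : ι (rising (suc r) k ℕ.* (suc r ℕ.+ double k) ℕ.* (height k p q 20 ℕ.+ L₁ ℕ.* height k p q 9 ℕ.+ L₂ ℕ.* height k p q 12)) ≡ ι (rising (suc r) k) * ι T⁺ * R
      right = trans (ι-* (rising (suc r) k ℕ.* T⁺) _) (cong₂ _*_ (ι-* (rising (suc r) k) T⁺) Rι)

-- Finite verification, and estimates for the products in the bound.

module Numerics where

  open Bounds using (∧-left; ∧-right)
  open Spherical using (double; odds; rising)
  open LP using (height; ≤ᵇ-true)
  open import Data.Nat hiding (parity)
  open import Data.Nat.Properties
  open import Data.Nat.Tactic.RingSolver using (solve-∀)
  open import Data.Bool using (Bool; true; false; _∧_)
  open import Data.Sum using (inj₁; inj₂)
  open import Relation.Nullary.Negation using (contradiction)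
  open import Relation.Binary.PropositionalEquality

  -- The test polynomial changes sign at s = p/q; e₀ and f₀ are the constants of
  -- cap-small at s, and L₁ bounds the vertices v with s < ⟨u,v⟩/n ≤ 9/20.
  module Check (p q e₀ f₀ : ℕ) where

    κ² : ℕ
    κ² = 3 * e₀ * (239 * (q * q) * (239 * (q * q)))

    loss : ℕ → ℕ
    loss D = 4 * (e₀ * e₀ * e₀) * D

    -- The coefficient `c` of `cap-small` is its successor when the loss is below `κ²`; this form
    -- makes it a nonzero divisor.
    c⁻ : ℕ → ℕ
    c⁻ D = pred (κ² ∸ loss D)

    L₁ : ℕ → ℕ
    L₁ D = (D * (f₀ * ((e₀ + f₀ + 2 * e₀) * (e₀ + f₀ + 2 * e₀)))) / suc (c⁻ D)

    e : ℕ → ℕ → ℕ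
    e k D = q * q * suc (double k) ∸ p * p * (D + double k)

    strict : ℕ → ℕ → ℕ → Bool
    strict k D N = rising D k * (D + double k) * (height k p q 20 + L₁ D * height k p q 9 + 11 * height k p q 12)
      <ᵇ 20 ^ (3 + double k) * (p * e k D * odds k * N)

    check : ℕ → ℕ → Bool
    check k r = (loss (suc r) <ᵇ κ²) ∧ ((p * p * (suc r + double k) ≤ᵇ q * q * suc (double k)) ∧ strict k (suc r) (suc (m r)))

  allBelow : (ℕ → Bool) → ℕ → Bool
  allBelow f zero    = true
  allBelow f (suc i) = f i ∧ allBelow f i

  allBelow-true : ∀ f N → allBelow f N ≡ true → ∀ {i} → i < N → f i ≡ true
  allBelow-true f (suc N) h {i} (s≤s i≤N) with m≤n⇒m<n∨m≡n i≤N
  ... | inj₂ refl = ∧-left h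
  ... | inj₁ i<N  = allBelow-true f N (∧-right {f N} h) i<N

  -- s = 5/13 serves 47 ≤ r ≤ 60 and s = 2/5 serves 61 ≤ r ≤ 240; beyond that,
  -- s = 3/7 with D ≤ 8k admits a uniform estimate.
  module I = Check 5 13 4369 46331
  module II = Check 2 5 325 7175

  -- The condition p²(D + 2k) ≤ q²(2k + 1) with D = r + 1 reads 288k ≥ 25D - 169 for s = 5/13 and
  -- 42k ≥ 4D - 25 for s = 2/5. `kᴵ` and `kᴵᴵ` lie slightly above these bounds.
  kᴵ : ℕ → ℕ
  kᴵ r with r ≤ᵇ 49
  ... | true  = 4
  ... | false = 5

  kᴵᴵ : ℕ → ℕ
  kᴵᴵ r = (r + 2) / 10

  check-I : allBelow (λ i → I.check (kᴵ (47 + i)) (47 + i)) 14 ≡ true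
  check-I = refl

  check-II : allBelow (λ i → II.check (kᴵᴵ (61 + i)) (61 + i)) 180 ≡ true
  check-II = refl

  -- Both sides are D (D + 2) ⋯ (D + 2k).
  rising-shift : ∀ D k → rising (2 + D) k * D ≡ rising D k * (D + double k)
  rising-shift D zero    = trans (+-identityʳ D) (sym (trans (+-identityʳ (D + 0)) (+-identityʳ D)))
  rising-shift D (suc k) = begin
    (2 + D + double k) * rising (2 + D) k * D     ≡⟨ *-assoc (2 + D + double k) (rising (2 + D) k) D ⟩
    (2 + D + double k) * (rising (2 + D) k * D)   ≡⟨ cong ((2 + D + double k) *_) (rising-shift D k) ⟩
    (2 + D + double k) * (rising D k * (D + double k)) ≡⟨ identity D (double k) (rising D k) ⟩
    (D + double k) * rising D k * (D + (2 + double k)) ∎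
    where
    open ≡-Reasoning
    identity : ∀ D k x → (2 + D + k) * (x * (D + k)) ≡ (D + k) * x * (D + (2 + k))
    identity = solve-∀

  rising-mono : ∀ {D D′} k → D ≤ D′ → rising D k ≤ rising D′ k
  rising-mono zero    h = ≤-refl
  rising-mono (suc k) h = *-mono-≤ (+-monoˡ-≤ (double k) h) (rising-mono k h)

  double≡ : ∀ k → double k ≡ 2 * k
  double≡ zero    = refl
  double≡ (suc k) = trans (cong (2 +_) (double≡ k)) (identity k)
    where
    identity : ∀ k → 2 + 2 * k ≡ 2 * (1 + k)
    identity = solve-∀

  odds>0 : ∀ k → 1 ≤ odds k
  odds>0 zero    = ≤-refl
  odds>0 (suc k) = *-mono-≤ {1} {suc (double k)} (s≤s z≤n) (odds>0 k)

  -- The first hypothesis is (5/4)⁴ a ≤ 16 s; the others bound four ratios by 5/4. The factor 256 ·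
  -- 625 = 4⁴ · 5⁴ clears the denominators.
  product-bound : ∀ {a b c d e s b′ c′ d′ e′} → a * 625 ≤ s * 4096 → b * 4 ≤ b′ * 5 → c * 4 ≤ c′ * 5 → d * 4 ≤ d′ * 5 → e * 4 ≤ e′ * 5 →
    a * (b * c * (d * e)) ≤ s * 16 * (b′ * c′ * (d′ * e′))
  product-bound {a} {b} {c} {d} {e} {s} {b′} {c′} {d′} {e′} ha hb hc hd he =
    *-cancelʳ-≤ (a * (b * c * (d * e))) (s * 16 * (b′ * c′ * (d′ * e′))) (256 * 625) (begin
      a * (b * c * (d * e)) * (256 * 625)                   ≡⟨ group a b c d e 625 4 ⟩
      a * 625 * (b * 4 * (c * 4) * (d * 4 * (e * 4)))       ≤⟨ *-mono-≤ ha (*-mono-≤ (*-mono-≤ hb hc) (*-mono-≤ hd he)) ⟩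
      s * 4096 * (b′ * 5 * (c′ * 5) * (d′ * 5 * (e′ * 5)))  ≡⟨ group′ s b′ c′ d′ e′ 16 256 5 ⟩
      s * 16 * (b′ * c′ * (d′ * e′)) * (256 * 625)          ∎)
    where
    open ≤-Reasoning
    group : ∀ a b c d e t u → a * (b * c * (d * e)) * (u * u * (u * u) * t) ≡ a * t * (b * u * (c * u) * (d * u * (e * u)))
    group = solve-∀
    group′ : ∀ s b c d e t u v → s * (t * u) * (b * v * (c * v) * (d * v * (e * v))) ≡ s * t * (b * c * (d * e)) * (u * (v * v * (v * v)))
    group′ = solve-∀

  linear-bound : ∀ k {a s} → 1 ≤ k → a ≡ k * 10 + 8 → s ≡ k * 2 + 1 → a * 625 ≤ s * 4096
  linear-bound k {a} {s} 1≤k refl refl = begin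
    (k * 10 + 8) * 625           ≡⟨ distrib k 10 8 625 ⟩
    -- Here 1942 = 8192 - 6250, and for k ≥ 1 it covers the constant, as 5000 ≤ 1942 + 4096.
    k * 6250 + 5000              ≤⟨ +-monoʳ-≤ (k * 6250) (≤-trans (≤ᵇ-true 5000 6038 refl) (+-monoˡ-≤ 4096 (≤-trans (≤-reflexive (sym (*-identityˡ 1942))) (*-monoˡ-≤ 1942 1≤k)))) ⟩
    k * 6250 + (k * 1942 + 4096) ≡⟨ collect k 6250 1942 4096 ⟩
    k * 8192 + 4096              ≡⟨ distrib k 2 1 4096 ⟨
    (k * 2 + 1) * 4096           ∎
    where
    open ≤-Reasoning
    distrib : ∀ k a b c → (k * a + b) * c ≡ k * (a * c) + b * c
    distrib = solve-∀
    collect : ∀ k a b c → k * a + (k * b + c) ≡ k * (a + b) + c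
    collect = solve-∀

  telescope : ∀ {R₈ R₆ R₄ R₂ R₀ d₆ d₄ d₂ d₀ t₆ t₄ t₂ t₀} →
    R₈ * d₆ ≡ R₆ * t₆ → R₆ * d₄ ≡ R₄ * t₄ → R₄ * d₂ ≡ R₂ * t₂ → R₂ * d₀ ≡ R₀ * t₀ →
    R₈ * (d₆ * d₄ * (d₂ * d₀)) ≡ R₀ * (t₆ * t₄ * (t₂ * t₀))
  telescope {R₈} {R₆} {R₄} {R₂} {R₀} {d₆} {d₄} {d₂} {d₀} {t₆} {t₄} {t₂} {t₀} h₆ h₄ h₂ h₀ = begin
    R₈ * (d₆ * d₄ * (d₂ * d₀))   ≡⟨ step R₈ d₆ d₄ (d₂ * d₀) ⟩
    R₈ * d₆ * (d₄ * (d₂ * d₀))   ≡⟨ cong (_* (d₄ * (d₂ * d₀))) h₆ ⟩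
    R₆ * t₆ * (d₄ * (d₂ * d₀))   ≡⟨ swap R₆ t₆ d₄ (d₂ * d₀) ⟩
    R₆ * d₄ * (d₂ * d₀) * t₆     ≡⟨ cong (λ z → z * (d₂ * d₀) * t₆) h₄ ⟩
    R₄ * t₄ * (d₂ * d₀) * t₆     ≡⟨ cong (_* t₆) (swap R₄ t₄ d₂ d₀) ⟩
    R₄ * d₂ * d₀ * t₄ * t₆       ≡⟨ cong (λ z → z * d₀ * t₄ * t₆) h₂ ⟩
    R₂ * t₂ * d₀ * t₄ * t₆       ≡⟨ exchange R₂ t₂ d₀ t₄ t₆ ⟩
    R₂ * d₀ * t₂ * t₄ * t₆       ≡⟨ cong (λ z → z * t₂ * t₄ * t₆) h₀ ⟩
    R₀ * t₀ * t₂ * t₄ * t₆       ≡⟨ finish R₀ t₀ t₂ t₄ t₆ ⟩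
    R₀ * (t₆ * t₄ * (t₂ * t₀))   ∎
    where
    open ≡-Reasoning
    step : ∀ a b c d → a * (b * c * d) ≡ a * b * (c * d)
    step = solve-∀
    swap : ∀ a b c d → a * b * (c * d) ≡ a * c * d * b
    swap = solve-∀
    exchange : ∀ a b c d e → a * b * c * d * e ≡ a * c * b * d * e
    exchange = solve-∀
    finish : ∀ a b c d e → a * b * c * d * e ≡ a * (e * d * (c * b))
    finish = solve-∀

  cancel-step : ∀ {a s R₈ R₀ B T} → 1 ≤ B → R₈ * B ≡ R₀ * T → a * T ≤ s * 16 * B → a * R₈ ≤ 16 * s * R₀
  cancel-step {a} {s} {R₈} {R₀} {B} {T} 1≤B eq h = *-cancelʳ-≤ (a * R₈) (16 * s * R₀) B {{>-nonZero 1≤B}} (begin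
    a * R₈ * B        ≡⟨ *-assoc a R₈ B ⟩
    a * (R₈ * B)      ≡⟨ cong (a *_) eq ⟩
    a * (R₀ * T)      ≡⟨ swap a R₀ T ⟩
    R₀ * (a * T)      ≤⟨ *-monoʳ-≤ R₀ h ⟩
    R₀ * (s * 16 * B) ≡⟨ finish R₀ s B 16 ⟩
    16 * s * R₀ * B   ∎)
    where
    open ≤-Reasoning
    swap : ∀ a b c → a * (b * c) ≡ b * (a * c)
    swap = solve-∀
    finish : ∀ r s b c → r * (s * c * b) ≡ c * s * r * b
    finish = solve-∀

  -- Each shift of D by 2 costs a factor of at most 5/4, as 2k ≤ D/4, and (5/4)⁴ (10k + 8) ≤ 16 (2k + 1).
  rising-step : ∀ k D → D ≡ 8 * k → 1 ≤ D → rising (8 + D) (suc k) ≤ 16 * suc (double k) * rising D k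
  rising-step k D D≡8k 1≤D = cancel-step {8 + D + double k} {suc (double k)} {rising (8 + D) k} {rising D k}
        {(6 + D) * (4 + D) * ((2 + D) * D)} {(6 + D + double k) * (4 + D + double k) * ((2 + D + double k) * (D + double k))}
      (*-mono-≤ {1} {(6 + D) * (4 + D)} {1} {(2 + D) * D} (*-mono-≤ {1} {6 + D} {1} {4 + D} (s≤s z≤n) (s≤s z≤n)) (*-mono-≤ {1} {2 + D} {1} {D} (s≤s z≤n) 1≤D))
      (telescope {rising (8 + D) k} {rising (6 + D) k} {rising (4 + D) k} {rising (2 + D) k} {rising D k} {6 + D} {4 + D} {2 + D} {D} {6 + D + double k} {4 + D + double k} {2 + D + double k} {D + double k}
        (rising-shift (6 + D) k) (rising-shift (4 + D) k) (rising-shift (2 + D) k) (rising-shift D k))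
      (product-bound {8 + D + double k} {6 + D + double k} {4 + D + double k} {2 + D + double k} {D + double k} {suc (double k)} {6 + D} {4 + D} {2 + D} {D}
        last-factor (factor 6) (factor 4) (factor 2) (factor 0))
    where
    open ≤-Reasoning
    factor : ∀ i → (i + D + double k) * 4 ≤ (i + D) * 5
    factor i = begin
      (i + D + double k) * 4     ≡⟨ cong (λ z → (i + D + z) * 4) (double≡ k) ⟩
      (i + D + 2 * k) * 4        ≡⟨ expand i D k ⟩
      i * 4 + D * 4 + 8 * k      ≡⟨ cong (i * 4 + D * 4 +_) D≡8k ⟨
      i * 4 + D * 4 + D          ≤⟨ +-monoˡ-≤ D (+-monoˡ-≤ (D * 4) (*-monoʳ-≤ i {4} {5} (n≤1+n 4))) ⟩
      i * 5 + D * 4 + D          ≡⟨ collect i D ⟩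
      (i + D) * 5                ∎
      where
      expand : ∀ i D k → (i + D + 2 * k) * 4 ≡ i * 4 + D * 4 + 8 * k
      expand = solve-∀
      collect : ∀ i D → i * 5 + D * 4 + D ≡ (i + D) * 5
      collect = solve-∀
    tenfold : ∀ k → 8 + 8 * k + 2 * k ≡ k * 10 + 8
    tenfold = solve-∀
    twofold : ∀ k → 1 + 2 * k ≡ k * 2 + 1
    twofold = solve-∀
    1≤k : 1 ≤ k
    1≤k = positive k D≡8k
      where
      positive : ∀ k → D ≡ 8 * k → 1 ≤ k
      positive zero    refl = contradiction 1≤D λ ()
      positive (suc k) _    = s≤s z≤n
    last-factor : (8 + D + double k) * 625 ≤ suc (double k) * 4096
    last-factor = linear-bound k {8 + D + double k} {suc (double k)} 1≤k (trans (cong₂ (λ a b → 8 + a + b) D≡8k (double≡ k)) (tenfold k)) (trans (cong suc (double≡ k)) (twofold k))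

-- Growth estimates uniform in the rank.

module Growth where

  open Bounds using (m-double)
  open Spherical using (double; odds; rising)
  open LP using (height; <ᵇ-true; ≤ᵇ-true)
  open Numerics
  open import Data.Nat hiding (parity)
  open import Data.Nat.Properties
  open import Data.Nat.Tactic.RingSolver using (solve-∀)
  open import Relation.Binary.PropositionalEquality

  growth-step : ∀ c E k → 1 ≤ 8 * k → rising (8 * k) k * c ≤ 3 * odds k * E → rising (8 * suc k) (suc k) * c ≤ 3 * odds (suc k) * (16 * E)
  growth-step c E k 1≤8k h = begin
    rising (8 * suc k) (suc k) * c                 ≡⟨ cong (λ z → rising z (suc k) * c) (*-suc 8 k) ⟩
    rising (8 + 8 * k) (suc k) * c                 ≤⟨ *-monoˡ-≤ c (rising-step k (8 * k) refl 1≤8k) ⟩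
    16 * suc (double k) * rising (8 * k) k * c     ≡⟨ *-assoc (16 * suc (double k)) (rising (8 * k) k) c ⟩
    16 * suc (double k) * (rising (8 * k) k * c)   ≤⟨ *-monoʳ-≤ (16 * suc (double k)) h ⟩
    16 * suc (double k) * (3 * odds k * E)         ≡⟨ identity₂ (suc (double k)) (odds k) E ⟩
    3 * (suc (double k) * odds k) * (16 * E)       ∎
    where
    open ≤-Reasoning
    identity₂ : ∀ s x y → 16 * s * (3 * x * y) ≡ 3 * (s * x) * (16 * y)
    identity₂ = solve-∀

  2^4+ : ∀ k → 2 ^ (4 * suc k) ≡ 16 * 2 ^ (4 * k)
  2^4+ k = trans (cong (2 ^_) (*-suc 4 k)) (^-distribˡ-+-* 2 4 (4 * k))

  -- By `rising-step` both sides gain the factor 16(2k + 1) from k to k + 1, the left at most and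
  -- the right exactly. The base 31 is the least k arising from r ≥ 241; 16000 = 20 · 800 combines
  -- the bound 800 of `heights` with the doubled factor 10k.
  growth : ∀ {k} → 31 ≤′ k → rising (8 * k) k * 16000 ≤ 3 * odds k * 2 ^ (4 * k)
  growth (≤′-reflexive refl) = ≤ᵇ-true (rising (8 * 31) 31 * 16000) (3 * odds 31 * 2 ^ (4 * 31)) refl
  growth {suc k} (≤′-step h) = subst (λ E → rising (8 * suc k) (suc k) * 16000 ≤ 3 * odds (suc k) * E) (sym (2^4+ k))
    (growth-step 16000 (2 ^ (4 * k)) k (≤-trans {1} {k} {8 * k} (≤-trans {1} {31} {k} (s≤s z≤n) (≤′⇒≤ h)) (m≤m+n k (7 * k))) (growth h))

  power-bound : ∀ {k} → 2 ≤′ k → 12 ^ double k * 3 ≤ 20 ^ double k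
  power-bound (≤′-reflexive refl) = ≤ᵇ-true (12 ^ 4 * 3) (20 ^ 4) refl
  power-bound {suc k} (≤′-step h) = power-step (12 ^ double k) (20 ^ double k) (power-bound h)
    where
    open ≤-Reasoning
    power-step : ∀ x y → x * 3 ≤ y → 12 * (12 * x) * 3 ≤ 20 * (20 * y)
    power-step x y h = begin
      12 * (12 * x) * 3   ≡⟨ identity x 12 ⟩
      12 * (12 * (x * 3)) ≤⟨ *-mono-≤ {12} {20} (m≤m+n 12 8) (*-mono-≤ {12} {20} (m≤m+n 12 8) h) ⟩
      20 * (20 * y)       ∎
      where
      identity : ∀ x c → c * (c * x) * 3 ≡ c * (c * (x * 3))
      identity = solve-∀

  strict-combine : ∀ {R R′ T H B c h k o E n e} → R ≤ R′ → T ≤ 10 * k → H ≤ B * h → c ≡ 20 * h → R′ * c ≤ 3 * o * E → E < 16 * n → 8 * k ≤ e → 1 ≤ o → 1 ≤ B → 1 ≤ k →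
    R * T * H < B * (3 * e * o * n)
  strict-combine {R} {R′} {T} {H} {B} {c} {h} {k} {o} {E} {n} {e} R≤ T≤ H≤ c≡ g E< 8k≤ 1≤o 1≤B 1≤k = *-cancelˡ-< 2 (R * T * H) (B * (3 * e * o * n)) (begin-strict
    2 * (R * T * H)                     ≤⟨ *-monoʳ-≤ 2 (*-mono-≤ (*-mono-≤ R≤ T≤) H≤) ⟩
    2 * (R′ * (10 * k) * (B * h))       ≡⟨ identity₁ R′ k B h ⟩
    k * B * (R′ * (20 * h))             ≡⟨ cong (λ z → k * B * (R′ * z)) c≡ ⟨
    k * B * (R′ * c)                    ≤⟨ *-monoʳ-≤ (k * B) g ⟩
    k * B * (3 * o * E)                 <⟨ *-monoʳ-< (k * B) {{>-nonZero (*-mono-≤ 1≤k 1≤B)}} (*-monoʳ-< (3 * o) {{>-nonZero (*-mono-≤ {1} {3} (s≤s z≤n) 1≤o)}} E<) ⟩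
    k * B * (3 * o * (16 * n))          ≡⟨ identity₂ k B o n ⟩
    2 * (B * (3 * (8 * k) * o * n))     ≤⟨ *-monoʳ-≤ 2 (*-monoʳ-≤ B (*-monoˡ-≤ n (*-monoˡ-≤ o (*-monoʳ-≤ 3 8k≤)))) ⟩
    2 * (B * (3 * e * o * n))           ∎)
    where
    open ≤-Reasoning
    identity₁ : ∀ R k B h → 2 * (R * (10 * k) * (B * h)) ≡ k * B * (R * (20 * h))
    identity₁ = solve-∀
    identity₂ : ∀ k B o n → k * B * (3 * o * (16 * n)) ≡ 2 * (B * (3 * (8 * k) * o * n))
    identity₂ = solve-∀

  heights-combine : ∀ {x y z a b c d f} → z ≤ y → y * f ≤ x → 27 * b + 11 * c ≤ f * a → a + a ≡ d → x * a + 27 * (z * b) + 11 * (y * c) ≤ x * d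
  heights-combine {x} {y} {z} {a} {b} {c} {d} {f} z≤y y≤x bc≤ refl = begin
    x * a + 27 * (z * b) + 11 * (y * c)   ≤⟨ +-monoˡ-≤ (11 * (y * c)) (+-monoʳ-≤ (x * a) (*-monoʳ-≤ 27 (*-monoˡ-≤ b z≤y))) ⟩
    x * a + 27 * (y * b) + 11 * (y * c)   ≡⟨ identity x y a b c ⟩
    x * a + y * (27 * b + 11 * c)         ≤⟨ +-monoʳ-≤ (x * a) (*-monoʳ-≤ y bc≤) ⟩
    x * a + y * (f * a)                   ≡⟨ cong (x * a +_) (*-assoc y f a) ⟨
    x * a + y * f * a                     ≤⟨ +-monoʳ-≤ (x * a) (*-monoˡ-≤ a y≤x) ⟩
    x * a + x * a                         ≡⟨ *-distribˡ-+ x a a ⟨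
    x * (a + a)                           ∎
    where
    open ≤-Reasoning
    identity : ∀ x y a b c → x * a + 27 * (y * b) + 11 * (y * c) ≡ x * a + y * (27 * b + 11 * c)
    identity = solve-∀

  -- At c = 20, 9, 12 the cubic factor (7c - 60)(7c + 60)² is 3200000, 45387, 497664. The last two,
  -- weighted by 27 and 11, total at most 3 · 3200000, and 12^2k is at most a third of 20^2k; so the
  -- off-diagonal terms at most double the diagonal one.
  heights : ∀ k → 2 ≤ k → height k 3 7 20 + 27 * height k 3 7 9 + 11 * height k 3 7 12 ≤ 20 ^ (3 + double k) * 800
  heights k 2≤k = ≤-trans (heights-combine {20 ^ double k} {12 ^ double k} {9 ^ double k} {3200000} {45387} {497664} {6400000} {3}
        (^-monoˡ-≤ (double k) {9} {12} (m≤m+n 9 3)) (power-bound (≤⇒≤′ 2≤k)) (≤ᵇ-true 6699753 9600000 refl) refl)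
      (≤-reflexive (collect (20 ^ double k) 20 800))
    where
    collect : ∀ x c d → x * (c * (c * c) * d) ≡ c * (c * (c * x)) * d
    collect = solve-∀

  -- The slack for s = 3/7: the coefficient 8 is 49 · 2 - 9 · 10.
  gap-bound : ∀ {k D t e} → t ≡ 2 * k → D ≤ 8 * k → 9 * (D + t) + e ≡ 49 * suc t → 8 * k ≤ e
  gap-bound {k} {D} {t} {e} refl D≤ gap = +-cancelˡ-≤ (9 * (8 * k + 2 * k)) (8 * k) e (begin
    9 * (8 * k + 2 * k) + 8 * k      ≤⟨ m≤m+n _ 49 ⟩
    9 * (8 * k + 2 * k) + 8 * k + 49 ≡⟨ identity k ⟩
    49 * (1 + 2 * k)                 ≡⟨ gap ⟨
    9 * (D + 2 * k) + e              ≤⟨ +-monoˡ-≤ e (*-monoʳ-≤ 9 (+-monoˡ-≤ (2 * k) D≤)) ⟩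
    9 * (8 * k + 2 * k) + e          ∎)
    where
    open ≤-Reasoning
    identity : ∀ k → 9 * (8 * k + 2 * k) + 8 * k + 49 ≡ 49 * (1 + 2 * k)
    identity = solve-∀

  strict-III : ∀ k r n e → 31 ≤ k → suc r ≤ 8 * k → 2 ^ (4 * k) < 16 * n →
    9 * (suc r + double k) + e ≡ 49 * suc (double k) →
    rising (suc r) k * (suc r + double k) * (height k 3 7 20 + 27 * height k 3 7 9 + 11 * height k 3 7 12)
      < 20 ^ (3 + double k) * (3 * e * odds k * n)
  strict-III k r n e 31≤k r≤ n> gap = strict-combine {rising (suc r) k} {rising (8 * k) k} {suc r + double k} {_} {20 ^ (3 + double k)} {16000} {800} {k} {odds k} {2 ^ (4 * k)} {n} {e}
    (rising-mono k r≤) 10k (heights k (≤-trans {2} {31} {k} (s≤s (s≤s z≤n)) 31≤k)) refl (growth (≤⇒≤′ 31≤k)) n> (gap-bound {k} {suc r} {double k} {e} (double≡ k) r≤ gap) (odds>0 k) (m^n>0 20 (3 + double k)) (≤-trans {1} {31} {k} (s≤s z≤n) 31≤k)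
    where
    10k : suc r + double k ≤ 10 * k
    10k = ≤-trans (+-monoˡ-≤ (double k) r≤) (≤-reflexive (trans (cong (8 * k +_) (double≡ k)) (sym (*-distribʳ-+ k 8 2))))

  two-step : (Q : ℕ → Set) → Q 0 → Q 1 → (∀ i → Q i → Q (2 + i)) → ∀ i → Q i
  two-step Q q₀ q₁ step zero          = q₀
  two-step Q q₀ q₁ step (suc zero)    = q₁
  two-step Q q₀ q₁ step (suc (suc i)) = step i (two-step Q q₀ q₁ step i)

  -- With r = 47 + i: two twin classes of rank at most r - 3 together with 8(r + 1) further vertices
  -- stay below the bound for rank r.
  m-drop-3 : ∀ i → 2 * m (44 + i) + 8 * (48 + i) + 1 ≤ m (47 + i)
  m-drop-3 = two-step _ (≤ᵇ-true (2 * m 44 + 8 * 48 + 1) (m 47) refl) (≤ᵇ-true (2 * m 45 + 8 * 49 + 1) (m 48) refl) λ i h → begin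
    2 * m (2 + (44 + i)) + 8 * (50 + i) + 1         ≡⟨ cong (λ z → 2 * z + 8 * (50 + i) + 1) (m-double (44 + i) (s≤s (s≤s z≤n))) ⟩
    2 * (2 * m (44 + i) + 2) + 8 * (50 + i) + 1     ≤⟨ m≤m+n _ (367 + 8 * i) ⟩
    2 * (2 * m (44 + i) + 2) + 8 * (50 + i) + 1 + (367 + 8 * i) ≡⟨ identity (m (44 + i)) i ⟩
    2 * (2 * m (44 + i) + 8 * (48 + i) + 1) + 2     ≤⟨ +-monoˡ-≤ 2 (*-monoʳ-≤ 2 h) ⟩
    2 * m (47 + i) + 2                              ≡⟨ m-double (47 + i) (s≤s (s≤s z≤n)) ⟨
    m (2 + (47 + i))                                ∎
    where
    open ≤-Reasoning
    identity : ∀ x i → 2 * (2 * x + 2) + 8 * (50 + i) + 1 + (367 + 8 * i) ≡ 2 * (2 * x + 8 * (48 + i) + 1) + 2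
    identity = solve-∀

  -- In two steps `f` about doubles while `g` quadruples; the added `c` absorbs the constant 2 of
  -- the recursion.
  compare-doubling : ∀ (f g : ℕ → ℕ) c → (∀ i → f (2 + i) ≡ 2 * f i + 2) → (∀ i → g (2 + i) ≡ 2 * (2 * g i)) →
    f 0 * c + c < g 0 * 5 → f 1 * c + c < g 1 * 5 → ∀ i → f i * c + c < g i * 5
  compare-doubling f g c f-step g-step base₀ base₁ = two-step (λ i → f i * c + c < g i * 5) base₀ base₁ λ i h →
    subst₂ (λ x y → x * c + c < y * 5) (sym (f-step i)) (sym (g-step i)) (step (f i) (g i) h)
    where
    open ≤-Reasoning
    identity₁ : ∀ x c → (2 * x + 2) * c + c + (2 * x + 1) * c ≡ 4 * (x * c + c)
    identity₁ = solve-∀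
    identity₂ : ∀ x → 4 * (x * 5) ≡ 2 * (2 * x) * 5
    identity₂ = solve-∀
    step : ∀ x y → x * c + c < y * 5 → (2 * x + 2) * c + c < 2 * (2 * y) * 5
    step x y h = begin-strict
      (2 * x + 2) * c + c                    ≤⟨ m≤m+n ((2 * x + 2) * c + c) ((2 * x + 1) * c) ⟩
      (2 * x + 2) * c + c + (2 * x + 1) * c  ≡⟨ identity₁ x c ⟩
      4 * (x * c + c)                        <⟨ *-monoʳ-< 4 h ⟩
      4 * (y * 5)                            ≡⟨ identity₂ y ⟩
      2 * (2 * y) * 5                        ∎

  2^-two-steps : ∀ a i → 2 ^ (a + (2 + i)) ≡ 2 * (2 * 2 ^ (a + i))
  2^-two-steps a i = cong (2 ^_) (trans (+-suc a (suc i)) (cong suc (+-suc a i)))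

  -- For r = 3 + 2g with g = 22 + i: 1200 times the bound for a twin class of rank 3 + g is still
  -- below m(r) + 2.
  m-half : ∀ i → m (25 + i) * 1200 + 1200 < 2 ^ (22 + i) * 5
  m-half = compare-doubling (λ i → m (25 + i)) (λ i → 2 ^ (22 + i)) 1200 (λ i → m-double (25 + i) (s≤s (s≤s z≤n))) (2^-two-steps 22)
    (<ᵇ-true (m (25 + 0) * 1200 + 1200) (2 ^ (22 + 0) * 5) refl) (<ᵇ-true (m (25 + 1) * 1200 + 1200) (2 ^ (22 + 1) * 5) refl)

-- The polynomial bound in its three ranges of rank.

module Regimes where

  open RatSum using (0#; ι; ι-mono; ι-suc≢0; ι-*; 0≤q-p)
  open LinAlg using (Proj; Fix)
  open Count
  open GraphRank using (rowK)
  open Bounds using (_is_; is-refl; true≢false; ∧-left; ∧-right; not-elim; m-even; m-mono)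
  open Spherical using (double; odds; rising)
  open Caps using (dist; inner; inner-dist; module Cap)
  open LP
  open Numerics
  open Growth
  open import Data.Nat hiding (parity)
  open import Data.Nat.Properties
  open import Data.Nat.DivMod
  open import Data.Nat.Tactic.RingSolver using (solve-∀)
  open import Data.Bool using (Bool; true; not; _∧_)
  import Data.Bool.Properties as BoolP
  open import Data.Empty using (⊥)
  open import Relation.Nullary using (yes; no)
  open import Relation.Binary.PropositionalEquality

  quotient-bound : ∀ {x c y} b → x * c ≤ y → y < suc b * c → x ≤ b
  quotient-bound {x} {c} {y} b h y< = s≤s⁻¹ (*-cancelʳ-< c x (suc b) (≤-<-trans h y<))

  dist-sym : ∀ {n} (G : Graph n) u v → dist G u v ≡ dist G v u
  dist-sym G u v = count-cong (λ a → BoolP.xor-comm (adj G u a) (adj G v a))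

  checked : ∀ (f : ℕ → Bool) a N → allBelow (λ i → f (a + i)) N ≡ true → ∀ r → a ≤ r → r < a + N → f r ≡ true
  checked f a N h r a≤r r< = subst (λ r → f r ≡ true) (m+[n∸m]≡n a≤r)
    (allBelow-true (λ i → f (a + i)) N h (+-cancelˡ-< a (r ∸ a) N (subst (_< a + N) (sym (m+[n∸m]≡n a≤r)) r<)))

  module _ {n r} (G : Graph n) (P : Proj n r) (fR : ∀ u → Fix P (rowK G u)) (n≢0 : ι n ≢ 0#)
    (separated : ∀ u v → u ≢ v → 20 * n ≤ 12 * n + 20 * (2 * dist G u v))
    (triple : ∀ u v w → u ≢ v → v ≢ w → u ≢ w → 599 * n ≤ 600 * (dist G u v + dist G v w + dist G u w)) where

    private
      close-≢ : ∀ {p q u i} → close G p q u i ≡ true → i ≢ u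
      close-≢ {u = u} h refl = true≢false (is-refl u) (not-elim (∧-left h))

      close-bound : ∀ {p q u i} → close G p q u i ≡ true → p * n + q * (2 * dist G i u) ≤ q * n
      close-bound {p} {q} {u} {i} h = subst (λ d → p * n + q * (2 * d) ≤ q * n) (dist-sym G u i)
        (<⇒≤ (<ᵇ-true (p * n + q * (2 * dist G u i)) (q * n) (∧-right {not (u is i)} h)))

      around : ∀ u i k → i ≢ k → i ≢ u → k ≢ u → 599 * n ≤ 600 * (dist G i k + dist G i u + dist G k u)
      around u i k i≢k i≢u k≢u = subst (λ d → 599 * n ≤ 600 * d) (exchange (dist G i k) (dist G k u) (dist G i u)) (triple i k u i≢k k≢u i≢u)
        where
        exchange : ∀ a b c → a + b + c ≡ a + c + b
        exchange = solve-∀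

    -- `cap-negative` at 9/20: 11900 = 300 · 29² - 601 · 20² and 131900 = 300 · 20² + 11900, with
    -- quotient below 12.
    few-nearby : ∀ p q u → count (nearby G p q u) ≤ 11
    few-nearby p q u = quotient-bound {count (nearby G p q u)} {11900} {131900} 11
        (Cap.cap-negative G P fR u n≢0 (nearby G p q u) 9 20
          (λ i k i≢k Ui Uk → around u i k i≢k (close-≢ {p} {q} (∧-left Ui)) (close-≢ {p} {q} (∧-left Uk))) lower (ι-suc≢0 19) 11900 refl)
        (<ᵇ-true 131900 142800 refl)
      where
      lower : ∀ i → nearby G p q u i ≡ true → 9 * n + 20 * (2 * dist G i u) ≤ 20 * n
      lower i Ui = subst (λ d → 9 * n + 20 * (2 * d) ≤ 20 * n) (dist-sym G u i)
        (<⇒≤ (≤ᵇ-false (20 * n) (9 * n + 20 * (2 * dist G u i)) (not-elim (∧-right {close G p q u i} Ui))))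

    -- At 3/7 the products of projections are still negative: 551 = 300 · 10² - 601 · 7² and 15251 =
    -- 300 · 7² + 551, with quotient below 28.
    few-outer-III : ∀ u → count (outer G 3 7 u) ≤ 27
    few-outer-III u = quotient-bound {count (outer G 3 7 u)} {551} {15251} 27
      (Cap.cap-negative G P fR u n≢0 (outer G 3 7 u) 3 7
        (λ i k i≢k Ui Uk → around u i k i≢k (close-≢ {3} {7} (∧-left Ui)) (close-≢ {3} {7} (∧-left Uk)))
        (λ i Ui → close-bound {3} {7} (∧-left Ui)) (ι-suc≢0 6) 551 refl)
      (<ᵇ-true 15251 15428 refl)

    module _ (p q e₀ f₀ : ℕ) (q>0 : 1 ≤ q) (p≤q : p ≤ q) (20p≤9q : 20 * p ≤ 9 * q)
      (e₀-eq : 300 * ((p + q) * (p + q)) + e₀ ≡ 601 * (q * q)) (f₀-eq : e₀ + f₀ ≡ 300 * (q * q)) where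

      open Check p q e₀ f₀

      few-outer : loss (suc r) < κ² → ∀ u → count (outer G p q u) ≤ L₁ (suc r)
      few-outer loss<κ² u = subst (_≤ L₁ (suc r)) (m*n/n≡m (count (outer G p q u)) (suc (c⁻ (suc r))))
          (/-monoˡ-≤ (suc (c⁻ (suc r))) (Cap.cap-small G P fR u n≢0 (outer G p q u) p q
            (λ i k i≢k Ui Uk → around u i k i≢k (close-≢ {p} {q} (∧-left Ui)) (close-≢ {p} {q} (∧-left Uk)))
            (λ i Ui → close-bound {p} {q} (∧-left Ui)) q≢0
            (λ i Ui → subst (λ d → 20 * n ≤ 9 * n + 20 * (2 * d)) (dist-sym G u i) (≤ᵇ-true (20 * n) (9 * n + 20 * (2 * dist G u i)) (∧-right {close G p q u i} Ui)))
            (λ i Ui → inner≥0 i (≤-trans (m≤n+m (q * (2 * dist G i u)) (p * n)) (close-bound {p} {q} (∧-left Ui))))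
            e₀ f₀ (suc (c⁻ (suc r))) e₀-eq f₀-eq margin))
        where
        positive : ∀ {q} → 1 ≤ q → ι q ≢ 0#
        positive {suc q} _ = ι-suc≢0 q
        q≢0 : ι q ≢ 0#
        q≢0 = positive q>0
        inner≥0 : ∀ i → q * (2 * dist G i u) ≤ q * n → 0# RatSum.≤ inner G i u
        inner≥0 i h = subst (0# RatSum.≤_) (sym (inner-dist G i u)) (0≤q-p (subst (RatSum._≤ ι n) (trans (ι-* 2 (dist G i u)) (cong (RatSum._* ι (dist G i u)) (cong (RatSum.1# RatSum.+_) (RatSum.+-identityʳ RatSum.1#))))
          (ι-mono (*-cancelˡ-≤ q {{>-nonZero q>0}} h))))
        margin : loss (suc r) + suc (c⁻ (suc r)) ≡ κ²
        margin = trans (cong (loss (suc r) +_) (suc-pred (κ² ∸ loss (suc r)) {{>-nonZero (m<n⇒0<n∸m loss<κ²)}})) (m+[n∸m]≡n (<⇒≤ loss<κ²))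

      check-contradiction : ∀ k → check k r ≡ true → m r < n → ⊥
      check-contradiction k h m<n = <⇒≱ strict-n
          (LinearProgram.linear-program G P fR n≢0 k p q (e k (suc r)) (L₁ (suc r)) 11 p≤q 20p≤9q (m+[n∸m]≡n gap) separated
            (few-outer (<ᵇ-true (loss (suc r)) (κ²) (∧-left h))) (few-nearby p q))
        where
        rest : (p * p * (suc r + double k) ≤ᵇ q * q * suc (double k)) ∧ strict k (suc r) (suc (m r)) ≡ true
        rest = ∧-right {loss (suc r) <ᵇ κ²} h
        gap : p * p * (suc r + double k) ≤ q * q * suc (double k)
        gap = ≤ᵇ-true (p * p * (suc r + double k)) (q * q * suc (double k)) (∧-left rest)
        heights-sum : ℕ
        heights-sum = height k p q 20 + L₁ (suc r) * height k p q 9 + 11 * height k p q 12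
        strict-n : rising (suc r) k * (suc r + double k) * heights-sum < 20 ^ (3 + double k) * (p * e k (suc r) * odds k * n)
        strict-n = <-≤-trans (<ᵇ-true (rising (suc r) k * (suc r + double k) * heights-sum) (20 ^ (3 + double k) * (p * e k (suc r) * odds k * suc (m r)))
            (∧-right {p * p * (suc r + double k) ≤ᵇ q * q * suc (double k)} rest))
          (*-monoʳ-≤ (20 ^ (3 + double k)) (*-monoʳ-≤ (p * e k (suc r) * odds k) m<n))

    contradiction-III : 241 ≤ r → m r < n → ⊥
    contradiction-III 241≤r m<n = <⇒≱ (strict-III k r n e 31≤k r<8k n-large gap)
        (LinearProgram.linear-program G P fR n≢0 k 3 7 e 27 11 (m≤m+n 3 4) (m≤m+n 60 3) gap separated few-outer-III (few-nearby 3 7))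
      where
      j k e : ℕ
      j = r / 8
      -- The least k with r + 1 ≤ 8k.
      k = suc j
      30≤j : 30 ≤ j
      30≤j = /-monoˡ-≤ 8 (≤-trans (m≤m+n 240 1) 241≤r)
      31≤k : 31 ≤ k
      31≤k = s≤s 30≤j
      r≡ : r ≡ r % 8 + j * 8
      r≡ = m≡m%n+[m/n]*n r 8
      r<8k : suc r ≤ 8 * k
      r<8k = subst₂ _<_ (sym r≡) (*-comm k 8) (+-monoˡ-< (j * 8) (m%n<n r 8))
      gap≤ : 9 * (suc r + double k) ≤ 49 * suc (double k)
      gap≤ = bound k (double k) (suc r) (double≡ k) r<8k
        where
        bound : ∀ k t D → t ≡ 2 * k → D ≤ 8 * k → 9 * (D + t) ≤ 49 * suc t
        bound k _ D refl D≤ = begin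
          9 * (D + 2 * k)                    ≤⟨ *-monoʳ-≤ 9 (+-monoˡ-≤ (2 * k) D≤) ⟩
          9 * (8 * k + 2 * k)                ≤⟨ m≤m+n (9 * (8 * k + 2 * k)) (49 + 8 * k) ⟩
          9 * (8 * k + 2 * k) + (49 + 8 * k) ≡⟨ identity k ⟩
          49 * (1 + 2 * k)                   ∎
          where
          open ≤-Reasoning
          identity : ∀ k → 9 * (8 * k + 2 * k) + (49 + 8 * k) ≡ 49 * (1 + 2 * k)
          identity = solve-∀
      e = 49 * suc (double k) ∸ 9 * (suc r + double k)
      gap : 9 * (suc r + double k) + e ≡ 49 * suc (double k)
      gap = m+[n∸m]≡n gap≤
      n-large : 2 ^ (4 * k) < 16 * n
      n-large = subst (_< 16 * n) (sym (2^4+ j)) (*-monoʳ-< 16 (≤-<-trans (begin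
          2 ^ (4 * j)             ≤⟨ twice-minus (2 ^ (4 * j)) (≤-trans {2} ≤-refl (^-monoʳ-≤ 2 {1} {4 * j} (≤-trans (s≤s z≤n) (≤-trans 30≤j (m≤m+n j (3 * j)))))) ⟩
          2 * 2 ^ (4 * j) ∸ 2     ≡⟨ m-even (4 * j) ⟨
          m (2 * (4 * j))         ≤⟨ m-mono (≤-trans {2} {30} (s≤s (s≤s z≤n)) (≤-trans 30≤j (≤-trans (m≤m+n j (3 * j)) (m≤m+n (4 * j) (4 * j + 0))))) (≤-trans (≤-reflexive (trans (sym (*-assoc 2 4 j)) (*-comm 8 j))) (≤-trans (m≤n+m (j * 8) (r % 8)) (≤-reflexive (sym r≡)))) ⟩
          m r                     ∎) m<n))
        where
        open ≤-Reasoning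
        twice-minus : ∀ x → 2 ≤ x → x ≤ 2 * x ∸ 2
        twice-minus x 2≤x = subst (_≤ 2 * x ∸ 2) (m+n∸n≡m x 2) (∸-monoˡ-≤ 2 (≤-trans (+-monoʳ-≤ x 2≤x) (≤-reflexive (cong (x +_) (sym (+-identityʳ x))))))

    regime-contradiction : 47 ≤ r → m r < n → ⊥
    regime-contradiction 47≤r m<n with r <? 61 | r <? 241
    -- Here 4369 = 601 · 13² - 300 · 18² and 46331 = 300 · 13² - 4369; likewise in the next case 325
    -- = 601 · 5² - 300 · 7² and 7175 = 300 · 5² - 325.
    ... | yes r<61 | _ = check-contradiction 5 13 4369 46331 (m≤m+n 1 12) (m≤m+n 5 8) (m≤m+n 100 17) refl refl (kᴵ r)
            (checked (λ r → I.check (kᴵ r) r) 47 14 check-I r 47≤r r<61) m<n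
    ... | no r≮61 | yes r<241 = check-contradiction 2 5 325 7175 (m≤m+n 1 4) (m≤m+n 2 3) (m≤m+n 40 5) refl refl (kᴵᴵ r)
            (checked (λ r → II.check (kᴵᴵ r) r) 61 180 check-II r (≮⇒≥ r≮61) r<241) m<n
    ... | no _ | no r≮241 = contradiction-III (≮⇒≥ r≮241) m<n

-- Least counterexamples: distances by parity of the rank, and the case distinction.

open RatSum using (0#; ι; ι-suc≢0)
open LinAlg using (Proj; Fix)
open Count
open GraphRank using (rowK; hasRank⇒Proj; fromDefs)
open Bounds
open Structure using (Maximal; exists-maximal; module Core; xor-true)
open Twins using (module TwinClasses)
open Signed using (plotkin; distL)
open Caps using (all)
open Growth using (m-drop-3; m-half)
open Regimes using (regime-contradiction)
open import Data.Nat hiding (parity)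
open import Data.Nat.Properties
open import Data.Nat.Induction using (<-rec)
open import Data.Nat.Tactic.RingSolver using (solve-∀)
import Data.Fin.Properties as FinP
open import Data.Bool using (true; false; not; _∧_; _xor_)
import Data.Bool.Properties as BoolP
open import Data.Product using (∃; _,_; proj₁; proj₂)
open import Data.Sum using (inj₁; inj₂)
open import Data.Empty using (⊥; ⊥-elim)
open import Function using (_∘_)
open import Relation.Nullary using (yes; no)
open import Relation.Nullary.Negation using (contradiction)
open import Relation.Binary.PropositionalEquality hiding ([_])

m-drop : ∀ ρ → 44 ≤ ρ → 2 * m ρ + 8 * (4 + ρ) + 1 ≤ m (3 + ρ)
m-drop ρ 44≤ρ = subst (λ ρ → 2 * m ρ + 8 * (4 + ρ) + 1 ≤ m (3 + ρ)) (m+[n∸m]≡n 44≤ρ) (m-drop-3 (ρ ∸ 44))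

m-half-rank : ∀ g → 22 ≤ g → m (3 + g) * 1200 + 1200 < 2 ^ g * 5
m-half-rank g 22≤g = subst (λ g → m (3 + g) * 1200 + 1200 < 2 ^ g * 5) (m+[n∸m]≡n 22≤g) (m-half (g ∸ 22))

m-even′ : ∀ h → m (2 * h) + 2 ≡ 2 * 2 ^ h
m-even′ h = trans (cong (_+ 2) (m-even h)) (m∸n+n≡m (*-monoʳ-≤ 2 (1≤2^ h)))

m-odd′ : ∀ h → m (3 + 2 * h) + 2 ≡ 5 * 2 ^ h
m-odd′ h = trans (cong (_+ 2) (m-odd h)) (m∸n+n≡m (≤-trans (m≤m+n 2 3) (*-monoʳ-≤ 5 (1≤2^ h))))

-- M = m(r) and M′ = m(r - 1) for even r, with x = 2^(r/2 - 2). Their ratio is about 5/8, so d takes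
-- up 3/8 of n.
even-distance : ∀ {M M′ x n d} → M + 2 ≡ 8 * x → M′ + 2 ≡ 5 * x → M < n → n ≤ d + M′ → 3 * n ≤ 8 * d
even-distance {M} {M′} {x} {n} {d} eq eq′ M<n n≤ = +-cancelʳ-≤ (5 * n + 16) (3 * n) (8 * d) (begin
  3 * n + (5 * n + 16)          ≡⟨ identity₁ n ⟩
  8 * (n + 2)                   ≤⟨ *-monoʳ-≤ 8 (+-monoˡ-≤ 2 n≤) ⟩
  8 * (d + M′ + 2)              ≡⟨ cong (8 *_) (trans (+-assoc d M′ 2) (cong (d +_) eq′)) ⟩
  8 * (d + 5 * x)               ≡⟨ identity₂ d x ⟩
  8 * d + 5 * (8 * x)           ≡⟨ cong (λ z → 8 * d + 5 * z) eq ⟨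
  8 * d + 5 * (M + 2)           ≡⟨ cong (λ z → 8 * d + 5 * z) (+-suc M 1) ⟩
  8 * d + 5 * (suc M + 1)       ≤⟨ +-monoʳ-≤ (8 * d) (*-monoʳ-≤ 5 (+-monoˡ-≤ 1 M<n)) ⟩
  8 * d + 5 * (n + 1)           ≤⟨ m≤m+n _ 11 ⟩
  8 * d + 5 * (n + 1) + 11      ≡⟨ identity₃ d n ⟩
  8 * d + (5 * n + 16)          ∎)
  where
  open ≤-Reasoning
  identity₁ : ∀ n → 3 * n + (5 * n + 16) ≡ 8 * (n + 2)
  identity₁ = solve-∀
  identity₂ : ∀ d x → 8 * (d + 5 * x) ≡ 8 * d + 5 * (8 * x)
  identity₂ = solve-∀
  identity₃ : ∀ d n → 8 * d + 5 * (n + 1) + 11 ≡ 8 * d + (5 * n + 16)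
  identity₃ = solve-∀

-- M = m(r) and M′ = m(r - 1) for odd r, with x = 2^((r - 3)/2). Their ratio is about 4/5, which
-- leaves only 1/5 of n for d.
odd-distance : ∀ {M M′ x n d} → M + 2 ≡ 5 * x → M′ + 2 ≡ 4 * x → M < n → n ≤ d + M′ → n ≤ 5 * d
odd-distance {M} {M′} {x} {n} {d} eq eq′ M<n n≤ = +-cancelʳ-≤ (4 * n + 10) n (5 * d) (begin
  n + (4 * n + 10)              ≡⟨ identity₁ n ⟩
  5 * (n + 2)                   ≤⟨ *-monoʳ-≤ 5 (+-monoˡ-≤ 2 n≤) ⟩
  5 * (d + M′ + 2)              ≡⟨ cong (5 *_) (trans (+-assoc d M′ 2) (cong (d +_) eq′)) ⟩
  5 * (d + 4 * x)               ≡⟨ identity₂ d x ⟩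
  5 * d + 4 * (5 * x)           ≡⟨ cong (λ z → 5 * d + 4 * z) eq ⟨
  5 * d + 4 * (M + 2)           ≡⟨ cong (λ z → 5 * d + 4 * z) (+-suc M 1) ⟩
  5 * d + 4 * (suc M + 1)       ≤⟨ +-monoʳ-≤ (5 * d) (*-monoʳ-≤ 4 (+-monoˡ-≤ 1 M<n)) ⟩
  5 * d + 4 * (n + 1)           ≤⟨ m≤m+n _ 6 ⟩
  5 * d + 4 * (n + 1) + 6       ≡⟨ identity₃ d n ⟩
  5 * d + (4 * n + 10)          ∎)
  where
  open ≤-Reasoning
  identity₁ : ∀ n → n + (4 * n + 10) ≡ 5 * (n + 2)
  identity₁ = solve-∀
  identity₂ : ∀ d x → 5 * (d + 4 * x) ≡ 5 * d + 4 * (5 * x)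
  identity₂ = solve-∀
  identity₃ : ∀ d n → 5 * d + 4 * (n + 1) + 6 ≡ 5 * d + (4 * n + 10)
  identity₃ = solve-∀

odd-defect : ∀ {M M′ x n t} → M + 2 ≡ 5 * x → M′ + 2 ≡ 4 * x → M < n → n < t + M′ → x < t
odd-defect {M} {M′} {x} {n} {t} eq eq′ M<n n< = +-cancelʳ-≤ (4 * x) (suc x) t (begin
  suc (5 * x)      ≡⟨ cong suc eq ⟨
  suc (M + 2)      ≤⟨ +-monoˡ-≤ 2 M<n ⟩
  n + 2            ≤⟨ +-monoˡ-≤ 2 (<⇒≤ n<) ⟩
  t + M′ + 2       ≡⟨ trans (+-assoc t M′ 2) (cong (t +_) eq′) ⟩
  t + 4 * x        ∎)
  where open ≤-Reasoning

separated-5 : ∀ {n d} → n ≤ 5 * d → 20 * n ≤ 12 * n + 20 * (2 * d)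
separated-5 {n} {d} h = begin
  20 * n                ≡⟨ identity₁ n ⟩
  12 * n + 8 * n        ≤⟨ +-monoʳ-≤ (12 * n) (*-monoʳ-≤ 8 h) ⟩
  12 * n + 8 * (5 * d)  ≡⟨ identity₂ n d ⟩
  12 * n + 20 * (2 * d) ∎
  where
  open ≤-Reasoning
  identity₁ : ∀ n → 20 * n ≡ 12 * n + 8 * n
  identity₁ = solve-∀
  identity₂ : ∀ n d → 12 * n + 8 * (5 * d) ≡ 12 * n + 20 * (2 * d)
  identity₂ = solve-∀

triple-even : ∀ {n a b c} → 3 * n ≤ 8 * a → 3 * n ≤ 8 * b → 3 * n ≤ 8 * c → 599 * n ≤ 600 * (a + b + c)
triple-even {n} {a} {b} {c} ha hb hc = begin
  599 * n                          ≤⟨ *-monoˡ-≤ n (m≤m+n 599 76) ⟩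
  675 * n                          ≡⟨ identity₁ n 75 ⟩
  75 * (3 * n + 3 * n + 3 * n)     ≤⟨ *-monoʳ-≤ 75 (+-mono-≤ (+-mono-≤ ha hb) hc) ⟩
  75 * (8 * a + 8 * b + 8 * c)     ≡⟨ identity₂ a b c 75 ⟩
  600 * (a + b + c)                ∎
  where
  open ≤-Reasoning
  identity₁ : ∀ n z → 9 * z * n ≡ z * (3 * n + 3 * n + 3 * n)
  identity₁ = solve-∀
  identity₂ : ∀ a b c z → z * (8 * a + 8 * b + 8 * c) ≡ 8 * z * (a + b + c)
  identity₂ = solve-∀

-- The sum `s` of three distances is at least 2t ≥ n - 2a, where `a` is the size of a twin class and
-- 2a ≤ n/(z + 1).
triple-odd : ∀ z {n t a s} → n + 1 ≤ 2 * t + 2 * a → 2 * a * suc z ≤ n → 2 * t ≤ s → z * n ≤ suc z * s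
triple-odd z {n} {t} {a} {s} h ha hs = +-cancelʳ-≤ (2 * a * suc z) (z * n) (suc z * s) (begin
  z * n + 2 * a * suc z       ≤⟨ +-monoʳ-≤ (z * n) ha ⟩
  z * n + n                   ≡⟨ +-comm (z * n) n ⟩
  suc z * n                   ≤⟨ *-monoʳ-≤ (suc z) (≤-trans (m≤m+n n 1) (≤-trans h (+-monoˡ-≤ (2 * a) hs))) ⟩
  suc z * (s + 2 * a)         ≡⟨ identity z s a ⟩
  suc z * s + 2 * a * suc z   ∎)
  where
  open ≤-Reasoning
  identity : ∀ z s a → (1 + z) * (s + 2 * a) ≡ (1 + z) * s + 2 * a * (1 + z)
  identity = solve-∀

empty-count : ∀ {n} {p : Pred n} → (∀ x → p x ≢ true) → count p ≡ 0
empty-count {n} {p} h with 1 ≤? count p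
... | yes 1≤ = ⊥-elim (let (x , px) = find {p = p} 1≤ in h x px)
... | no 1≰  = n<1⇒n≡0 (≰⇒> 1≰)

count-outside : ∀ {n} (p q : Pred n) → (∀ x → p x ≡ true → q x ≡ true → ⊥) →
  count (λ x → not (p x) ∧ not (q x)) + (count p + count q) ≡ n
count-outside {n} p q disjoint = begin
  l + (count p + count q)  ≡⟨ identity l (count p) (count q) ⟩
  count p + (count q + l)  ≡⟨ cong (λ z → count p + (z + l)) (count-cong same) ⟩
  count p + (count (λ x → not (p x) ∧ q x) + l) ≡⟨ cong (count p +_) (count-split (not ∘ p) q) ⟨
  count p + count (not ∘ p) ≡⟨ count-not p ⟩
  n ∎
  where
  open ≡-Reasoning
  l : ℕ
  l = count (λ x → not (p x) ∧ not (q x))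
  identity : ∀ l a b → l + (a + b) ≡ a + (b + l)
  identity = solve-∀
  same : ∀ x → q x ≡ not (p x) ∧ q x
  same x with p x in px | q x in qx
  ... | true  | true  = ⊥-elim (disjoint x px qx)
  ... | true  | false = refl
  ... | false | _     = refl

module Counterexample {n r₂} (G : Graph n) (red : Reduced G) (hr : HasRank G (2 + r₂)) (P : Proj n (2 + r₂)) (fR : ∀ u → Fix P (rowK G u))
  (M : Maximal G r₂) (45≤r₂ : 45 ≤ r₂) (bounds : ∀ ρ → 2 ≤ ρ → ρ ≤ suc r₂ → Bounded ρ) (m<n : m (2 + r₂) < n) where

  open Core G red P fR M using (K; t₂; dist; dist-bound; triple-dist; n≡; module Halving; halve)

  2≤r₂ : 2 ≤ r₂
  2≤r₂ = ≤-trans {2} {45} (s≤s (s≤s z≤n)) 45≤r₂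

  large : 2 * m r₂ + 3 ≤ n
  large = subst (_≤ n) (trans (cong suc (m-double r₂ 2≤r₂)) (sym (+-suc (2 * m r₂) 2))) m<n

  -- A core containing every vertex would give the whole graph rank at most r - 2.
  defect : ∃ λ d → K d ≡ false
  defect with FinP.any? (λ d → K d BoolP.≟ false)
  ... | yes w = w
  ... | no h  = contradiction (Maximal.rank M (2 + r₂) (proj₁ (proj₁ hr)) (λ i → full _)
      (λ c z → fromDefs G (proj₁ (proj₁ hr)) (proj₂ (proj₁ hr)) c (λ j → z j (full j)))) (<⇒≱ (n≤1+n (suc r₂)))
    where
    full : ∀ x → K x ≡ true
    full x = not-false (λ Kx → h (x , Kx))

  n≢0 : ι n ≢ 0#
  n≢0 = positive m<n
    where
    positive : ∀ {k n} → k < n → ι n ≢ 0#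
    positive {n = suc n} _ = ι-suc≢0 n

  module TC = TwinClasses G red P fR M (bounds r₂ 2≤r₂ (n≤1+n r₂)) large (proj₁ defect) (proj₂ defect)
  open TC using (X; X-K; X-side; u; u<t₂; t₂-large; count-core; X-bound; Y; Y-constant; X-rank; X-rank-3; large-class)

  -- The number of vertices exceeds any bound linear in the rank that a Plotkin-type argument could
  -- give here.
  few : 8 * (3 + r₂) < n
  few = go r₂ 45≤r₂ m<n
    where
    go : ∀ r → 45 ≤ r → m (2 + r) < n → 8 * (3 + r) < n
    go (suc ρ) (s≤s 44≤ρ) h = <-trans (≤-trans (≤-trans (≤-reflexive (+-comm 1 _)) (+-monoˡ-≤ 1 (m≤n+m (8 * (4 + ρ)) (2 * m ρ)))) (m-drop ρ 44≤ρ)) h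

  module _ (le : t₂ + m (suc r₂) ≤ n) where

    far : ∀ v w → v ≢ w → t₂ ≤ dist v w
    far v w v≢w with dist-bound (bounds (suc r₂) (m≤n⇒m≤1+n 2≤r₂) ≤-refl) v w v≢w
    ... | inj₁ h = h
    ... | inj₂ h = +-cancelʳ-≤ (m (suc r₂)) t₂ (dist v w) (≤-trans le h)

    -- Without twins `t₂-large` gives 2t > n, so all rows pairwise differ in more than half of the
    -- places.
    far-untwinned : count (X true) ≡ 0 → ⊥
    far-untwinned none = <⇒≱ few (≤-trans (≤-trans (≤-reflexive (sym (count-true n)))
        (plotkin G all P fR all apart (subst (1 ≤_) (sym (count-true n)) (≤-trans (s≤s z≤n) m<n)))) (*-monoˡ-≤ (3 + r₂) {2} {8} (m≤m+n 2 6)))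
      where
      apart : ∀ v w → v ≢ w → true ≡ true → true ≡ true → suc (count {n} all) ≤ 2 * dist v w
      apart v w v≢w _ _ = begin
        suc (count {n} all)         ≡⟨ cong suc (count-true n) ⟩
        suc n                       ≡⟨ +-comm 1 n ⟩
        n + 1                       ≤⟨ t₂-large true ⟩
        2 * t₂ + 2 * count (X true) ≡⟨ trans (cong (λ z → 2 * t₂ + 2 * z) none) (+-identityʳ (2 * t₂)) ⟩
        2 * t₂                      ≤⟨ *-monoʳ-≤ 2 (far v w v≢w) ⟩
        2 * dist v w                ∎
        where open ≤-Reasoning

    -- The Plotkin-type bound, applied to a large class `Y`, gives |Y| ≤ 2(r + 1), hence t ≤ 4(r +
    -- 1). The two twin classes have rank at most r - 3 and the remaining u + t vertices number
    -- fewer than 2t, so n is too small.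
    far-twinned : ∀ x₀ → X true x₀ ≡ true → ⊥
    far-twinned x₀ Xx₀ with large-class x₀ Xx₀
    ... | e , t₂≤2y , 2≤y with find₂ {p = Y x₀ Xx₀ e} 2≤y
    ... | d , d′ , d≢d′ , Yd , Yd′ = finish r₂ refl 45≤r₂
      where
      -- Members of `Y` agree on both twin classes, so deleting those columns loses no distance and
      -- leaves only u + t < 2t columns.
      L : Pred n
      L a = not (X true a) ∧ not (X false a)

      distL-dist : ∀ v w → Y x₀ Xx₀ e v ≡ true → Y x₀ Xx₀ e w ≡ true → dist v w ≤ distL G L v w
      distL-dist v w Yv Yw = count-mono {n} {λ a → adj G v a xor adj G w a} {λ a → L a ∧ (adj G v a xor adj G w a)}
          (λ a vw → ∧-intro (∧-intro (outside true a vw) (outside false a vw)) vw)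
        where
        outside : ∀ s a → adj G v a xor adj G w a ≡ true → not (X s a) ≡ true
        outside s a vw = not-intro (not-true (λ Xa → xor-true {adj G v a} {adj G w a} vw
          (trans (Graph.sym G v a) (trans (Y-constant x₀ Xx₀ {s} {e} Yv Yw Xa) (Graph.sym G a w)))))

      count-L : count L ≡ u + t₂
      count-L = +-cancelʳ-≡ (count (X true) + count (X false)) (count L) (u + t₂) (begin
        count L + (count (X true) + count (X false))   ≡⟨ count-outside (X true) (X false) (λ x h h′ → true≢false (X-side h) (X-side h′)) ⟩
        n                                              ≡⟨ n≡ ⟨
        count K + t₂                                   ≡⟨ cong (_+ t₂) count-core ⟩
        count (X true) + count (X false) + u + t₂      ≡⟨ identity (count (X true)) (count (X false)) u t₂ ⟩
        u + t₂ + (count (X true) + count (X false))    ∎)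
        where
        open ≡-Reasoning
        identity : ∀ a b u t → a + b + u + t ≡ u + t + (a + b)
        identity = solve-∀

      y≤ : count (Y x₀ Xx₀ e) ≤ 2 * (3 + r₂)
      y≤ = plotkin G L P fR (Y x₀ Xx₀ e)
        (λ v w v≢w Yv Yw → begin
          suc (count L)          ≡⟨ cong suc count-L ⟩
          suc u + t₂             ≤⟨ +-monoˡ-≤ t₂ u<t₂ ⟩
          t₂ + t₂                ≡⟨ cong (t₂ +_) (+-identityʳ t₂) ⟨
          2 * t₂                 ≤⟨ *-monoʳ-≤ 2 (≤-trans (far v w v≢w) (distL-dist v w Yv Yw)) ⟩
          2 * distL G L v w      ∎)
        (subst (1 ≤_) (sym count-L) (≤-trans (≤-trans (s≤s z≤n) u<t₂) (m≤n+m t₂ u)))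
        where open ≤-Reasoning

      finish : ∀ r → r ≡ r₂ → 45 ≤ r → ⊥
      finish (suc ρ) refl (s≤s 44≤ρ) = <⇒≱ m<n (≤-trans (s≤s⁻¹ (begin
        suc n                                                          ≡⟨ cong suc n≡ ⟨
        suc (count K + t₂)                                             ≡⟨ cong (λ z → suc (z + t₂)) count-core ⟩
        suc (count (X true) + count (X false) + u + t₂)                ≡⟨ identity₁ (count (X true)) (count (X false)) u t₂ ⟩
        count (X true) + count (X false) + (suc u + t₂)                ≤⟨ +-mono-≤ (+-mono-≤ (x≤ true) (x≤ false)) (+-monoˡ-≤ t₂ u<t₂) ⟩
        suc (m ρ) + suc (m ρ) + (t₂ + t₂)                              ≤⟨ +-monoʳ-≤ (suc (m ρ) + suc (m ρ)) (+-mono-≤ t₂≤ t₂≤) ⟩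
        suc (m ρ) + suc (m ρ) + (2 * (2 * (4 + ρ)) + 2 * (2 * (4 + ρ))) ≡⟨ identity₂ (m ρ) ρ ⟩
        suc (2 * m ρ + 8 * (4 + ρ) + 1)                                ∎)) (m-drop ρ 44≤ρ))
        where
        open ≤-Reasoning
        t₂≤ : t₂ ≤ 2 * (2 * (4 + ρ))
        t₂≤ = ≤-trans t₂≤2y (*-monoʳ-≤ 2 y≤)
        x≤ : ∀ s → count (X s) ≤ suc (m ρ)
        x≤ s = X-bound s (bounds ρ (≤-trans {2} {44} (s≤s (s≤s z≤n)) 44≤ρ) (m≤n+m ρ 2)) (X-rank-3 x₀ Xx₀ s e d≢d′ Yd Yd′ ≤-refl)
        identity₁ : ∀ a b u t → 1 + (a + b + u + t) ≡ a + b + (1 + u + t)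
        identity₁ = solve-∀
        identity₂ : ∀ x ρ → 1 + x + (1 + x) + (2 * (2 * (4 + ρ)) + 2 * (2 * (4 + ρ))) ≡ 1 + (2 * x + 8 * (4 + ρ) + 1)
        identity₂ = solve-∀

  module _ (gt : n < t₂ + m (suc r₂)) where

    spread : ∀ v w → v ≢ w → n ≤ dist v w + m (suc r₂)
    spread v w v≢w with dist-bound (bounds (suc r₂) (m≤n⇒m≤1+n 2≤r₂) ≤-refl) v w v≢w
    ... | inj₁ h = ≤-trans (<⇒≤ gt) (+-monoˡ-≤ (m (suc r₂)) h)
    ... | inj₂ h = h

    regimes : (∀ v w → v ≢ w → n ≤ 5 * dist v w) → (∀ v w x → v ≢ w → w ≢ x → v ≢ x → 599 * n ≤ 600 * (dist v w + dist w x + dist v x)) → ⊥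
    regimes sep triple = regime-contradiction G P fR n≢0 (λ v w v≢w → separated-5 {n} {dist v w} (sep v w v≢w)) triple (s≤s (s≤s 45≤r₂)) m<n

    -- Each distance is at least (3/8)n, so separation and the triple condition follow from
    -- distances alone.
    near-even : ∀ g → 2 + r₂ ≡ 2 * (2 + g) → ⊥
    near-even g eq = regimes (λ v w v≢w → weaken {dist v w} (dist-3/8 v w v≢w))
        (λ v w x v≢w w≢x v≢x → triple-even {n} {dist v w} {dist w x} {dist v x} (dist-3/8 v w v≢w) (dist-3/8 w x w≢x) (dist-3/8 v x v≢x))
      where
      eq₁ : m (2 + r₂) + 2 ≡ 8 * 2 ^ g
      eq₁ = trans (cong (λ r → m r + 2) eq) (trans (m-even′ (2 + g)) (identity (2 ^ g)))
        where
        identity : ∀ x → 2 * (2 * (2 * x)) ≡ 8 * x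
        identity = solve-∀
      eq₂ : m (suc r₂) + 2 ≡ 5 * 2 ^ g
      eq₂ = trans (cong (λ r → m r + 2) (suc-injective (trans eq (identity g)))) (m-odd′ g)
        where
        identity : ∀ g → 2 * (2 + g) ≡ 1 + (3 + 2 * g)
        identity = solve-∀
      dist-3/8 : ∀ v w → v ≢ w → 3 * n ≤ 8 * dist v w
      dist-3/8 v w v≢w = even-distance {m (2 + r₂)} {m (suc r₂)} {2 ^ g} {n} {dist v w} eq₁ eq₂ m<n (spread v w v≢w)
      weaken : ∀ {d} → 3 * n ≤ 8 * d → n ≤ 5 * d
      weaken {d} h = *-cancelˡ-≤ 3 (≤-trans h (≤-trans (*-monoˡ-≤ d {8} {15} (m≤m+n 8 7)) (≤-reflexive (*-assoc 3 5 d))))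

    -- Three distances of n/5 do not reach (599/600)n, so the triple condition must come from
    -- `triple-dist` and the smallness of `X true`.
    near-odd : ∀ g → 2 + r₂ ≡ 3 + 2 * g → ⊥
    near-odd g eq = regimes (λ v w v≢w → odd-distance {m (2 + r₂)} {m (suc r₂)} {2 ^ g} {n} {dist v w} eq₁ eq₂ m<n (spread v w v≢w))
        (λ v w x v≢w w≢x v≢x → triple-odd 599 {n} {t₂} {count (X true)} (t₂-large true) tiny (triple-dist v w x v≢w w≢x v≢x))
      where
      r₂≡ : r₂ ≡ 1 + 2 * g
      r₂≡ = suc-injective (suc-injective eq)
      22≤g : 22 ≤ g
      22≤g = *-cancelˡ-≤ 2 (s≤s⁻¹ (subst (45 ≤_) r₂≡ 45≤r₂))
      eq₁ : m (2 + r₂) + 2 ≡ 5 * 2 ^ g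
      eq₁ = trans (cong (λ r → m r + 2) eq) (m-odd′ g)
      eq₂ : m (suc r₂) + 2 ≡ 4 * 2 ^ g
      eq₂ = trans (cong (λ r → m r + 2) (trans (cong suc r₂≡) (identity g))) (trans (m-even′ (1 + g)) (sym (*-assoc 2 2 (2 ^ g))))
        where
        identity : ∀ g → 2 + 2 * g ≡ 2 * (1 + g)
        identity = solve-∀

      -- Halving a class of at least t/2 vertices outside the core yields `g` independent rows
      -- vanishing on `X true`, whose rank is then at most r - g = 3 + g.
      class-size : ∀ x₀ (Xx₀ : X true x₀ ≡ true) → count (X true) ≤ suc (m (3 + g))
      class-size x₀ Xx₀ with large-class x₀ Xx₀
      ... | e , t₂≤2y , _ = X-bound true (bounds (3 + g) (s≤s (s≤s z≤n)) small) (X-rank x₀ Xx₀ true e rank)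
        where
        ζ : ℕ
        ζ = Halving.ζ (halve (Y x₀ Xx₀ e))
        small : 3 + g ≤ suc r₂
        small = ≤-trans (+-monoˡ-≤ g (s≤s (s≤s (≤-trans {1} {22} (s≤s z≤n) 22≤g)))) (≤-reflexive (cong suc (trans (cong (λ z → suc (g + z)) (sym (+-identityʳ g))) (sym r₂≡))))
        g≤ζ : g ≤ ζ
        -- From 2^g < t ≤ 2|Y| ≤ 2^(ζ + 1).
        g≤ζ = s≤s⁻¹ (≰⇒> (λ ζ<g → <⇒≱ (<-≤-trans (odd-defect {m (2 + r₂)} {m (suc r₂)} {2 ^ g} {n} {t₂} eq₁ eq₂ m<n gt)
          (≤-trans t₂≤2y (*-monoʳ-≤ 2 (Halving.size (halve (Y x₀ Xx₀ e)))))) (^-monoʳ-≤ 2 ζ<g)))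
        rank : 2 + r₂ ≤ 3 + g + ζ
        rank = ≤-trans (≤-reflexive (trans eq (cong (λ z → 3 + (g + z)) (+-identityʳ g)))) (+-monoʳ-≤ (3 + g) g≤ζ)

      tiny : 2 * count (X true) * 600 ≤ n
      tiny with FinP.any? (λ x → X true x BoolP.≟ true)
      ... | no none = subst (λ a → 2 * a * 600 ≤ n) (sym (empty-count {p = X true} (λ x h → none (x , h)))) z≤n
      ... | yes (x₀ , Xx₀) = bound 600 (count (X true)) (m (3 + g)) (2 ^ g) (class-size x₀ Xx₀) (m-half-rank g 22≤g) eq₁ m<n
        where
        bound : ∀ c a μ x {M} → a ≤ suc μ → μ * (2 * c) + 2 * c < x * 5 → M + 2 ≡ 5 * x → M < n → 2 * a * c ≤ n
        bound c a μ x {M} a≤ h eq M<n = s≤s⁻¹ (begin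
          suc (2 * a * c)              ≤⟨ s≤s (*-monoˡ-≤ c (*-monoʳ-≤ 2 a≤)) ⟩
          suc (2 * suc μ * c)          ≡⟨ cong suc (identity μ c) ⟩
          suc (μ * (2 * c) + 2 * c)    ≤⟨ h ⟩
          x * 5                        ≡⟨ trans (*-comm x 5) (sym eq) ⟩
          M + 2                        ≡⟨ +-suc M 1 ⟩
          suc M + 1                    ≤⟨ +-monoˡ-≤ 1 M<n ⟩
          n + 1                        ≡⟨ +-comm n 1 ⟩
          suc n                        ∎)
          where
          open ≤-Reasoning
          identity : ∀ μ c → 2 * (1 + μ) * c ≡ μ * (2 * c) + 2 * c
          identity = solve-∀

  impossible : ⊥
  impossible with t₂ + m (suc r₂) ≤? n
  ... | no gt = near (parity r₂) (≰⇒> gt)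
    where
    near : Parity r₂ → n < t₂ + m (suc r₂) → ⊥
    near par gt = by-parity par refl
      where
      even-shift : ∀ h → 2 + 2 * (1 + h) ≡ 2 * (2 + h)
      even-shift = solve-∀
      by-parity : ∀ {r} → Parity r → r ≡ r₂ → ⊥
      by-parity (even zero) eq = contradiction (subst (2 ≤_) (sym eq) 2≤r₂) λ ()
      by-parity (even (suc h)) eq = near-even gt h (trans (cong (2 +_) (sym eq)) (even-shift h))
      by-parity (odd h) eq = near-odd gt h (cong (2 +_) (sym eq))
  ... | yes le with FinP.any? (λ x → X true x BoolP.≟ true)
  ...   | no none = far-untwinned le (empty-count {p = X true} (λ x h → none (x , h)))
  ...   | yes (x₀ , Xx₀) = far-twinned le x₀ Xx₀

theorem4p6 :
  (∀ (r : ℕ) → 2 ≤ r → r ≤ 46 →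
    ∀ (n : ℕ) (G : Graph n) → Reduced G → HasRank G r → n ≤ m r) →
  ∀ (r : ℕ) → 2 ≤ r →
    ∀ (n : ℕ) (G : Graph n) → Reduced G → HasRank G r → n ≤ m r
theorem4p6 small = <-rec _ step
  where
  Claim : ℕ → Set
  Claim r = 2 ≤ r → ∀ (n : ℕ) (G : Graph n) → Reduced G → HasRank G r → n ≤ m r
  step : ∀ r → (∀ {ρ} → ρ < r → Claim ρ) → Claim r
  step r IH 2≤r n G red hr with r ≤? 46 | n ≤? m r
  ... | yes r≤46 | _      = small r 2≤r r≤46 n G red hr
  ... | no _     | yes le = le
  ... | no r≰46  | no n≰  = ⊥-elim (refute r IH hr (≰⇒> r≰46) (≰⇒> n≰))
    where
    refute : ∀ r → (∀ {ρ} → ρ < r → Claim ρ) → HasRank G r → 47 ≤ r → m r < n → ⊥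
    refute (suc (suc r₂)) IH hr (s≤s (s≤s 45≤r₂)) m<n = exists-maximal G r₂ λ M →
      Counterexample.impossible G red hr (proj₁ (hasRank⇒Proj G hr)) (proj₂ (hasRank⇒Proj G hr)) M 45≤r₂
        (λ ρ 2≤ρ ρ≤ → bounded ρ 2≤ρ (λ ρ′ 2≤ρ′ ρ′≤ρ → IH (s≤s (≤-trans ρ′≤ρ ρ≤)) 2≤ρ′)) m<n
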